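{- For every positive integer $t$ there exists a finite simple graph $G$ such that $\bar\theta(G)=2$ and $\mathrm{bt}(G)\ge t$, where $\bar\theta(G)$ denotes the geometric thickness of $G$ and $\mathrm{bt}(G)$ denotes the book thickness of $G$.
   Context: All graphs are finite and simple. A straight-line drawing of a graph places the vertices at distinct points of the plane $\mathbb{R}^2$ and draws each edge as the straight line segment between the points representing its endpoints (with the usual convention that an edge passes through no vertex other than its own endpoints). Two edges cross if their segments share a point that is not a common endpoint of the two edges. The geometric thickness $\bar\theta(G)$ of a graph $G$ is the minimum number of layers in a straight-line drawing of $G$ in the plane in which each edge is assigned to a single layer and no two edges in the same layer cross. (Edges in different layers may cross; the vertex positions are the same for all layers.) The book thickness $\mathrm{bt}(G)$ of a graph $G$ is the minimum number of layers in a straight-line drawing of $G$ in the plane in which each edge is assigned to a single layer and no two edges in the same layer cross, with the further restriction that the vertices of $G$ are placed in convex position (i.e. they are the vertices of a strictly convex polygon). -}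

module Defs where

open import Data.Bool using (Bool; true; false; T)
open import Data.Fin as Fin using (Fin)
open import Data.Nat as ℕ using (ℕ; suc)
import Data.Nat.Properties as ℕₚ
open import Data.Product using (Σ; _×_; _,_; proj₁; proj₂; ∃; ∃-syntax; Σ-syntax)
open import Data.Rational as ℚ using (ℚ; 0ℚ; 1ℚ; ½)
import Data.Rational.Properties as ℚₚ
open import Data.Rational.Solver using (module +-*-Solver)
open import Data.Sum using (_⊎_)
open import Data.Vec.Functional using (foldr)
open import Relation.Binary.PropositionalEquality
open import Relation.Nullary using (¬_)

------------------------------------------------------------------------
-- Real numbers: Cauchy sequences of rationals, compared by _≃_

IsCauchy : (ℕ → ℚ) → Set
IsCauchy x = ∀ ε → 0ℚ ℚ.< ε →
  ∃[ N ] (∀ m n → N ℕ.≤ m → N ℕ.≤ n → ℚ.∣ x m ℚ.- x n ∣ ℚ.< ε)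

record ℝ : Set where
  constructor mkℝ
  field
    seq    : ℕ → ℚ
    cauchy : IsCauchy seq

open ℝ public

infix 4 _≃_ _<_ _≤_

_≃_ : ℝ → ℝ → Set
x ≃ y = ∀ ε → 0ℚ ℚ.< ε →
  ∃[ N ] (∀ n → N ℕ.≤ n → ℚ.∣ seq x n ℚ.- seq y n ∣ ℚ.< ε)

-- The positive gap ε is essential: a termwise strict inequality would also
-- hold between representatives of the same real number.
_<_ : ℝ → ℝ → Set
x < y = ∃[ ε ] (0ℚ ℚ.< ε × ∃[ N ] (∀ n → N ℕ.≤ n → seq x n ℚ.+ ε ℚ.≤ seq y n))

_≤_ : ℝ → ℝ → Set
x ≤ y = ¬ (y < x)

fromℚ : ℚ → ℝ
fromℚ q = mkℝ (λ _ → q) λ ε 0<ε → 0 , λ _ _ _ _ →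
  subst (ℚ._< ε) (sym (cong ℚ.∣_∣ (ℚₚ.+-inverseʳ q))) 0<ε

0ℝ 1ℝ : ℝ
0ℝ = fromℚ 0ℚ
1ℝ = fromℚ 1ℚ

private
  half-pos : ∀ {ε} → 0ℚ ℚ.< ε → 0ℚ ℚ.< ½ ℚ.* ε
  half-pos 0<ε = ℚₚ.*-monoʳ-<-pos ½ 0<ε

  half+half : ∀ ε → ½ ℚ.* ε ℚ.+ ½ ℚ.* ε ≡ ε
  half+half ε = trans (sym (ℚₚ.*-distribʳ-+ ε ½ ½)) (ℚₚ.*-identityˡ ε)

  +-cauchy : ∀ x y → IsCauchy x → IsCauchy y → IsCauchy (λ n → x n ℚ.+ y n)
  +-cauchy x y cx cy ε 0<ε =
    let N , hx = cx (½ ℚ.* ε) (half-pos 0<ε)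
        M , hy = cy (½ ℚ.* ε) (half-pos 0<ε)
    in
    N ℕ.⊔ M , λ m n m≥ n≥ → begin-strict
        ℚ.∣ (x m ℚ.+ y m) ℚ.- (x n ℚ.+ y n) ∣
          ≡⟨ cong ℚ.∣_∣ (regroup (x m) (y m) (x n) (y n)) ⟩
        ℚ.∣ (x m ℚ.- x n) ℚ.+ (y m ℚ.- y n) ∣
          ≤⟨ ℚₚ.∣p+q∣≤∣p∣+∣q∣ (x m ℚ.- x n) (y m ℚ.- y n) ⟩
        ℚ.∣ x m ℚ.- x n ∣ ℚ.+ ℚ.∣ y m ℚ.- y n ∣
          <⟨ ℚₚ.+-mono-< (hx m n (ℕₚ.m⊔n≤o⇒m≤o N M m≥) (ℕₚ.m⊔n≤o⇒m≤o N M n≥))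
                         (hy m n (ℕₚ.m⊔n≤o⇒n≤o N M m≥) (ℕₚ.m⊔n≤o⇒n≤o N M n≥)) ⟩
        ½ ℚ.* ε ℚ.+ ½ ℚ.* ε
          ≡⟨ half+half ε ⟩
        ε ∎
    where
    open ℚₚ.≤-Reasoning
    open +-*-Solver
    regroup : ∀ a b c d → (a ℚ.+ b) ℚ.- (c ℚ.+ d) ≡ (a ℚ.- c) ℚ.+ (b ℚ.- d)
    regroup = solve 4 (λ a b c d → (a :+ b) :- (c :+ d) := (a :- c) :+ (b :- d)) refl

  cauchy-bound : ∀ {x} → IsCauchy x →
    ∃[ B ] (0ℚ ℚ.< B × ∃[ N ] (∀ n → N ℕ.≤ n → ℚ.∣ x n ∣ ℚ.≤ B))
  cauchy-bound {x} cx =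
    let N , h = cx 1ℚ (ℚₚ.positive⁻¹ 1ℚ)
    in
      1ℚ ℚ.+ ℚ.∣ x N ∣
    , ℚₚ.+-mono-<-≤ (ℚₚ.positive⁻¹ 1ℚ) (ℚₚ.0≤∣p∣ (x N))
    , N , λ n n≥ → begin
        ℚ.∣ x n ∣
          ≡⟨ cong ℚ.∣_∣ (split (x n) (x N)) ⟩
        ℚ.∣ (x n ℚ.- x N) ℚ.+ x N ∣
          ≤⟨ ℚₚ.∣p+q∣≤∣p∣+∣q∣ (x n ℚ.- x N) (x N) ⟩
        ℚ.∣ x n ℚ.- x N ∣ ℚ.+ ℚ.∣ x N ∣
          ≤⟨ ℚₚ.+-monoˡ-≤ ℚ.∣ x N ∣ (ℚₚ.<⇒≤ (h n N n≥ ℕₚ.≤-refl)) ⟩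
        1ℚ ℚ.+ ℚ.∣ x N ∣ ∎
    where
    open ℚₚ.≤-Reasoning
    open +-*-Solver
    split : ∀ a b → a ≡ (a ℚ.- b) ℚ.+ b
    split = solve 2 (λ a b → a := (a :- b) :+ b) refl

  ∣*∣-bound : ∀ {p q B δ} → 0ℚ ℚ.< B → ℚ.∣ p ∣ ℚ.≤ B → ℚ.∣ q ∣ ℚ.< δ →
              ℚ.∣ p ℚ.* q ∣ ℚ.< B ℚ.* δ
  ∣*∣-bound {p} {q} {B} {δ} 0<B p≤B q<δ = begin-strict
    ℚ.∣ p ℚ.* q ∣          ≡⟨ ℚₚ.∣p*q∣≡∣p∣*∣q∣ p q ⟩
    ℚ.∣ p ∣ ℚ.* ℚ.∣ q ∣    ≤⟨ ℚₚ.*-monoʳ-≤-nonNeg ℚ.∣ q ∣ {{ℚₚ.∣-∣-nonNeg q}} p≤B ⟩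
    B ℚ.* ℚ.∣ q ∣          <⟨ ℚₚ.*-monoʳ-<-pos B {{ℚ.positive 0<B}} q<δ ⟩
    B ℚ.* δ                ∎
    where open ℚₚ.≤-Reasoning

  -- Splits ε as A δ + B δ with δ = ε / (A + B).
  split-ε : ∀ {A B ε} → 0ℚ ℚ.< A → 0ℚ ℚ.< B → 0ℚ ℚ.< ε →
            ∃[ δ ] (0ℚ ℚ.< δ × A ℚ.* δ ℚ.+ B ℚ.* δ ≡ ε)
  split-ε {A} {B} {ε} 0<A 0<B 0<ε = divide (A ℚ.+ B) refl (ℚₚ.+-mono-< 0<A 0<B)
    where
    divide : ∀ C → A ℚ.+ B ≡ C → 0ℚ ℚ.< C →
             ∃[ δ ] (0ℚ ℚ.< δ × A ℚ.* δ ℚ.+ B ℚ.* δ ≡ ε)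
    divide C A+B≡C 0<C =
        (ℚ.1/ C) ℚ.* ε
      , subst (ℚ._< (ℚ.1/ C) ℚ.* ε) (ℚₚ.*-zeroʳ (ℚ.1/ C))
          (ℚₚ.*-monoʳ-<-pos (ℚ.1/ C) 0<ε)
      , (begin
          A ℚ.* ((ℚ.1/ C) ℚ.* ε) ℚ.+ B ℚ.* ((ℚ.1/ C) ℚ.* ε)
            ≡⟨ ℚₚ.*-distribʳ-+ ((ℚ.1/ C) ℚ.* ε) A B ⟨
          (A ℚ.+ B) ℚ.* ((ℚ.1/ C) ℚ.* ε)
            ≡⟨ cong (ℚ._* ((ℚ.1/ C) ℚ.* ε)) A+B≡C ⟩
          C ℚ.* ((ℚ.1/ C) ℚ.* ε)
            ≡⟨ ℚₚ.*-assoc C (ℚ.1/ C) ε ⟨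
          C ℚ.* (ℚ.1/ C) ℚ.* ε
            ≡⟨ cong (ℚ._* ε) (ℚₚ.*-inverseʳ C) ⟩
          1ℚ ℚ.* ε
            ≡⟨ ℚₚ.*-identityˡ ε ⟩
          ε ∎)
      where
      open ≡-Reasoning
      instance
        C-pos : ℚ.Positive C
        C-pos = ℚ.positive 0<C
        C-nonZero : ℚ.NonZero C
        C-nonZero = ℚₚ.pos⇒nonZero C
        1/C-pos : ℚ.Positive (ℚ.1/ C)
        1/C-pos = ℚₚ.1/pos⇒pos C

  product-bound : ∀ {A B δ} a b c d → 0ℚ ℚ.< A → 0ℚ ℚ.< B →
    ℚ.∣ a ∣ ℚ.≤ A → ℚ.∣ d ∣ ℚ.≤ B → ℚ.∣ a ℚ.- c ∣ ℚ.< δ → ℚ.∣ b ℚ.- d ∣ ℚ.< δ →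
    ℚ.∣ a ℚ.* b ℚ.- c ℚ.* d ∣ ℚ.< A ℚ.* δ ℚ.+ B ℚ.* δ
  product-bound {A} {B} {δ} a b c d 0<A 0<B a≤A d≤B a-c<δ b-d<δ = begin-strict
    ℚ.∣ a ℚ.* b ℚ.- c ℚ.* d ∣
      ≡⟨ cong ℚ.∣_∣ (regroup a b c d) ⟩
    ℚ.∣ a ℚ.* (b ℚ.- d) ℚ.+ d ℚ.* (a ℚ.- c) ∣
      ≤⟨ ℚₚ.∣p+q∣≤∣p∣+∣q∣ (a ℚ.* (b ℚ.- d)) (d ℚ.* (a ℚ.- c)) ⟩
    ℚ.∣ a ℚ.* (b ℚ.- d) ∣ ℚ.+ ℚ.∣ d ℚ.* (a ℚ.- c) ∣
      <⟨ ℚₚ.+-mono-< (∣*∣-bound {a} {b ℚ.- d} 0<A a≤A b-d<δ)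
                     (∣*∣-bound {d} {a ℚ.- c} 0<B d≤B a-c<δ) ⟩
    A ℚ.* δ ℚ.+ B ℚ.* δ ∎
    where
    open ℚₚ.≤-Reasoning
    open +-*-Solver
    regroup : ∀ a b c d →
      a ℚ.* b ℚ.- c ℚ.* d ≡ a ℚ.* (b ℚ.- d) ℚ.+ d ℚ.* (a ℚ.- c)
    regroup = solve 4 (λ a b c d → a :* b :- c :* d := a :* (b :- d) :+ d :* (a :- c)) refl

  *-cauchy : ∀ x y → IsCauchy x → IsCauchy y → IsCauchy (λ n → x n ℚ.* y n)
  *-cauchy x y cx cy ε 0<ε =
    let A , 0<A , K , x≤A = cauchy-bound cx
        B , 0<B , L , y≤B = cauchy-bound cy
        δ , 0<δ , total   = split-ε 0<A 0<B 0<ε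
        N , hx            = cx δ 0<δ
        M , hy            = cy δ 0<δ
    in
    (K ℕ.⊔ L) ℕ.⊔ (N ℕ.⊔ M) , λ m n m≥ n≥ →
      let m≥KL = ℕₚ.m⊔n≤o⇒m≤o (K ℕ.⊔ L) (N ℕ.⊔ M) m≥
          n≥KL = ℕₚ.m⊔n≤o⇒m≤o (K ℕ.⊔ L) (N ℕ.⊔ M) n≥
          m≥NM = ℕₚ.m⊔n≤o⇒n≤o (K ℕ.⊔ L) (N ℕ.⊔ M) m≥
          n≥NM = ℕₚ.m⊔n≤o⇒n≤o (K ℕ.⊔ L) (N ℕ.⊔ M) n≥
      in subst (ℚ.∣ x m ℚ.* y m ℚ.- x n ℚ.* y n ∣ ℚ.<_) total
           (product-bound (x m) (y m) (x n) (y n) 0<A 0<B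
             (x≤A m (ℕₚ.m⊔n≤o⇒m≤o K L m≥KL))
             (y≤B n (ℕₚ.m⊔n≤o⇒n≤o K L n≥KL))
             (hx m n (ℕₚ.m⊔n≤o⇒m≤o N M m≥NM) (ℕₚ.m⊔n≤o⇒m≤o N M n≥NM))
             (hy m n (ℕₚ.m⊔n≤o⇒n≤o N M m≥NM) (ℕₚ.m⊔n≤o⇒n≤o N M n≥NM)))

infixl 6 _+_
infixl 7 _*_

_+_ : ℝ → ℝ → ℝ
x + y = mkℝ (λ n → seq x n ℚ.+ seq y n) (+-cauchy (seq x) (seq y) (cauchy x) (cauchy y))

_*_ : ℝ → ℝ → ℝ
x * y = mkℝ (λ n → seq x n ℚ.* seq y n) (*-cauchy (seq x) (seq y) (cauchy x) (cauchy y))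

∑ : ∀ {n} → (Fin n → ℝ) → ℝ
∑ = foldr _+_ 0ℝ

------------------------------------------------------------------------
-- The plane

ℝ² : Set
ℝ² = ℝ × ℝ

infix 4 _≈_ _∈[_,_]

_≈_ : ℝ² → ℝ² → Set
(x , y) ≈ (x′ , y′) = x ≃ x′ × y ≃ y′

infixr 7 _·_

_·_ : ℝ → ℝ² → ℝ²
s · (x , y) = s * x , s * y

infixl 6 _⊕_

_⊕_ : ℝ² → ℝ² → ℝ²
(x , y) ⊕ (x′ , y′) = x + x′ , y + y′

_∈[_,_] : ℝ² → ℝ² → ℝ² → Set
p ∈[ a , b ] = ∃[ s ] ∃[ t ] (0ℝ ≤ s × 0ℝ ≤ t × s + t ≃ 1ℝ × p ≈ s · a ⊕ t · b)

-- p lies in the convex hull of the points P w with w ≠ v.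
InHullWithout : ∀ {n} → (Fin n → ℝ²) → Fin n → ℝ² → Set
InHullWithout {n} P v p = Σ[ μ ∈ (Fin n → ℝ) ]
  ( (∀ w → 0ℝ ≤ μ w)
  × μ v ≃ 0ℝ
  × ∑ μ ≃ 1ℝ
  × p ≈ (∑ (λ w → μ w * proj₁ (P w)) , ∑ (λ w → μ w * proj₂ (P w))) )

-- Each point is an extreme point of the convex hull of the family, i.e. the
-- points are the vertices of a strictly convex polygon.
ConvexPosition : ∀ {n} → (Fin n → ℝ²) → Set
ConvexPosition P = ∀ v → ¬ InHullWithout P v (P v)

------------------------------------------------------------------------
-- Finite simple graphs

record Graph : Set where
  field
    order  : ℕ
    adj    : Fin order → Fin order → Bool
    symm   : ∀ u v → adj u v ≡ adj v u
    irrefl : ∀ v → adj v v ≡ false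

  Vertex : Set
  Vertex = Fin order

  -- The ordering of the endpoints makes every undirected edge occur exactly
  -- once; both proof fields are propositions, so e ≢ f says that e and f
  -- have different endpoint sets.
  record Edge : Set where
    constructor edge
    field
      src tgt  : Vertex
      src<tgt  : src Fin.< tgt
      adjacent : T (adj src tgt)

  _isEndOf_ : Vertex → Edge → Set
  w isEndOf e = w ≡ Edge.src e ⊎ w ≡ Edge.tgt e

------------------------------------------------------------------------
-- Straight-line drawings and layers

module _ (G : Graph) where
  open Graph G

  record Drawing : Set where
    field
      pos : Vertex → ℝ²

    _onEdge_ : ℝ² → Edge → Set
    p onEdge e = p ∈[ pos (Edge.src e) , pos (Edge.tgt e) ]

    field
      distinct : ∀ u v → u ≢ v → ¬ (pos u ≈ pos v)
      avoids   : ∀ e w → ¬ (w isEndOf e) → ¬ (pos w onEdge e)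

    Cross : Edge → Edge → Set
    Cross e f = ∃[ p ] (p onEdge e × p onEdge f ×
      ¬ (∃[ w ] (w isEndOf e × w isEndOf f × p ≈ pos w)))

    IsLayering : ∀ {k} → (Edge → Fin k) → Set
    IsLayering layer = ∀ e f → e ≢ f → layer e ≡ layer f → ¬ Cross e f

  open Drawing

  DrawableIn : ℕ → Set
  DrawableIn k = Σ[ D ∈ Drawing ] Σ[ layer ∈ (Edge → Fin k) ] IsLayering D layer

  ConvexDrawableIn : ℕ → Set
  ConvexDrawableIn k = Σ[ D ∈ Drawing ]
    (ConvexPosition (pos D) × Σ[ layer ∈ (Edge → Fin k) ] IsLayering D layer)

------------------------------------------------------------------------
-- Geometric thickness and book thickness

-- t ≤min S says that the minimum of the set S ⊆ ℕ is at least t.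
infix 4 _≤min_

_≤min_ : ℕ → (ℕ → Set) → Set
t ≤min S = ∀ k → S k → t ℕ.≤ k

IsMin : (ℕ → Set) → ℕ → Set
IsMin S k = S k × k ≤min S

GeometricThickness≡ : Graph → ℕ → Set
GeometricThickness≡ G = IsMin (DrawableIn G)

-- Stated as a lower bound on all layer counts: computing the minimum itself
-- would require deciding ConvexDrawableIn.  The two readings agree because
-- the set is nonempty: on a circle, with one layer per edge, every graph has
-- a convex drawing.
BookThickness≥ : Graph → ℕ → Set
BookThickness≥ G t = t ≤min ConvexDrawableIn G

{-# OPTIONS --safe #-}
-- Subdivide every edge of K_{p,q} once, and put a K₅ beside it.  One layer holds the
-- stars of the vertices of one side, the other layer those of the other side: with
-- the subdivision vertices on a grid, these stars lie in disjoint vertical and in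
-- disjoint horizontal strips.  One layer is not enough, for by a parity count some
-- four of five points in general position are in convex position.
--
-- In a convex drawing with few layers, the pigeonhole principle gives a K_{3,3} with
-- all edges at one side in one layer and all edges at the other side in one layer.
-- Modulo two, the number of crossings of two chords is bilinear in the cyclic order of
-- the points, and the total number of crossings of independent edges comes out odd, as
-- in the Hanani-Tutte proof that K_{3,3} is not planar.
--
-- Points in convex position are compared by signs of determinants, which are decided
-- only under a double negation; the goal there is a contradiction.

module Submission where

open import Data.Bool using (true; false; _xor_; _≟_; Bool; not; if_then_else_; T)
open import Data.Bool.Properties using (xor-∧-commutativeRing; ¬-not; T-irrelevant)
open import Data.Empty using (⊥-elim; ⊥)
open import Data.Fin as Fin using (Fin; zero; suc; toℕ)
open import Data.Fin.Patterns using (0F; 1F; 2F; 3F; 4F)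
import Data.Fin.Properties as Finₚ
open import Data.Nat as ℕ using (ℕ; z≤n; s≤s)
import Data.Nat.Properties as ℕₚ
open import Data.Product using (_×_; _,_; proj₁; proj₂; ∃; ∃-syntax; ∃₂; Σ-syntax)
open import Data.Rational as ℚ using (ℚ; 0ℚ; 1ℚ; ½)
import Data.Rational.Properties as ℚₚ
open import Data.Sum using (_⊎_; inj₁; inj₂)
open import Function using (_∘_; _↔_; mk↔ₛ′; Inverse)
open import Relation.Binary.Definitions using (tri<; tri≈; tri>)
open import Relation.Binary.PropositionalEquality
open import Relation.Nullary using (¬_; yes; no; does; Dec; ¬?)
open import Relation.Nullary.Decidable
  using (dec⇒maybe; dec-true; dec-false; decidable-stable; from-yes; _→-dec_; _⊎-dec_; _×-dec_;
         toWitness; toWitnessFalse; ⌊_⌋; fromWitness; fromWitnessFalse)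
open import Tactic.RingSolver using (solve-∀)
open import Tactic.RingSolver.Core.AlmostCommutativeRing using (AlmostCommutativeRing; fromCommutativeRing)

-- The two halves of a subdivided edge may lie in different layers, so nothing restricts the
-- crossings between `a`-halves and `b`-halves. The parity argument has to survive this. For either
-- family alone, the sum over independent pairs loses every term with a centre and keeps only the
-- relative order of the subdivision vertices. The two families thus give two sums over the same
-- pairs of subdivision vertices, which contradict each other without an `a`-half ever being
-- compared with a `b`-half. All geometry enters through signs of determinants of triples. For four
-- points in general position, the xor of the four signs is even when two segments spanned by them
-- cross and odd when one point lies in the triangle of the others. Convexity makes every quadruple
-- even, which gives the crossing formula; a crossing-free `K₅` would make every quadruple odd. The
-- edges of `K₅` join all pairs of its vertices, so the condition that edges avoid other vertices
-- puts its points in general position. A colour is the pair of layers of the two halves of an edge,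
-- hence the `t * t` colours that fix the size of the graph.

-- Polynomial identities over the rationals.

module Identities where

  open import Data.Rational using (0ℚ; 1ℚ; _+_; _*_; _-_; -_)

  ring : AlmostCommutativeRing _ _
  ring = fromCommutativeRing ℚₚ.+-*-commutativeRing (λ p → dec⇒maybe (0ℚ ℚₚ.≟ p))

  normalised-sum : ∀ r a b c d → (r * a - 1ℚ) - r * (a + b + c + d) ≡ r * - b + r * - c + r * - d - 1ℚ
  normalised-sum = solve-∀ ring

  normalised-combination : ∀ r a b c d p q s t →
    r * (a * p + b * q + c * s + d * t) - p * (r * a - 1ℚ) ≡
    p - (r * - b * q + r * - c * s + r * - d * t)
  normalised-combination = solve-∀ ring

  opposite-sum : ∀ r a b c d → (r * (a + b) - 1ℚ) - r * (a + b + c + d) ≡ r * - c + r * - d - 1ℚ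
  opposite-sum = solve-∀ ring

  opposite-combination : ∀ r a b c d p q s t →
    r * (a * p + b * q + c * s + d * t) ≡ r * a * p + r * b * q - (r * - c * s + r * - d * t)
  opposite-combination = solve-∀ ring

  neg-sum : ∀ a b c d → - (a + b + c + d) ≡ - a + - b + - c + - d
  neg-sum = solve-∀ ring

  neg-combination : ∀ a b c d p q s t →
    - (a * p + b * q + c * s + d * t) ≡ - a * p + - b * q + - c * s + - d * t
  neg-combination = solve-∀ ring

  rotate : ∀ a b c d → a + b + c + d ≡ b + c + d + a
  rotate = solve-∀ ring

  -- Cofactor expansion of a 4×4 determinant with a repeated column: the rows are the points in
  -- homogeneous coordinates (1, first, second), preceded by a copy of one of these three columns.
  -- The next two identities repeat the other columns.
  det-sum : ∀ x₁ x₂ y₁ y₂ z₁ z₂ w₁ w₂ →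
    let det = λ x₁ x₂ y₁ y₂ z₁ z₂ → (y₁ - x₁) * (z₂ - x₂) - (z₁ - x₁) * (y₂ - x₂) in
    det y₁ y₂ z₁ z₂ w₁ w₂ + - det x₁ x₂ z₁ z₂ w₁ w₂ + det x₁ x₂ y₁ y₂ w₁ w₂ + - det x₁ x₂ y₁ y₂ z₁ z₂ ≡ 0ℚ
  det-sum = solve-∀ ring

  det-combination₁ : ∀ x₁ x₂ y₁ y₂ z₁ z₂ w₁ w₂ →
    let det = λ x₁ x₂ y₁ y₂ z₁ z₂ → (y₁ - x₁) * (z₂ - x₂) - (z₁ - x₁) * (y₂ - x₂) in
    det y₁ y₂ z₁ z₂ w₁ w₂ * x₁ + - det x₁ x₂ z₁ z₂ w₁ w₂ * y₁
      + det x₁ x₂ y₁ y₂ w₁ w₂ * z₁ + - det x₁ x₂ y₁ y₂ z₁ z₂ * w₁ ≡ 0ℚ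
  det-combination₁ = solve-∀ ring

  det-combination₂ : ∀ x₁ x₂ y₁ y₂ z₁ z₂ w₁ w₂ →
    let det = λ x₁ x₂ y₁ y₂ z₁ z₂ → (y₁ - x₁) * (z₂ - x₂) - (z₁ - x₁) * (y₂ - x₂) in
    det y₁ y₂ z₁ z₂ w₁ w₂ * x₂ + - det x₁ x₂ z₁ z₂ w₁ w₂ * y₂
      + det x₁ x₂ y₁ y₂ w₁ w₂ * z₂ + - det x₁ x₂ y₁ y₂ z₁ z₂ * w₂ ≡ 0ℚ
  det-combination₂ = solve-∀ ring

  det-swap : ∀ x₁ x₂ y₁ y₂ z₁ z₂ →
    - ((y₁ - x₁) * (z₂ - x₂) - (z₁ - x₁) * (y₂ - x₂)) ≡ (z₁ - x₁) * (y₂ - x₂) - (y₁ - x₁) * (z₂ - x₂)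
  det-swap = solve-∀ ring

  difference-sum : ∀ x y z → (y - z) + (z - x) + (x - y) ≡ 0ℚ
  difference-sum = solve-∀ ring

  difference-combination : ∀ x y z → (y - z) * x + (z - x) * y + (x - y) * z ≡ 0ℚ
  difference-combination = solve-∀ ring

  difference-det₁ : ∀ x₁ x₂ y₁ y₂ z₁ z₂ →
    - ((y₁ - x₁) * (z₂ - x₂) - (z₁ - x₁) * (y₂ - x₂)) ≡
    (y₁ - z₁) * x₂ + (z₁ - x₁) * y₂ + (x₁ - y₁) * z₂
  difference-det₁ = solve-∀ ring

  difference-det₂ : ∀ x₁ x₂ y₁ y₂ z₁ z₂ →
    (y₁ - x₁) * (z₂ - x₂) - (z₁ - x₁) * (y₂ - x₂) ≡
    (y₂ - z₂) * x₁ + (z₂ - x₂) * y₁ + (x₂ - y₂) * z₁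
  difference-det₂ = solve-∀ ring

  neg-difference : ∀ x y → - (x - y) ≡ y - x
  neg-difference = solve-∀ ring

  opposite-of-third : ∀ a b c → (a + c) + - (a + b + c) ≡ - b
  opposite-of-third = solve-∀ ring

  neg-sum₃ : ∀ a b c → - (a + b + c) ≡ - a + - b + - c
  neg-sum₃ = solve-∀ ring

  neg-combination₃ : ∀ a b c p q s → - (a * p + b * q + c * s) ≡ - a * p + - b * q + - c * s
  neg-combination₃ = solve-∀ ring

  rotate₃ : ∀ a b c → a + b + c ≡ b + c + a
  rotate₃ = solve-∀ ring

  pad : ∀ a b → a + 0ℚ * b ≡ a
  pad = solve-∀ ring

  merge : ∀ p α β γ y z → p - (α * y + β * z + γ * z) ≡ p - (α * y + (β + γ) * z)
  merge = solve-∀ ring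

  common-endpoint : ∀ a₁ a₂ b₁ b₂ c₁ c₂ p₁ p₂ s t s′ t′ →
    (b₁ - a₁) * (((p₂ - (s * a₂ + t * b₂)) + a₂ * (s + t - 1ℚ)) - ((p₂ - (s′ * a₂ + t′ * c₂)) + a₂ * (s′ + t′ - 1ℚ)))
    - (b₂ - a₂) * (((p₁ - (s * a₁ + t * b₁)) + a₁ * (s + t - 1ℚ)) - ((p₁ - (s′ * a₁ + t′ * c₁)) + a₁ * (s′ + t′ - 1ℚ)))
    ≡ ((b₁ - a₁) * (c₂ - a₂) - (c₁ - a₁) * (b₂ - a₂)) * t′
  common-endpoint = solve-∀ ring

  at-endpoint : ∀ a c p s t → ((p - (s * a + t * c)) + a * (s + t - 1ℚ)) + (c - a) * t ≡ p - a
  at-endpoint = solve-∀ ring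

  segment-bound : ∀ a₁ a₂ b₁ b₂ p₁ p₂ s t α β M →
    ((M - (α * a₁ + β * a₂)) * s + (M - (α * b₁ + β * b₂)) * t)
    + - ((M * (s + t - 1ℚ) + (α * (p₁ - (s * a₁ + t * b₁)))) + β * (p₂ - (s * a₂ + t * b₂)))
    ≡ M - (α * p₁ + β * p₂)
  segment-bound = solve-∀ ring

  opposite-bounds : ∀ M M′ α β p₁ p₂ →
    (M - (α * p₁ + β * p₂)) + (- M′ - (- α * p₁ + - β * p₂)) ≡ - (M′ - M)
  opposite-bounds = solve-∀ ring

  neg-functional : ∀ α β x y → - (α * x + β * y) ≡ - α * x + - β * y
  neg-functional = solve-∀ ring

  vertical-star : ∀ A J J′ → ((1ℚ + A) - A) * (J′ - 0ℚ) - ((1ℚ + A) - A) * (J - 0ℚ) ≡ J′ - J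
  vertical-star = solve-∀ ring

  horizontal-star : ∀ B I I′ → (I - 0ℚ) * ((1ℚ + B) - B) - (I′ - 0ℚ) * ((1ℚ + B) - B) ≡ I - I′
  horizontal-star = solve-∀ ring

module I = Identities

-- Identities over the field with two elements.

module ParityIdentities where

  parity-ring : AlmostCommutativeRing _ _
  parity-ring = fromCommutativeRing xor-∧-commutativeRing (λ p → dec⇒maybe (false ≟ p))

  isolate-id : ∀ c v u w → w ≡ (c xor (v xor (u xor w))) xor (c xor (v xor u))
  isolate-id = solve-∀ parity-ring

  total : ∀ r₁ r₂ r₃ r₄ r₅ r₆ r₇ r₈ r₉ →
        ((r₁ xor r₂ xor r₃) xor (r₄ xor r₅ xor r₆) xor (r₇ xor r₈ xor r₉)) xor
        (((true xor r₁) xor (true xor r₄) xor (true xor r₇)) xor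
         ((true xor r₂) xor (true xor r₅) xor (true xor r₈)) xor
         ((true xor r₃) xor (true xor r₆) xor (true xor r₉))) ≡ true
  total = solve-∀ parity-ring

  bilinear-id : ∀ c u₀ u₁ u₂ v₀ v₁ v₂ →
    ((c xor v₁ xor u₀) xor (c xor v₀ xor u₁)) xor
    ((c xor v₂ xor u₀) xor (c xor v₀ xor u₂)) xor
    ((c xor v₂ xor u₁) xor (c xor v₁ xor u₂)) ≡ false
  bilinear-id = solve-∀ parity-ring

  not-out : ∀ p q → p xor (true xor q) ≡ true xor (p xor q)
  not-out = solve-∀ parity-ring

  elimination : ∀ p a b c d e →
    (p xor a xor b xor c) xor (p xor d xor e xor c) ≡ b xor (e xor (a xor d))
  elimination = solve-∀ parity-ring

  five-subsets : ∀ a b c d e f g h i j →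
    (g xor d xor b xor a) xor (h xor e xor c xor a) xor (i xor f xor c xor b) xor (j xor f xor e xor d) xor (j xor i xor h xor g) ≡ false
  five-subsets = solve-∀ parity-ring

module Q = ParityIdentities

-- Signs, order and reciprocals of Cauchy reals.

module Reals where

  open import Data.Rational.Solver using (module +-*-Solver)
  open +-*-Solver using (solve; _:+_; _:*_; _:-_; :-_; _:=_; con)
  open import Defs
  open import Data.Rational.Solver using (module +-*-Solver)

  open import Algebra.Properties.Group ℚₚ.+-0-group using (⁻¹-involutive)

  -- Rational inequalities

  -- Abstract, for otherwise the type checker unfolds the rational divisions.
  abstract
    half : ∀ {ε} → 0ℚ ℚ.< ε → ∃[ h ] (0ℚ ℚ.< h × h ℚ.+ h ≡ ε)
    half {ε} 0<ε = ½ ℚ.* ε , ℚₚ.*-monoʳ-<-pos ½ 0<ε ,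
      trans (sym (ℚₚ.*-distribʳ-+ ε ½ ½)) (ℚₚ.*-identityˡ ε)

    divide : ∀ {B ε} → 0ℚ ℚ.< B → 0ℚ ℚ.< ε → ∃[ δ ] (0ℚ ℚ.< δ × B ℚ.* δ ≡ ε)
    divide {B} {ε} 0<B 0<ε =
        (ℚ.1/ B) ℚ.* ε
      , subst (ℚ._< (ℚ.1/ B) ℚ.* ε) (ℚₚ.*-zeroʳ (ℚ.1/ B)) (ℚₚ.*-monoʳ-<-pos (ℚ.1/ B) 0<ε)
      , trans (sym (ℚₚ.*-assoc B (ℚ.1/ B) ε))
          (trans (cong (ℚ._* ε) (ℚₚ.*-inverseʳ B)) (ℚₚ.*-identityˡ ε))
      where
      instance
        B-pos : ℚ.Positive B
        B-pos = ℚ.positive 0<B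
        B-nonZero : ℚ.NonZero B
        B-nonZero = ℚₚ.pos⇒nonZero B
        1/B-pos : ℚ.Positive (ℚ.1/ B)
        1/B-pos = ℚₚ.1/pos⇒pos B

  p-q≡0⇒p≡q : ∀ p q → p ℚ.- q ≡ 0ℚ → p ≡ q
  p-q≡0⇒p≡q p q eq = trans (solve 2 (λ p q → p := (p :- q) :+ q) refl p q)
    (trans (cong (ℚ._+ q) eq) (ℚₚ.+-identityˡ q))

  ≤⇒0≤ : ∀ {p q} → p ℚ.≤ q → 0ℚ ℚ.≤ q ℚ.- p
  ≤⇒0≤ {p} {q} p≤q = subst (ℚ._≤ q ℚ.- p) (ℚₚ.+-inverseʳ p) (ℚₚ.+-monoˡ-≤ (ℚ.- p) p≤q)

  <⇒0< : ∀ {p q} → p ℚ.< q → 0ℚ ℚ.< q ℚ.- p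
  <⇒0< {p} {q} p<q = subst (ℚ._< q ℚ.- p) (ℚₚ.+-inverseʳ p) (ℚₚ.+-monoˡ-< (ℚ.- p) p<q)

  p≤∣p∣ : ∀ p → p ℚ.≤ ℚ.∣ p ∣
  p≤∣p∣ p with ℚₚ.∣p∣≡p∨∣p∣≡-p p
  ... | inj₁ eq = ℚₚ.≤-reflexive (sym eq)
  ... | inj₂ eq = ℚₚ.≤-trans
    (subst₂ ℚ._≤_ (⁻¹-involutive p) refl (ℚₚ.neg-antimono-≤ (subst (0ℚ ℚ.≤_) eq (ℚₚ.0≤∣p∣ p))))
    (ℚₚ.0≤∣p∣ p)

  -∣p∣≤p : ∀ p → ℚ.- ℚ.∣ p ∣ ℚ.≤ p
  -∣p∣≤p p = subst₂ ℚ._≤_ (cong ℚ.-_ (ℚₚ.∣-p∣≡∣p∣ p)) (⁻¹-involutive p)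
    (ℚₚ.neg-antimono-≤ (p≤∣p∣ (ℚ.- p)))

  ∣p∣<ε : ∀ {p ε} → ℚ.- ε ℚ.< p → p ℚ.< ε → ℚ.∣ p ∣ ℚ.< ε
  ∣p∣<ε {p} {ε} -ε<p p<ε with ℚₚ.∣p∣≡p∨∣p∣≡-p p
  ... | inj₁ eq = subst (ℚ._< ε) (sym eq) p<ε
  ... | inj₂ eq = subst₂ ℚ._<_ (sym eq) (⁻¹-involutive ε) (ℚₚ.neg-antimono-< -ε<p)

  -- Sequences of rationals

  Eventually : (ℕ → Set) → Set
  Eventually P = ∃[ N ] (∀ n → N ℕ.≤ n → P n)

  always : ∀ {P : ℕ → Set} → (∀ n → P n) → Eventually P
  always p = 0 , λ n _ → p n

  mapᵉ : ∀ {P Q : ℕ → Set} → (∀ n → P n → Q n) → Eventually P → Eventually Q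
  mapᵉ f (N , p) = N , λ n N≤n → f n (p n N≤n)

  zipᵉ : ∀ {P Q R : ℕ → Set} → (∀ n → P n → Q n → R n) → Eventually P → Eventually Q → Eventually R
  zipᵉ f (N , p) (M , q) = N ℕ.⊔ M , λ n ≤n →
    f n (p n (ℕₚ.m⊔n≤o⇒m≤o N M ≤n)) (q n (ℕₚ.m⊔n≤o⇒n≤o N M ≤n))

  sample : ∀ {P : ℕ → Set} → Eventually P → ∃ P
  sample (N , p) = N , p N ℕₚ.≤-refl

  Seq : Set
  Seq = ℕ → ℚ

  -- Conditions on the limit. `NonNeg` is the affirmative counterpart of `0ℝ ≤ x`, which is defined
  -- as a negation and gives no estimate by itself.
  Null NonNeg Pos Bounded : Seq → Set
  Null f = ∀ ε → 0ℚ ℚ.< ε → Eventually (λ n → ℚ.∣ f n ∣ ℚ.< ε)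
  NonNeg f = ∀ ε → 0ℚ ℚ.< ε → Eventually (λ n → ℚ.- ε ℚ.≤ f n)
  Pos f = ∃[ ε ] (0ℚ ℚ.< ε × Eventually (λ n → ε ℚ.≤ f n))
  Bounded f = ∃[ B ] (0ℚ ℚ.< B × Eventually (λ n → ℚ.∣ f n ∣ ℚ.≤ B))

  Neg : Seq → Set
  Neg f = Pos (λ n → ℚ.- f n)

  null-cong : ∀ {f g} → (∀ n → f n ≡ g n) → Null f → Null g
  null-cong eq nf ε 0<ε = mapᵉ (λ n → subst (λ z → ℚ.∣ z ∣ ℚ.< ε) (eq n)) (nf ε 0<ε)

  nonneg-cong : ∀ {f g} → (∀ n → f n ≡ g n) → NonNeg f → NonNeg g
  nonneg-cong eq nf ε 0<ε = mapᵉ (λ n → subst (ℚ.- ε ℚ.≤_) (eq n)) (nf ε 0<ε)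

  pos-cong : ∀ {f g} → (∀ n → f n ≡ g n) → Pos f → Pos g
  pos-cong eq (ε , 0<ε , pf) = ε , 0<ε , mapᵉ (λ n → subst (ε ℚ.≤_) (eq n)) pf

  null-0 : ∀ {f} → (∀ n → f n ≡ 0ℚ) → Null f
  null-0 eq = null-cong (λ n → sym (eq n)) λ ε 0<ε → always λ n → 0<ε

  null-+ : ∀ {f g} → Null f → Null g → Null (λ n → f n ℚ.+ g n)
  null-+ {f} {g} nf ng ε 0<ε with half 0<ε
  ... | h , 0<h , refl = zipᵉ (λ n p q →
    ℚₚ.≤-<-trans (ℚₚ.∣p+q∣≤∣p∣+∣q∣ (f n) (g n)) (ℚₚ.+-mono-< p q)) (nf h 0<h) (ng h 0<h)

  null-* : ∀ {f g} → Bounded f → Null g → Null (λ n → f n ℚ.* g n)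
  null-* {f} {g} (B , 0<B , bf) ng ε 0<ε with divide 0<B 0<ε
  ... | δ , 0<δ , refl = zipᵉ (λ n f≤ g< → begin-strict
      ℚ.∣ f n ℚ.* g n ∣        ≡⟨ ℚₚ.∣p*q∣≡∣p∣*∣q∣ (f n) (g n) ⟩
      ℚ.∣ f n ∣ ℚ.* ℚ.∣ g n ∣  ≤⟨ ℚₚ.*-monoʳ-≤-nonNeg ℚ.∣ g n ∣ {{ℚₚ.∣-∣-nonNeg (g n)}} f≤ ⟩
      B ℚ.* ℚ.∣ g n ∣          <⟨ ℚₚ.*-monoʳ-<-pos B {{ℚ.positive 0<B}} g< ⟩
      B ℚ.* δ                  ∎) bf (ng δ 0<δ)
    where open ℚₚ.≤-Reasoning

  cauchy⇒bounded : ∀ f → IsCauchy f → Bounded f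
  cauchy⇒bounded f cf with cf 1ℚ (ℚₚ.positive⁻¹ 1ℚ)
  ... | N , h = 1ℚ ℚ.+ ℚ.∣ f N ∣ , ℚₚ.+-mono-<-≤ (ℚₚ.positive⁻¹ 1ℚ) (ℚₚ.0≤∣p∣ (f N)) , N , λ n N≤n →
    begin
      ℚ.∣ f n ∣
        ≡⟨ cong ℚ.∣_∣ (solve 2 (λ a b → a := (a :- b) :+ b) refl (f n) (f N)) ⟩
      ℚ.∣ (f n ℚ.- f N) ℚ.+ f N ∣
        ≤⟨ ℚₚ.∣p+q∣≤∣p∣+∣q∣ (f n ℚ.- f N) (f N) ⟩
      ℚ.∣ f n ℚ.- f N ∣ ℚ.+ ℚ.∣ f N ∣
        ≤⟨ ℚₚ.+-monoˡ-≤ ℚ.∣ f N ∣ (ℚₚ.<⇒≤ (h n N N≤n ℕₚ.≤-refl)) ⟩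
      1ℚ ℚ.+ ℚ.∣ f N ∣ ∎
    where open ℚₚ.≤-Reasoning

  null⇒nonneg : ∀ {f} → Null f → NonNeg f
  null⇒nonneg {f} nf ε 0<ε = mapᵉ (λ n p →
    ℚₚ.≤-trans (ℚₚ.neg-antimono-≤ (ℚₚ.<⇒≤ p)) (-∣p∣≤p (f n))) (nf ε 0<ε)

  pos⇒nonneg : ∀ {f} → Pos f → NonNeg f
  pos⇒nonneg (δ , 0<δ , p) ε 0<ε = mapᵉ (λ n δ≤ →
    ℚₚ.≤-trans (ℚₚ.<⇒≤ (ℚₚ.<-trans (ℚₚ.neg-antimono-< 0<ε) 0<δ)) δ≤) p

  nonneg-+ : ∀ {f g} → NonNeg f → NonNeg g → NonNeg (λ n → f n ℚ.+ g n)
  nonneg-+ {f} {g} nf ng ε 0<ε with half 0<ε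
  ... | h , 0<h , refl = zipᵉ (λ n p q →
    subst (ℚ._≤ f n ℚ.+ g n) (sym (ℚₚ.neg-distrib-+ h h)) (ℚₚ.+-mono-≤ p q)) (nf h 0<h) (ng h 0<h)

  pos-+ : ∀ {f g} → Pos f → NonNeg g → Pos (λ n → f n ℚ.+ g n)
  pos-+ {f} {g} (ε , 0<ε , pf) ng with half 0<ε
  ... | h , 0<h , refl = h , 0<h , zipᵉ (λ n p q →
    subst (ℚ._≤ f n ℚ.+ g n) (solve 1 (λ h → (h :+ h) :- h := h) refl h) (ℚₚ.+-mono-≤ p q)) pf (ng h 0<h)

  nonneg-* : ∀ {g f : Seq} → (∃[ R ] (0ℚ ℚ.< R × (∀ n → 0ℚ ℚ.≤ g n × g n ℚ.≤ R))) → NonNeg f →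
             NonNeg (λ n → g n ℚ.* f n)
  nonneg-* {g} {f} (R , 0<R , bg) nf ε 0<ε with divide 0<R 0<ε
  ... | δ , 0<δ , refl = mapᵉ (λ n -δ≤f → begin
      ℚ.- (R ℚ.* δ)      ≡⟨ ℚₚ.neg-distribʳ-* R δ ⟩
      R ℚ.* (ℚ.- δ)      ≤⟨ ℚₚ.*-monoʳ-≤-nonPos (ℚ.- δ) {{ℚ.nonPositive (ℚₚ.neg-antimono-≤ (ℚₚ.<⇒≤ 0<δ))}} (proj₂ (bg n)) ⟩
      g n ℚ.* (ℚ.- δ)    ≤⟨ ℚₚ.*-monoˡ-≤-nonNeg (g n) {{ℚ.nonNegative (proj₁ (bg n))}} -δ≤f ⟩
      g n ℚ.* f n        ∎) (nf δ 0<δ)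
    where open ℚₚ.≤-Reasoning

  nonneg-antisym : ∀ {f} → NonNeg f → NonNeg (λ n → ℚ.- f n) → Null f
  nonneg-antisym {f} nf ng ε 0<ε with half 0<ε
  ... | h , 0<h , refl = zipᵉ (λ n p q → ∣p∣<ε
      (ℚₚ.<-≤-trans (ℚₚ.neg-antimono-< h<2h) p)
      (ℚₚ.≤-<-trans (subst₂ ℚ._≤_ (⁻¹-involutive (f n)) (⁻¹-involutive h) (ℚₚ.neg-antimono-≤ q)) h<2h))
      (nf h 0<h) (ng h 0<h)
    where
    h<2h : h ℚ.< h ℚ.+ h
    h<2h = subst (ℚ._< h ℚ.+ h) (ℚₚ.+-identityˡ h) (ℚₚ.+-monoˡ-< h 0<h)

  pos⇒¬nonneg : ∀ {f} → Pos f → ¬ NonNeg (λ n → ℚ.- f n)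
  pos⇒¬nonneg {f} pf nf with pos-+ pf nf
  ... | ε , 0<ε , h with sample h
  ... | n , ε≤ = ℚₚ.<-irrefl refl (ℚₚ.<-≤-trans 0<ε (subst (ε ℚ.≤_) (ℚₚ.+-inverseʳ (f n)) ε≤))

  null⇒¬pos : ∀ {f} → Null f → ¬ Pos f
  null⇒¬pos {f} nf pf = pos⇒¬nonneg pf (null⇒nonneg
    (λ ε 0<ε → mapᵉ (λ n → subst (ℚ._< ε) (sym (ℚₚ.∣-p∣≡∣p∣ (f n)))) (nf ε 0<ε)))

  -- A Cauchy sequence is decided, at any given scale, by one late term.
  cauchy-split : ∀ {f} → IsCauchy f → ∀ ε → 0ℚ ℚ.< ε → Eventually (λ n → ℚ.- ε ℚ.≤ f n) ⊎ Neg f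
  cauchy-split {f} cf ε 0<ε with half 0<ε
  ... | h , 0<h , refl with half 0<h
  ... | q , 0<q , refl with cf q 0<q
  ... | N , near with (ℚ.- h) ℚₚ.≤? f N
  ... | yes -h≤ = inj₁ (N , λ n N≤n → begin
        ℚ.- (h ℚ.+ h)                ≡⟨ ℚₚ.neg-distrib-+ h h ⟩
        ℚ.- h ℚ.+ ℚ.- (q ℚ.+ q)      ≤⟨ ℚₚ.+-mono-≤ -h≤ (begin
            ℚ.- (q ℚ.+ q)            ≤⟨ ℚₚ.neg-antimono-≤ q≤2q ⟩
            ℚ.- q                    ≤⟨ ℚₚ.neg-antimono-≤ (ℚₚ.<⇒≤ (near n N N≤n ℕₚ.≤-refl)) ⟩
            ℚ.- ℚ.∣ f n ℚ.- f N ∣    ≤⟨ -∣p∣≤p (f n ℚ.- f N) ⟩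
            f n ℚ.- f N              ∎) ⟩
        f N ℚ.+ (f n ℚ.- f N)        ≡⟨ solve 2 (λ a b → a :+ (b :- a) := b) refl (f N) (f n) ⟩
        f n                          ∎)
    where
    open ℚₚ.≤-Reasoning
    q≤2q : q ℚ.≤ q ℚ.+ q
    q≤2q = subst (ℚ._≤ q ℚ.+ q) (ℚₚ.+-identityˡ q) (ℚₚ.+-monoˡ-≤ q (ℚₚ.<⇒≤ 0<q))
  ... | no ¬-h≤ = inj₂ (q , 0<q , N , λ n N≤n → begin
        q                                      ≡⟨ solve 1 (λ q → q := (:- q) :+ (q :+ q)) refl q ⟩
        ℚ.- q ℚ.+ (q ℚ.+ q)                    ≤⟨ ℚₚ.+-mono-≤
            (ℚₚ.neg-antimono-≤ (ℚₚ.<⇒≤ (ℚₚ.≤-<-trans (p≤∣p∣ (f n ℚ.- f N)) (near n N N≤n ℕₚ.≤-refl))))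
            (subst (ℚ._≤ ℚ.- f N) (⁻¹-involutive h) (ℚₚ.neg-antimono-≤ (ℚₚ.<⇒≤ (ℚₚ.≰⇒> ¬-h≤)))) ⟩
        ℚ.- (f n ℚ.- f N) ℚ.+ ℚ.- f N          ≡⟨ solve 2 (λ a b → (:- (a :- b)) :+ (:- b) := :- a) refl (f n) (f N) ⟩
        ℚ.- f n                                ∎)
    where open ℚₚ.≤-Reasoning

  abstract
    cauchy-neg : ∀ f → IsCauchy f → IsCauchy (λ n → ℚ.- f n)
    cauchy-neg f cf ε 0<ε with cf ε 0<ε
    ... | N , h = N , λ m n N≤m N≤n → subst (ℚ._< ε)
      (trans (sym (ℚₚ.∣-p∣≡∣p∣ (f m ℚ.- f n)))
        (cong ℚ.∣_∣ (solve 2 (λ a b → :- (a :- b) := (:- a) :- (:- b)) refl (f m) (f n))))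
      (h m n N≤m N≤n)

  -- At each scale `cauchy-split` yields either the wanted bound or a proof of `Neg f`, which is
  -- refuted; hence the negation gives an estimate constructively.
  ¬neg⇒nonneg : ∀ {f} → IsCauchy f → ¬ Neg f → NonNeg f
  ¬neg⇒nonneg cf ¬n ε 0<ε with cauchy-split cf ε 0<ε
  ... | inj₁ e = e
  ... | inj₂ n = ⊥-elim (¬n n)

  ¬pos⇒nonneg : ∀ {f} → IsCauchy f → ¬ Pos f → NonNeg (λ n → ℚ.- f n)
  ¬pos⇒nonneg {f} cf ¬p = ¬neg⇒nonneg (cauchy-neg f cf)
    λ n → ¬p (pos-cong (λ k → ⁻¹-involutive (f k)) n)

  ¬pos¬neg⇒null : ∀ {f} → IsCauchy f → ¬ Pos f → ¬ Neg f → Null f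
  ¬pos¬neg⇒null cf ¬p ¬n = nonneg-antisym (¬neg⇒nonneg cf ¬n) (¬pos⇒nonneg cf ¬p)

  -- Real numbers

  0≤⇒nonneg : ∀ {x} → 0ℝ ≤ x → NonNeg (seq x)
  0≤⇒nonneg {x} 0≤x = ¬neg⇒nonneg (cauchy x) λ (ε , 0<ε , h) → 0≤x (ε , 0<ε , mapᵉ (λ n ε≤ →
    subst₂ ℚ._≤_ (ℚₚ.+-comm ε (seq x n)) (ℚₚ.+-inverseˡ (seq x n)) (ℚₚ.+-monoˡ-≤ (seq x n) ε≤)) h)

  nonneg⇒0≤ : ∀ {x} → NonNeg (seq x) → 0ℝ ≤ x
  nonneg⇒0≤ {x} nx (ε , 0<ε , h) = pos⇒¬nonneg
    (ε , 0<ε , mapᵉ (λ n le → subst₂ ℚ._≤_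
      (solve 2 (λ a e → (a :+ e) :- a := e) refl (seq x n) ε) (ℚₚ.+-identityˡ (ℚ.- seq x n))
      (ℚₚ.+-monoˡ-≤ (ℚ.- seq x n) le)) h)
    (nonneg-cong (λ n → sym (⁻¹-involutive (seq x n))) nx)

  null-scale : ∀ (k : ℝ) {g} → Null g → Null (λ n → seq k n ℚ.* g n)
  null-scale k = null-* {seq k} (cauchy⇒bounded (seq k) (cauchy k))

  null-neg : ∀ {f} → Null f → Null (λ n → ℚ.- f n)
  null-neg {f} nf = null-cong (λ n → solve 1 (λ a → con (ℚ.- 1ℚ) :* a := :- a) refl (f n)) (null-scale (fromℚ (ℚ.- 1ℚ)) nf)

  abstract
    cauchy-minus : ∀ x y → IsCauchy (λ n → seq x n ℚ.- seq y n)
    cauchy-minus x y = cauchy (x + mkℝ (λ n → ℚ.- seq y n) (cauchy-neg (seq y) (cauchy y)))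

  infixl 6 _-_

  _-_ : ℝ → ℝ → ℝ
  x - y = mkℝ (λ n → seq x n ℚ.- seq y n) (cauchy-minus x y)

  neg : ℝ → ℝ
  neg x = mkℝ (λ n → ℚ.- seq x n) (cauchy-neg (seq x) (cauchy x))

  -- The bounds hold for every term of the representing sequence, not only in the limit, so
  -- multiplication by `r` scales a lower bound `- δ` to at worst `- (R δ)`.
  BoundedNonNeg : ℝ → Set
  BoundedNonNeg r = ∃[ R ] (0ℚ ℚ.< R × (∀ n → 0ℚ ℚ.≤ seq r n × seq r n ℚ.≤ R))

  reciprocal : ∀ x → Pos (seq x) → ∃[ r ] (BoundedNonNeg r × r * x ≃ 1ℝ)
  reciprocal x (ε , 0<ε , N , ε≤x) =
      mkℝ inv inv-cauchy
    , (E , 0<E , λ n → ℚₚ.<⇒≤ (0<inv n) , inv≤E n)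
    , (λ δ 0<δ → N , λ n N≤n →
        subst (λ z → ℚ.∣ z ∣ ℚ.< δ)
          (sym (trans (cong (λ k → inv n ℚ.* seq x k ℚ.- 1ℚ) (sym (ℚ⊔ n N≤n)))
                      (trans (cong (ℚ._- 1ℚ) (inv*y n)) (ℚₚ.+-inverseʳ 1ℚ)))) 0<δ)
    where
    open ℚₚ.≤-Reasoning
    -- The terms of `x` before `N` may vanish. Reading the sequence from `N` on makes every term at
    -- least ε, hence invertible.
    y : ℕ → ℚ
    y n = seq x (N ℕ.⊔ n)
    ε≤y : ∀ n → ε ℚ.≤ y n
    ε≤y n = ε≤x (N ℕ.⊔ n) (ℕₚ.m≤m⊔n N n)
    0<y : ∀ n → 0ℚ ℚ.< y n
    0<y n = ℚₚ.<-≤-trans 0<ε (ε≤y n)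
    inverse : ∀ n → ∃[ r ] (0ℚ ℚ.< r × y n ℚ.* r ≡ 1ℚ)
    inverse n = divide (0<y n) (ℚₚ.positive⁻¹ 1ℚ)
    inv : ℕ → ℚ
    inv n = proj₁ (inverse n)
    0<inv : ∀ n → 0ℚ ℚ.< inv n
    0<inv n = proj₁ (proj₂ (inverse n))
    inv*y : ∀ n → inv n ℚ.* y n ≡ 1ℚ
    inv*y n = trans (ℚₚ.*-comm (inv n) (y n)) (proj₂ (proj₂ (inverse n)))
    1/ε : ∃[ E ] (0ℚ ℚ.< E × ε ℚ.* E ≡ 1ℚ)
    1/ε = divide 0<ε (ℚₚ.positive⁻¹ 1ℚ)
    E : ℚ
    E = proj₁ 1/ε
    0<E : 0ℚ ℚ.< E
    0<E = proj₁ (proj₂ 1/ε)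
    inv≤E : ∀ n → inv n ℚ.≤ E
    inv≤E n = begin
      inv n                    ≡⟨ ℚₚ.*-identityʳ (inv n) ⟨
      inv n ℚ.* 1ℚ             ≡⟨ cong (inv n ℚ.*_) (proj₂ (proj₂ 1/ε)) ⟨
      inv n ℚ.* (ε ℚ.* E)      ≤⟨ ℚₚ.*-monoˡ-≤-nonNeg (inv n) {{ℚ.nonNegative (ℚₚ.<⇒≤ (0<inv n))}}
                                   (ℚₚ.*-monoʳ-≤-nonNeg E {{ℚ.nonNegative (ℚₚ.<⇒≤ 0<E)}} (ε≤y n)) ⟩
      inv n ℚ.* (y n ℚ.* E)    ≡⟨ ℚₚ.*-assoc (inv n) (y n) E ⟨
      inv n ℚ.* y n ℚ.* E      ≡⟨ cong (ℚ._* E) (inv*y n) ⟩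
      1ℚ ℚ.* E                 ≡⟨ ℚₚ.*-identityˡ E ⟩
      E                        ∎
    ℚ⊔ : ∀ n → N ℕ.≤ n → N ℕ.⊔ n ≡ n
    ℚ⊔ n = ℕₚ.m≤n⇒m⊔n≡n
    ∣inv∣≤E : ∀ n → ℚ.∣ inv n ∣ ℚ.≤ E
    ∣inv∣≤E n = subst (ℚ._≤ E) (sym (ℚₚ.0≤p⇒∣p∣≡p (ℚₚ.<⇒≤ (0<inv n)))) (inv≤E n)
    difference : ∀ a b u v → a ℚ.* u ≡ 1ℚ → b ℚ.* v ≡ 1ℚ → a ℚ.- b ≡ a ℚ.* (b ℚ.* (v ℚ.- u))
    difference a b u v au≡1 bv≡1 = trans
      (cong₂ ℚ._-_
        (trans (sym (ℚₚ.*-identityʳ a)) (cong (a ℚ.*_) (sym bv≡1)))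
        (trans (sym (ℚₚ.*-identityʳ b)) (cong (b ℚ.*_) (sym au≡1))))
      (solve 4 (λ a b u v → a :* (b :* v) :- b :* (a :* u) := a :* (b :* (v :- u))) refl a b u v)
    ∣inv*∣≤ : ∀ n p q → ℚ.∣ p ∣ ℚ.≤ q → ℚ.∣ inv n ℚ.* p ∣ ℚ.≤ E ℚ.* q
    ∣inv*∣≤ n p q ∣p∣≤q = begin
      ℚ.∣ inv n ℚ.* p ∣        ≡⟨ ℚₚ.∣p*q∣≡∣p∣*∣q∣ (inv n) p ⟩
      ℚ.∣ inv n ∣ ℚ.* ℚ.∣ p ∣  ≤⟨ ℚₚ.*-monoʳ-≤-nonNeg ℚ.∣ p ∣ {{ℚₚ.∣-∣-nonNeg p}} (∣inv∣≤E n) ⟩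
      E ℚ.* ℚ.∣ p ∣            ≤⟨ ℚₚ.*-monoˡ-≤-nonNeg E {{ℚ.nonNegative (ℚₚ.<⇒≤ 0<E)}} ∣p∣≤q ⟩
      E ℚ.* q                  ∎
    ∣inv-inv∣≤ : ∀ m n → ℚ.∣ inv m ℚ.- inv n ∣ ℚ.≤ E ℚ.* (E ℚ.* ℚ.∣ y n ℚ.- y m ∣)
    ∣inv-inv∣≤ m n = subst (λ z → ℚ.∣ z ∣ ℚ.≤ E ℚ.* (E ℚ.* ℚ.∣ y n ℚ.- y m ∣))
      (sym (difference (inv m) (inv n) (y m) (y n) (inv*y m) (inv*y n)))
      (∣inv*∣≤ m (inv n ℚ.* (y n ℚ.- y m)) (E ℚ.* ℚ.∣ y n ℚ.- y m ∣)
        (∣inv*∣≤ n (y n ℚ.- y m) ℚ.∣ y n ℚ.- y m ∣ ℚₚ.≤-refl))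
    inv-cauchy : IsCauchy inv
    -- Two reciprocals differ by at most E² times the difference of the terms, so δ is η divided
    -- twice by `E`.
    inv-cauchy η 0<η with divide 0<E 0<η
    ... | θ , 0<θ , Eθ≡η with divide 0<E 0<θ
    ... | δ , 0<δ , Eδ≡θ with cauchy x δ 0<δ
    ... | M , near = M , λ m n M≤m M≤n → ℚₚ.≤-<-trans (∣inv-inv∣≤ m n)
      (subst (E ℚ.* (E ℚ.* ℚ.∣ y n ℚ.- y m ∣) ℚ.<_) (trans (cong (E ℚ.*_) Eδ≡θ) Eθ≡η)
        (ℚₚ.*-monoʳ-<-pos E {{ℚ.positive 0<E}} (ℚₚ.*-monoʳ-<-pos E {{ℚ.positive 0<E}}
          (near (N ℕ.⊔ n) (N ℕ.⊔ m) (ℕₚ.≤-trans M≤n (ℕₚ.m≤n⊔m N n)) (ℕₚ.≤-trans M≤m (ℕₚ.m≤n⊔m N m))))))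

  -- The records keep the type checker from unfolding real arithmetic down to
  -- rational arithmetic when it infers the argument.

  record Zero (x : ℝ) : Set where
    constructor mkZero
    field null : Null (seq x)

  record Positive (x : ℝ) : Set where
    constructor mkPositive
    field pos : Pos (seq x)

  record NonNegative (x : ℝ) : Set where
    constructor mkNonNegative
    field nonneg : NonNeg (seq x)

  Negative : ℝ → Set
  Negative x = Positive (neg x)

  infix 4 _≐_

  _≐_ : ℝ → ℝ → Set
  x ≐ y = ∀ n → seq x n ≡ seq y n

  zero-cong : ∀ {x y} → x ≐ y → Zero x → Zero y
  zero-cong eq (mkZero z) = mkZero (null-cong eq z)

  positive-cong : ∀ {x y} → x ≐ y → Positive x → Positive y
  positive-cong eq (mkPositive p) = mkPositive (pos-cong eq p)

  nonnegative-cong : ∀ {x y} → x ≐ y → NonNegative x → NonNegative y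
  nonnegative-cong eq (mkNonNegative p) = mkNonNegative (nonneg-cong eq p)

  zero-+ : ∀ {x y} → Zero x → Zero y → Zero (x + y)
  zero-+ (mkZero p) (mkZero q) = mkZero (null-+ p q)

  zero-neg : ∀ {x} → Zero x → Zero (neg x)
  zero-neg (mkZero p) = mkZero (null-neg p)

  zero-minus : ∀ {x y} → Zero x → Zero y → Zero (x - y)
  zero-minus (mkZero p) (mkZero q) = mkZero (null-+ p (null-neg q))

  zero-scale : ∀ k {x} → Zero x → Zero (k * x)
  zero-scale k (mkZero p) = mkZero (null-scale k p)

  ≃⇒zero : ∀ {x y} → x ≃ y → Zero (x - y)
  ≃⇒zero p = mkZero p

  zero⇒≃ : ∀ {x y} → Zero (x - y) → x ≃ y
  zero⇒≃ (mkZero p) = p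

  ≐⇒≃ : ∀ {x y} → x ≐ y → x ≃ y
  ≐⇒≃ {x} {y} eq = null-0 {seq (x - y)} (λ n → trans (cong (ℚ._- seq y n) (eq n)) (ℚₚ.+-inverseʳ (seq y n)))

  positive-+ : ∀ {x y} → Positive x → NonNegative y → Positive (x + y)
  positive-+ (mkPositive p) (mkNonNegative q) = mkPositive (pos-+ p q)

  nonnegative-+ : ∀ {x y} → NonNegative x → NonNegative y → NonNegative (x + y)
  nonnegative-+ (mkNonNegative p) (mkNonNegative q) = mkNonNegative (nonneg-+ p q)

  nonnegative-* : ∀ {r x} → BoundedNonNeg r → NonNegative x → NonNegative (r * x)
  nonnegative-* b (mkNonNegative q) = mkNonNegative (nonneg-* b q)

  positive⇒nonnegative : ∀ {x} → Positive x → NonNegative x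
  positive⇒nonnegative (mkPositive p) = mkNonNegative (pos⇒nonneg p)

  zero⇒nonnegative : ∀ {x} → Zero x → NonNegative x
  zero⇒nonnegative (mkZero p) = mkNonNegative (null⇒nonneg p)

  nonnegative⇒0≤ : ∀ {x} → NonNegative x → 0ℝ ≤ x
  nonnegative⇒0≤ {x} (mkNonNegative p) = nonneg⇒0≤ {x} p

  0≤⇒nonnegative : ∀ {x} → 0ℝ ≤ x → NonNegative x
  0≤⇒nonnegative {x} p = mkNonNegative (0≤⇒nonneg {x} p)

  positive⇒¬nonpositive : ∀ {x} → Positive x → ¬ NonNegative (neg x)
  positive⇒¬nonpositive (mkPositive p) (mkNonNegative q) = pos⇒¬nonneg p q

  zero⇒¬positive : ∀ {x} → Zero x → ¬ Positive x
  zero⇒¬positive (mkZero p) (mkPositive q) = null⇒¬pos p q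

  ¬positive⇒nonpositive : ∀ {x} → ¬ Positive x → NonNegative (neg x)
  ¬positive⇒nonpositive {x} ¬p = mkNonNegative (¬pos⇒nonneg (cauchy x) λ p → ¬p (mkPositive p))

  ¬positive¬negative⇒zero : ∀ {x} → ¬ Positive x → ¬ Negative x → Zero x
  ¬positive¬negative⇒zero {x} ¬p ¬n =
    mkZero (¬pos¬neg⇒null (cauchy x) (λ p → ¬p (mkPositive p)) (λ p → ¬n (mkPositive p)))

  abstract
    inverse : ∀ x → Positive x → ∃[ r ] (BoundedNonNeg r × Zero (r * x - 1ℝ))
    inverse x (mkPositive p) = wrap (reciprocal x p)
      where
      wrap : ∃[ r ] (BoundedNonNeg r × r * x ≃ 1ℝ) → ∃[ r ] (BoundedNonNeg r × Zero (r * x - 1ℝ))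
      wrap (r , b , e) = r , b , mkZero e

-- Affine dependences of four points.

module AffineDependence where

  open import Defs
  open Reals

  infix 4 _∈△[_,_,_]

  _∈△[_,_,_] : ℝ² → ℝ² → ℝ² → ℝ² → Set
  x ∈△[ y , z , w ] = ∃[ α ] ∃[ β ] ∃[ γ ]
    (NonNegative α × NonNegative β × NonNegative γ × α + β + γ ≃ 1ℝ × x ≈ α · y ⊕ β · z ⊕ γ · w)

  Meet : ℝ² → ℝ² → ℝ² → ℝ² → Set
  Meet x y z w = ∃[ p ] (p ∈[ x , y ] × p ∈[ z , w ])

  Dependence : (c₁ c₂ c₃ c₄ : ℝ) (x y z w : ℝ²) → Set
  Dependence c₁ c₂ c₃ c₄ x y z w =
      Zero (c₁ + c₂ + c₃ + c₄)
    × Zero (c₁ * proj₁ x + c₂ * proj₁ y + c₃ * proj₁ z + c₄ * proj₁ w)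
    × Zero (c₁ * proj₂ x + c₂ * proj₂ y + c₃ * proj₂ z + c₄ * proj₂ w)

  module _ {c₁ c₂ c₃ c₄ x y z w} (dep : Dependence c₁ c₂ c₃ c₄ x y z w) where

    -- Solve the dependence for `x` and divide by `c₁`: the weights are the quotients of `neg c₂`,
    -- `neg c₃`, `neg c₄` by `c₁`, and they sum to one because the coefficients sum to zero.
    dep⇒∈△ : Positive c₁ → NonNegative (neg c₂) → NonNegative (neg c₃) → NonNegative (neg c₄) →
             x ∈△[ y , z , w ]
    dep⇒∈△ pa nb nc nd = normalise (inverse c₁ pa)
      where
      normalise : ∃[ r ] (BoundedNonNeg r × Zero (r * c₁ - 1ℝ)) → x ∈△[ y , z , w ]
      normalise (r , 0≤r , rc) =
          r * neg c₂ , r * neg c₃ , r * neg c₄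
        , nonnegative-* {r} {neg c₂} 0≤r nb , nonnegative-* {r} {neg c₃} 0≤r nc , nonnegative-* {r} {neg c₄} 0≤r nd
        , zero⇒≃ {r * neg c₂ + r * neg c₃ + r * neg c₄} {1ℝ}
            (zero-cong (λ n → I.normalised-sum (seq r n) (seq c₁ n) (seq c₂ n) (seq c₃ n) (seq c₄ n))
              (zero-minus rc (zero-scale r (proj₁ dep))))
        , coordinate (proj₁ x) (proj₁ y) (proj₁ z) (proj₁ w) (proj₁ (proj₂ dep))
        , coordinate (proj₂ x) (proj₂ y) (proj₂ z) (proj₂ w) (proj₂ (proj₂ dep))
        where
        coordinate : ∀ p q s t → Zero (c₁ * p + c₂ * q + c₃ * s + c₄ * t) →
          p ≃ (r * neg c₂) * q + (r * neg c₃) * s + (r * neg c₄) * t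
        coordinate p q s t h = zero⇒≃ {p} {(r * neg c₂) * q + (r * neg c₃) * s + (r * neg c₄) * t}
          (zero-cong (λ n → I.normalised-combination
              (seq r n) (seq c₁ n) (seq c₂ n) (seq c₃ n) (seq c₄ n) (seq p n) (seq q n) (seq s n) (seq t n))
            (zero-minus (zero-scale r h) (zero-scale p rc)))

    -- The Radon point: moving the last two terms to the other side and dividing by `c₁ + c₂`, which
    -- equals minus `c₃ + c₄`, writes one point as a convex combination of either pair.
    dep⇒meet : Positive c₁ → Positive c₂ → Negative c₃ → Negative c₄ → Meet x y z w
    dep⇒meet pa pb nc nd = normalise (inverse (c₁ + c₂) (positive-+ pa (positive⇒nonnegative pb)))
      where
      normalise : ∃[ r ] (BoundedNonNeg r × Zero (r * (c₁ + c₂) - 1ℝ)) → Meet x y z w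
      normalise (r , 0≤r , rc) =
          (r * c₁) · x ⊕ (r * c₂) · y
        , ( r * c₁ , r * c₂
          , nonnegative⇒0≤ {r * c₁} (nonnegative-* {r} {c₁} 0≤r (positive⇒nonnegative pa))
          , nonnegative⇒0≤ {r * c₂} (nonnegative-* {r} {c₂} 0≤r (positive⇒nonnegative pb))
          , zero⇒≃ {r * c₁ + r * c₂} {1ℝ}
              (zero-cong (λ n → cong (ℚ._- 1ℚ) (ℚₚ.*-distribˡ-+ (seq r n) (seq c₁ n) (seq c₂ n))) rc)
          , ≐⇒≃ {X₁} {X₁} (λ n → refl)
          , ≐⇒≃ {X₂} {X₂} (λ n → refl))
        , ( r * neg c₃ , r * neg c₄
          , nonnegative⇒0≤ {r * neg c₃} (nonnegative-* {r} {neg c₃} 0≤r (positive⇒nonnegative nc))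
          , nonnegative⇒0≤ {r * neg c₄} (nonnegative-* {r} {neg c₄} 0≤r (positive⇒nonnegative nd))
          , zero⇒≃ {r * neg c₃ + r * neg c₄} {1ℝ}
              (zero-cong (λ n → I.opposite-sum (seq r n) (seq c₁ n) (seq c₂ n) (seq c₃ n) (seq c₄ n))
                (zero-minus rc (zero-scale r (proj₁ dep))))
          , coordinate (proj₁ x) (proj₁ y) (proj₁ z) (proj₁ w) (proj₁ (proj₂ dep))
          , coordinate (proj₂ x) (proj₂ y) (proj₂ z) (proj₂ w) (proj₂ (proj₂ dep)))
        where
        X₁ X₂ : ℝ
        X₁ = (r * c₁) * proj₁ x + (r * c₂) * proj₁ y
        X₂ = (r * c₁) * proj₂ x + (r * c₂) * proj₂ y
        coordinate : ∀ p q s t → Zero (c₁ * p + c₂ * q + c₃ * s + c₄ * t) →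
          (r * c₁) * p + (r * c₂) * q ≃ (r * neg c₃) * s + (r * neg c₄) * t
        coordinate p q s t h =
          zero⇒≃ {(r * c₁) * p + (r * c₂) * q} {(r * neg c₃) * s + (r * neg c₄) * t}
            (zero-cong (λ n → I.opposite-combination
                (seq r n) (seq c₁ n) (seq c₂ n) (seq c₃ n) (seq c₄ n) (seq p n) (seq q n) (seq s n) (seq t n))
              (zero-scale r h))

    dep-neg : Dependence (neg c₁) (neg c₂) (neg c₃) (neg c₄) x y z w
    dep-neg =
        (zero-cong (λ n → I.neg-sum (seq c₁ n) (seq c₂ n) (seq c₃ n) (seq c₄ n)) (zero-neg (proj₁ dep)))
      , (coordinate (proj₁ x) (proj₁ y) (proj₁ z) (proj₁ w) (proj₁ (proj₂ dep)))
      , (coordinate (proj₂ x) (proj₂ y) (proj₂ z) (proj₂ w) (proj₂ (proj₂ dep)))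
      where
      coordinate : ∀ p q s t → Zero (c₁ * p + c₂ * q + c₃ * s + c₄ * t) →
        Zero (neg c₁ * p + neg c₂ * q + neg c₃ * s + neg c₄ * t)
      coordinate p q s t h = zero-cong (λ n → I.neg-combination
        (seq c₁ n) (seq c₂ n) (seq c₃ n) (seq c₄ n) (seq p n) (seq q n) (seq s n) (seq t n)) (zero-neg h)

    dep-swap : Dependence c₂ c₁ c₃ c₄ y x z w
    dep-swap =
        (swap c₁ c₂ c₃ c₄ (proj₁ dep))
      , (swap (c₁ * proj₁ x) (c₂ * proj₁ y) (c₃ * proj₁ z) (c₄ * proj₁ w) (proj₁ (proj₂ dep)))
      , (swap (c₁ * proj₂ x) (c₂ * proj₂ y) (c₃ * proj₂ z) (c₄ * proj₂ w) (proj₂ (proj₂ dep)))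
      where
      swap : ∀ p q s t → Zero (p + q + s + t) → Zero (q + p + s + t)
      swap p q s t = zero-cong λ n → cong (λ u → u ℚ.+ seq s n ℚ.+ seq t n) (ℚₚ.+-comm (seq p n) (seq q n))

    dep-rotate : Dependence c₂ c₃ c₄ c₁ y z w x
    dep-rotate =
        (rotate c₁ c₂ c₃ c₄ (proj₁ dep))
      , (rotate (c₁ * proj₁ x) (c₂ * proj₁ y) (c₃ * proj₁ z) (c₄ * proj₁ w) (proj₁ (proj₂ dep)))
      , (rotate (c₁ * proj₂ x) (c₂ * proj₂ y) (c₃ * proj₂ z) (c₄ * proj₂ w) (proj₂ (proj₂ dep)))
      where
      rotate : ∀ p q s t → Zero (p + q + s + t) → Zero (q + s + t + p)
      rotate p q s t = zero-cong λ n → I.rotate (seq p n) (seq q n) (seq s n) (seq t n)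

-- Collinear triples and determinants.

module Collinearity where

  open import Defs
  open Reals
  open AffineDependence
  open import Algebra.Properties.Group ℚₚ.+-0-group using (⁻¹-involutive)

  Dependence₃ : (c₁ c₂ c₃ : ℝ) (x y z : ℝ²) → Set
  Dependence₃ c₁ c₂ c₃ x y z =
      Zero (c₁ + c₂ + c₃)
    × Zero (c₁ * proj₁ x + c₂ * proj₁ y + c₃ * proj₁ z)
    × Zero (c₁ * proj₂ x + c₂ * proj₂ y + c₃ * proj₂ z)

  ∈△⇒∈[] : ∀ {x y z} → x ∈△[ y , z , z ] → x ∈[ y , z ]
  ∈△⇒∈[] {x} {y} {z} (α , β , γ , 0≤α , 0≤β , 0≤γ , sum , eq₁ , eq₂) =
      α , β + γ , nonnegative⇒0≤ {α} 0≤α , nonnegative⇒0≤ {β + γ} (nonnegative-+ 0≤β 0≤γ)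
    , zero⇒≃ {α + (β + γ)} {1ℝ}
        (zero-cong (λ n → cong (ℚ._- 1ℚ) (ℚₚ.+-assoc (seq α n) (seq β n) (seq γ n)))
          (≃⇒zero {α + β + γ} {1ℝ} sum))
    , coordinate (proj₁ x) (proj₁ y) (proj₁ z) eq₁
    , coordinate (proj₂ x) (proj₂ y) (proj₂ z) eq₂
    where
    coordinate : ∀ p q s → p ≃ α * q + β * s + γ * s → p ≃ α * q + (β + γ) * s
    coordinate p q s h = zero⇒≃ {p} {α * q + (β + γ) * s}
      (zero-cong (λ n → I.merge (seq p n) (seq α n) (seq β n) (seq γ n) (seq q n) (seq s n))
        (≃⇒zero {p} {α * q + β * s + γ * s} h))

  neg-neg-nonnegative : ∀ {c} → NonNegative c → NonNegative (neg (neg c))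
  neg-neg-nonnegative {c} = nonnegative-cong (λ n → sym (⁻¹-involutive (seq c n)))

  neg-neg-positive : ∀ {c} → Positive c → Negative (neg c)
  neg-neg-positive {c} = positive-cong (λ n → sym (⁻¹-involutive (seq c n)))

  0ℝ-zero : Zero 0ℝ
  0ℝ-zero = mkZero (null-0 λ _ → refl)

  module _ {c₁ c₂ c₃ x y z} (dep : Dependence₃ c₁ c₂ c₃ x y z) where

    -- The triangle case applies after `z` is repeated with coefficient zero; a triangle with a
    -- repeated corner is a segment.
    dep₃⇒∈[] : Positive c₁ → NonNegative (neg c₂) → NonNegative (neg c₃) → x ∈[ y , z ]
    dep₃⇒∈[] p₁ n₂ n₃ = ∈△⇒∈[] {x} {y} {z} (dep⇒∈△ {c₁} {c₂} {c₃} {0ℝ} {x} {y} {z} {z} padded p₁ n₂ n₃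
        (zero⇒nonnegative {neg 0ℝ} (zero-neg {0ℝ} 0ℝ-zero)))
      where
      pad : ∀ a b → Zero a → Zero (a + 0ℝ * b)
      pad a b = zero-cong λ n → sym (I.pad (seq a n) (seq b n))
      padded : Dependence c₁ c₂ c₃ 0ℝ x y z z
      padded =
          zero-cong {c₁ + c₂ + c₃} {c₁ + c₂ + c₃ + 0ℝ} (λ n → sym (ℚₚ.+-identityʳ (seq c₁ n ℚ.+ seq c₂ n ℚ.+ seq c₃ n))) (proj₁ dep)
        , pad (c₁ * proj₁ x + c₂ * proj₁ y + c₃ * proj₁ z) (proj₁ z) (proj₁ (proj₂ dep))
        , pad (c₁ * proj₂ x + c₂ * proj₂ y + c₃ * proj₂ z) (proj₂ z) (proj₂ (proj₂ dep))

    dep₃-neg : Dependence₃ (neg c₁) (neg c₂) (neg c₃) x y z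
    dep₃-neg =
        zero-cong (λ n → I.neg-sum₃ (seq c₁ n) (seq c₂ n) (seq c₃ n)) (zero-neg (proj₁ dep))
      , coordinate (proj₁ x) (proj₁ y) (proj₁ z) (proj₁ (proj₂ dep))
      , coordinate (proj₂ x) (proj₂ y) (proj₂ z) (proj₂ (proj₂ dep))
      where
      coordinate : ∀ p q s → Zero (c₁ * p + c₂ * q + c₃ * s) → Zero (neg c₁ * p + neg c₂ * q + neg c₃ * s)
      coordinate p q s h = zero-cong (λ n → I.neg-combination₃
        (seq c₁ n) (seq c₂ n) (seq c₃ n) (seq p n) (seq q n) (seq s n)) (zero-neg h)

    dep₃-rotate : Dependence₃ c₂ c₃ c₁ y z x
    dep₃-rotate =
        rotate c₁ c₂ c₃ (proj₁ dep)
      , rotate (c₁ * proj₁ x) (c₂ * proj₁ y) (c₃ * proj₁ z) (proj₁ (proj₂ dep))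
      , rotate (c₁ * proj₂ x) (c₂ * proj₂ y) (c₃ * proj₂ z) (proj₂ (proj₂ dep))
      where
      rotate : ∀ p q s → Zero (p + q + s) → Zero (q + s + p)
      rotate p q s = zero-cong λ n → I.rotate₃ (seq p n) (seq q n) (seq s n)

    opposite-of-second : Positive c₁ → NonNegative c₃ → Negative c₂
    opposite-of-second p₁ n₃ =
      positive-cong {(c₁ + c₃) + neg (c₁ + c₂ + c₃)} {neg c₂}
        (λ n → I.opposite-of-third (seq c₁ n) (seq c₂ n) (seq c₃ n))
        (positive-+ {c₁ + c₃} {neg (c₁ + c₂ + c₃)} (positive-+ p₁ n₃)
          (zero⇒nonnegative {neg (c₁ + c₂ + c₃)} (zero-neg {c₁ + c₂ + c₃} (proj₁ dep))))

  module _ {x y z} (x∉ : ¬ x ∈[ y , z ]) (y∉ : ¬ y ∈[ z , x ]) (z∉ : ¬ z ∈[ x , y ]) where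

    -- Suppose `c₃` is positive. If `c₁` is positive too, `c₂` alone is negative and `y` lies
    -- between `z` and `x`; if `c₂` is, then `x` lies between `y` and `z`; if neither is, then `z`
    -- lies between `x` and `y`. All three are excluded.
    dep₃⇒¬positive : ∀ {c₁ c₂ c₃} → Dependence₃ c₁ c₂ c₃ x y z → ¬ Positive c₃
    dep₃⇒¬positive {c₁} {c₂} {c₃} dep p₃ = ¬p₁ p₁
      where
      ¬p₁ : ¬ Positive c₁
      ¬p₁ p₁ = y∉ (dep₃⇒∈[] {neg c₂} {neg c₃} {neg c₁} {y} {z} {x}
        (dep₃-neg {c₂} {c₃} {c₁} {y} {z} {x} (dep₃-rotate {c₁} {c₂} {c₃} {x} {y} {z} dep))
        (opposite-of-second {c₁} {c₂} {c₃} {x} {y} {z} dep p₁ (positive⇒nonnegative {c₃} p₃))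
        (neg-neg-nonnegative {c₃} (positive⇒nonnegative {c₃} p₃)) (neg-neg-nonnegative {c₁} (positive⇒nonnegative {c₁} p₁)))
      ¬p₂ : ¬ Positive c₂
      ¬p₂ p₂ = x∉ (dep₃⇒∈[] {neg c₁} {neg c₂} {neg c₃} {x} {y} {z}
        (dep₃-neg {c₁} {c₂} {c₃} {x} {y} {z} dep)
        (opposite-of-second {c₃} {c₁} {c₂} {z} {x} {y}
          (dep₃-rotate {c₂} {c₃} {c₁} {y} {z} {x} (dep₃-rotate {c₁} {c₂} {c₃} {x} {y} {z} dep))
          p₃ (positive⇒nonnegative {c₂} p₂))
        (neg-neg-nonnegative {c₂} (positive⇒nonnegative {c₂} p₂)) (neg-neg-nonnegative {c₃} (positive⇒nonnegative {c₃} p₃)))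
      p₁ : Positive c₁
      p₁ = ⊥-elim (z∉ (dep₃⇒∈[] {c₃} {c₁} {c₂} {z} {x} {y}
        (dep₃-rotate {c₂} {c₃} {c₁} {y} {z} {x} (dep₃-rotate {c₁} {c₂} {c₃} {x} {y} {z} dep))
        p₃ (¬positive⇒nonpositive {c₁} ¬p₁) (¬positive⇒nonpositive {c₂} ¬p₂)))

  det : ℝ² → ℝ² → ℝ² → ℝ
  det (x₁ , x₂) (y₁ , y₂) (z₁ , z₂) = (y₁ - x₁) * (z₂ - x₂) - (z₁ - x₁) * (y₂ - x₂)

  module _ (x y z : ℝ²) where
    private
      x₁ x₂ y₁ y₂ z₁ z₂ : ℝ
      x₁ = proj₁ x
      x₂ = proj₂ x
      y₁ = proj₁ y
      y₂ = proj₂ y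
      z₁ = proj₁ z
      z₂ = proj₂ z

    -- Differences of first coordinates sum to zero and annihilate the first coordinates
    -- identically; applied to the second coordinates they give minus the determinant.
    -- `det-zero⇒dep₂` exchanges the roles of the coordinates.
    det-zero⇒dep₁ : Zero (det x y z) → Dependence₃ (y₁ - z₁) (z₁ - x₁) (x₁ - y₁) x y z
    det-zero⇒dep₁ h =
        mkZero (null-0 λ n → I.difference-sum (seq x₁ n) (seq y₁ n) (seq z₁ n))
      , mkZero (null-0 λ n → I.difference-combination (seq x₁ n) (seq y₁ n) (seq z₁ n))
      , zero-cong (λ n → I.difference-det₁ (seq x₁ n) (seq x₂ n) (seq y₁ n) (seq y₂ n) (seq z₁ n) (seq z₂ n))
          (zero-neg {det x y z} h)

    det-zero⇒dep₂ : Zero (det x y z) → Dependence₃ (y₂ - z₂) (z₂ - x₂) (x₂ - y₂) x y z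
    det-zero⇒dep₂ h =
        mkZero (null-0 λ n → I.difference-sum (seq x₂ n) (seq y₂ n) (seq z₂ n))
      , zero-cong (λ n → I.difference-det₂ (seq x₁ n) (seq x₂ n) (seq y₁ n) (seq y₂ n) (seq z₁ n) (seq z₂ n)) h
      , mkZero (null-0 λ n → I.difference-combination (seq x₂ n) (seq y₂ n) (seq z₂ n))

    -- If the determinant vanished, the third coefficients of both dependences, the differences of
    -- the coordinates of `x` and `y`, could be neither positive nor negative, so `x` and `y` would
    -- coincide.
    det-nonzero : ¬ x ≈ y → ¬ x ∈[ y , z ] → ¬ y ∈[ z , x ] → ¬ z ∈[ x , y ] → ¬ Zero (det x y z)
    det-nonzero x≉y x∉ y∉ z∉ h = x≉y
      ( equal x₁ y₁ (y₁ - z₁) (z₁ - x₁) (det-zero⇒dep₁ h)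
      , equal x₂ y₂ (y₂ - z₂) (z₂ - x₂) (det-zero⇒dep₂ h))
      where
      equal : ∀ p q c₁ c₂ → Dependence₃ c₁ c₂ (p - q) x y z → p ≃ q
      equal p q c₁ c₂ dep = zero⇒≃ {p} {q} (¬positive¬negative⇒zero {p - q}
        (dep₃⇒¬positive {x} {y} {z} x∉ y∉ z∉ {c₁} {c₂} {p - q} dep)
        (dep₃⇒¬positive {x} {y} {z} x∉ y∉ z∉ {neg c₁} {neg c₂} {neg (p - q)}
          (dep₃-neg {c₁} {c₂} {p - q} {x} {y} {z} dep)))

-- Sign patterns of four points.

module Quadruples where

  open import Defs
  open Reals
  open AffineDependence
  open Collinearity
  open import Algebra.Properties.Group ℚₚ.+-0-group using (⁻¹-involutive)

  -- A Boolean index turns products of signs into `xor`, on which the parity arguments compute.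
  data HasSign : Bool → ℝ → Set where
    positive : ∀ {c} → Positive c → HasSign true c
    negative : ∀ {c} → Negative c → HasSign false c

  sign-neg : ∀ {s c} → HasSign s c → HasSign (not s) (neg c)
  sign-neg {true}  {c} (positive p) = negative (neg-neg-positive {c} p)
  sign-neg {false} {c} (negative p) = positive p

  sign-cong : ∀ {s} c d → c ≐ d → HasSign s c → HasSign s d
  sign-cong c d eq (positive p) = positive (positive-cong {c} {d} eq p)
  sign-cong c d eq (negative p) = negative (positive-cong {neg c} {neg d} (λ n → cong ℚ.-_ (eq n)) p)

  positive⇒¬negative : ∀ c → Positive c → ¬ Negative c
  positive⇒¬negative c p n = positive⇒¬nonpositive {c} p (positive⇒nonnegative {neg c} n)

  sign-unique : ∀ {s t} c → HasSign s c → HasSign t c → s ≡ t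
  sign-unique c (positive _) (positive _) = refl
  sign-unique c (positive p) (negative n) = ⊥-elim (positive⇒¬negative c p n)
  sign-unique c (negative n) (positive p) = ⊥-elim (positive⇒¬negative c p n)
  sign-unique c (negative _) (negative _) = refl

  -- A Cauchy real that refutes both strict signs is zero. From `¬ Zero c` no bound away from zero
  -- can be read off, hence the double negation.
  nonzero⇒¬¬sign : ∀ c → ¬ Zero c → ¬ ¬ (∃[ s ] HasSign s c)
  nonzero⇒¬¬sign c c≢0 ¬s = c≢0 (¬positive¬negative⇒zero {c}
    (λ p → ¬s (true , positive p)) (λ p → ¬s (false , negative p)))

  -- In an affine dependence of four points in which no coefficient vanishes, two
  -- coefficients of each sign mean that two segments cross, and a coefficient that
  -- is alone of its sign belongs to a point in the triangle of the others.
  module Quadruple (x y z w : ℝ²) (c₁ c₂ c₃ c₄ : ℝ) (dep : Dependence c₁ c₂ c₃ c₄ x y z w) where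

    private
      all-positive : ∀ d₁ d₂ d₃ d₄ → Dependence d₁ d₂ d₃ d₄ x y z w →
        Positive d₁ → Positive d₂ → Positive d₃ → ¬ Positive d₄
      all-positive d₁ d₂ d₃ d₄ d p₁ p₂ p₃ p₄ = zero⇒¬positive {d₁ + d₂ + d₃ + d₄} (proj₁ d)
        (positive-+ {d₁ + d₂ + d₃} {d₄} (positive-+ {d₁ + d₂} {d₃} (positive-+ {d₁} {d₂} p₁
          (positive⇒nonnegative {d₂} p₂)) (positive⇒nonnegative {d₃} p₃)) (positive⇒nonnegative {d₄} p₄))

    paired⇒meet : ∀ {s t} → HasSign s c₁ → HasSign s c₂ → HasSign t c₃ → HasSign t c₄ → Meet x y z w
    paired⇒meet (positive p₁) (positive p₂) (negative p₃) (negative p₄) =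
      dep⇒meet {c₁} {c₂} {c₃} {c₄} {x} {y} {z} {w} dep p₁ p₂ p₃ p₄
    paired⇒meet (negative p₁) (negative p₂) (positive p₃) (positive p₄) =
      dep⇒meet {neg c₁} {neg c₂} {neg c₃} {neg c₄} {x} {y} {z} {w}
        (dep-neg {c₁} {c₂} {c₃} {c₄} {x} {y} {z} {w} dep) p₁ p₂
        (neg-neg-positive {c₃} p₃) (neg-neg-positive {c₄} p₄)
    -- Four coefficients of one sign cannot sum to zero.
    paired⇒meet (positive p₁) (positive p₂) (positive p₃) (positive p₄) =
      ⊥-elim (all-positive c₁ c₂ c₃ c₄ dep p₁ p₂ p₃ p₄)
    paired⇒meet (negative p₁) (negative p₂) (negative p₃) (negative p₄) =
      ⊥-elim (all-positive (neg c₁) (neg c₂) (neg c₃) (neg c₄)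
        (dep-neg {c₁} {c₂} {c₃} {c₄} {x} {y} {z} {w} dep) p₁ p₂ p₃ p₄)

    isolated⇒∈△ : ∀ {s} → HasSign s c₁ → HasSign (not s) c₂ → HasSign (not s) c₃ → HasSign (not s) c₄ →
      x ∈△[ y , z , w ]
    isolated⇒∈△ (positive p₁) (negative p₂) (negative p₃) (negative p₄) =
      dep⇒∈△ {c₁} {c₂} {c₃} {c₄} {x} {y} {z} {w} dep p₁ (positive⇒nonnegative {neg c₂} p₂)
        (positive⇒nonnegative {neg c₃} p₃) (positive⇒nonnegative {neg c₄} p₄)
    isolated⇒∈△ (negative p₁) (positive p₂) (positive p₃) (positive p₄) =
      dep⇒∈△ {neg c₁} {neg c₂} {neg c₃} {neg c₄} {x} {y} {z} {w}
        (dep-neg {c₁} {c₂} {c₃} {c₄} {x} {y} {z} {w} dep) p₁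
        (neg-neg-nonnegative {c₂} (positive⇒nonnegative {c₂} p₂))
        (neg-neg-nonnegative {c₃} (positive⇒nonnegative {c₃} p₃))
        (neg-neg-nonnegative {c₄} (positive⇒nonnegative {c₄} p₄))

  module SignedQuadruple (x y z w : ℝ²) where

    private
      x₁ x₂ y₁ y₂ z₁ z₂ w₁ w₂ : ℝ
      x₁ = proj₁ x
      x₂ = proj₂ x
      y₁ = proj₁ y
      y₂ = proj₂ y
      z₁ = proj₁ z
      z₂ = proj₂ z
      w₁ = proj₁ w
      w₂ = proj₂ w

      c₁ c₂ c₃ c₄ : ℝ
      c₁ = det y z w
      c₂ = neg (det x z w)
      c₃ = det x y w
      c₄ = neg (det x y z)

    det-dependence : Dependence c₁ c₂ c₃ c₄ x y z w
    det-dependence =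
        mkZero (null-0 λ n → I.det-sum (seq x₁ n) (seq x₂ n) (seq y₁ n) (seq y₂ n)
          (seq z₁ n) (seq z₂ n) (seq w₁ n) (seq w₂ n))
      , mkZero (null-0 λ n → I.det-combination₁ (seq x₁ n) (seq x₂ n) (seq y₁ n) (seq y₂ n)
          (seq z₁ n) (seq z₂ n) (seq w₁ n) (seq w₂ n))
      , mkZero (null-0 λ n → I.det-combination₂ (seq x₁ n) (seq x₂ n) (seq y₁ n) (seq y₂ n)
          (seq z₁ n) (seq z₂ n) (seq w₁ n) (seq w₂ n))

    private
      rotated¹ : Dependence c₂ c₃ c₄ c₁ y z w x
      rotated¹ = dep-rotate {c₁} {c₂} {c₃} {c₄} {x} {y} {z} {w} det-dependence
      rotated² : Dependence c₃ c₄ c₁ c₂ z w x y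
      rotated² = dep-rotate {c₂} {c₃} {c₄} {c₁} {y} {z} {w} {x} rotated¹
      rotated³ : Dependence c₄ c₁ c₂ c₃ w x y z
      rotated³ = dep-rotate {c₃} {c₄} {c₁} {c₂} {z} {w} {x} {y} rotated²
      swapped : Dependence c₁ c₃ c₂ c₄ x z y w
      -- One rotation brings the middle points to the front, where they are exchanged; three further
      -- rotations complete the full turn.
      swapped = dep-rotate {c₄} {c₁} {c₃} {c₂} {w} {x} {z} {y}
        (dep-rotate {c₂} {c₄} {c₁} {c₃} {y} {w} {x} {z}
          (dep-rotate {c₃} {c₂} {c₄} {c₁} {z} {y} {w} {x}
            (dep-swap {c₂} {c₃} {c₄} {c₁} {y} {z} {w} {x} rotated¹)))

      isolated-x : ∀ {s} → HasSign s c₁ → HasSign (not s) c₂ → HasSign (not s) c₃ → HasSign (not s) c₄ →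
        x ∈△[ y , z , w ]
      isolated-x = Quadruple.isolated⇒∈△ x y z w c₁ c₂ c₃ c₄ det-dependence
      isolated-y : ∀ {s} → HasSign s c₂ → HasSign (not s) c₃ → HasSign (not s) c₄ → HasSign (not s) c₁ →
        y ∈△[ z , w , x ]
      isolated-y = Quadruple.isolated⇒∈△ y z w x c₂ c₃ c₄ c₁ rotated¹
      isolated-z : ∀ {s} → HasSign s c₃ → HasSign (not s) c₄ → HasSign (not s) c₁ → HasSign (not s) c₂ →
        z ∈△[ w , x , y ]
      isolated-z = Quadruple.isolated⇒∈△ z w x y c₃ c₄ c₁ c₂ rotated²
      isolated-w : ∀ {s} → HasSign s c₄ → HasSign (not s) c₁ → HasSign (not s) c₂ → HasSign (not s) c₃ →
        w ∈△[ x , y , z ]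
      isolated-w = Quadruple.isolated⇒∈△ w x y z c₄ c₁ c₂ c₃ rotated³

    module _ {s₁ s₂ s₃ s₄} (h₁ : HasSign s₁ (det y z w)) (h₂ : HasSign s₂ (det x z w))
             (h₃ : HasSign s₃ (det x y w)) (h₄ : HasSign s₄ (det x y z)) where

      private
        paired : s₁ ≡ not s₂ → s₃ ≡ not s₄ → Meet x y z w
        paired refl refl = Quadruple.paired⇒meet x y z w c₁ c₂ c₃ c₄ det-dependence
          h₁ (sign-neg h₂) h₃ (sign-neg h₄)

        swapped-paired : s₁ ≡ s₃ → s₂ ≡ s₄ → Meet x z y w
        swapped-paired refl refl = Quadruple.paired⇒meet x z y w c₁ c₃ c₂ c₄ swapped
          h₁ h₃ (sign-neg h₂) (sign-neg h₄)

        rotated-paired : s₁ ≡ not s₄ → s₃ ≡ not s₂ → Meet w x y z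
        rotated-paired refl refl = Quadruple.paired⇒meet w x y z c₄ c₁ c₂ c₃ rotated³
          (sign-neg h₄) h₁ (sign-neg h₂) h₃

      -- The second hypothesis puts `z` and `w` on opposite sides of the line through `x` and `y`.
      -- Even parity then puts `x` and `y` on opposite sides of the line through `z` and `w`.
      even∧opposite⇒meet : s₁ xor s₂ xor s₃ xor s₄ ≡ false → s₃ ≡ not s₄ → Meet x y z w
      even∧opposite⇒meet even eq = paired (first s₁ s₂ s₃ s₄ even eq) eq
        where
        first : ∀ a b c d → a xor b xor c xor d ≡ false → c ≡ not d → a ≡ not b
        first true  true  true  false () refl
        first true  true  false true  () refl
        first false false true  false () refl
        first false false false true  () refl
        first true  false _     _     _  _    = refl
        first false true  _     _     _  _    = refl

      -- The coefficients of the dependence carry the signs `s₁`, `not s₂`, `s₃`, `not s₄`; two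
      -- negations preserve parity. An even number of negative coefficients, with a sum of zero,
      -- means two of each sign, and the three ways to pair the points give the three alternatives.
      even⇒meet : s₁ xor s₂ xor s₃ xor s₄ ≡ false → Meet x y z w ⊎ Meet x z y w ⊎ Meet w x y z
      even⇒meet even with split s₁ s₂ s₃ s₄ even
        where
        split : ∀ a b c d → a xor b xor c xor d ≡ false →
          (a ≡ not b × c ≡ not d) ⊎ (a ≡ c × b ≡ d) ⊎ (a ≡ not d × c ≡ not b)
        split true  true  true  true  _ = inj₂ (inj₁ (refl , refl))
        split true  true  false false _ = inj₂ (inj₂ (refl , refl))
        split true  false true  false _ = inj₁ (refl , refl)
        split true  false false true  _ = inj₁ (refl , refl)
        split false true  true  false _ = inj₁ (refl , refl)
        split false true  false true  _ = inj₁ (refl , refl)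
        split false false true  true  _ = inj₂ (inj₂ (refl , refl))
        split false false false false _ = inj₂ (inj₁ (refl , refl))
      ... | inj₁ (p , q)        = inj₁ (paired p q)
      ... | inj₂ (inj₁ (p , q)) = inj₂ (inj₁ (swapped-paired p q))
      ... | inj₂ (inj₂ (p , q)) = inj₂ (inj₂ (rotated-paired p q))

    -- An odd number of negative coefficients leaves exactly one coefficient alone of its sign, and
    -- its point lies in the triangle of the others.
    odd⇒∈△ : ∀ {s₁ s₂ s₃ s₄} → HasSign s₁ (det y z w) → HasSign s₂ (det x z w) →
      HasSign s₃ (det x y w) → HasSign s₄ (det x y z) → s₁ xor s₂ xor s₃ xor s₄ ≡ true →
      x ∈△[ y , z , w ] ⊎ y ∈△[ z , w , x ] ⊎ z ∈△[ w , x , y ] ⊎ w ∈△[ x , y , z ]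
    odd⇒∈△ h₁ h₂ h₃ h₄ = choose h₁ (sign-neg h₂) h₃ (sign-neg h₄)
      where
      choose : ∀ {a b c d} → HasSign a c₁ → HasSign (not b) c₂ → HasSign c c₃ → HasSign (not d) c₄ →
        a xor b xor c xor d ≡ true →
        x ∈△[ y , z , w ] ⊎ y ∈△[ z , w , x ] ⊎ z ∈△[ w , x , y ] ⊎ w ∈△[ x , y , z ]
      choose {true}  {true}  {false} {true}  g₁ g₂ g₃ g₄ _ = inj₁ (isolated-x g₁ g₂ g₃ g₄)
      choose {false} {false} {true}  {false} g₁ g₂ g₃ g₄ _ = inj₁ (isolated-x g₁ g₂ g₃ g₄)
      choose {true}  {true}  {true}  {false} g₁ g₂ g₃ g₄ _ = inj₂ (inj₁ (isolated-y g₂ g₃ g₄ g₁))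
      choose {false} {false} {false} {true}  g₁ g₂ g₃ g₄ _ = inj₂ (inj₁ (isolated-y g₂ g₃ g₄ g₁))
      choose {false} {true}  {true}  {true}  g₁ g₂ g₃ g₄ _ = inj₂ (inj₂ (inj₁ (isolated-z g₃ g₄ g₁ g₂)))
      choose {true}  {false} {false} {false} g₁ g₂ g₃ g₄ _ = inj₂ (inj₂ (inj₁ (isolated-z g₃ g₄ g₁ g₂)))
      choose {true}  {false} {true}  {true}  g₁ g₂ g₃ g₄ _ = inj₂ (inj₂ (inj₂ (isolated-w g₄ g₁ g₂ g₃)))
      choose {false} {true}  {false} {false} g₁ g₂ g₃ g₄ _ = inj₂ (inj₂ (inj₂ (isolated-w g₄ g₁ g₂ g₃)))

-- Triangles inside the convex hull of a family.

module Hull where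

  open import Defs
  open Reals
  open AffineDependence using (_∈△[_,_,_])
  open import Algebra.Properties.CommutativeMonoid.Sum ℚₚ.+-0-commutativeMonoid using (sum; sum-cong-≗; sum-replicate-zero; ∑-distrib-+)

  sum-single : ∀ {n} (f : Fin n → ℚ) a → (∀ w → w ≢ a → f w ≡ 0ℚ) → sum f ≡ f a
  sum-single {ℕ.suc n} f zero off = trans
    (cong (f zero ℚ.+_) (trans (sum-cong-≗ (λ w → off (suc w) λ ())) (sum-replicate-zero n)))
    (ℚₚ.+-identityʳ (f zero))
  sum-single {ℕ.suc n} f (suc a) off = trans
    (cong₂ ℚ._+_ (off zero λ ()) (sum-single (f ∘ suc) a (λ w w≢a → off (suc w) (w≢a ∘ Finₚ.suc-injective))))
    (ℚₚ.+-identityˡ (f (suc a)))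

  seq-∑ : ∀ {m} (f : Fin m → ℝ) n → seq (∑ f) n ≡ sum (λ w → seq (f w) n)
  seq-∑ {ℕ.zero}  f n = refl
  seq-∑ {ℕ.suc m} f n = cong (seq (f zero) n ℚ.+_) (seq-∑ (f ∘ suc) n)

  at : ∀ {m} → Fin m → ℝ → Fin m → ℝ
  at a α w = if does (w Fin.≟ a) then α else 0ℝ

  at-self : ∀ {m} (a : Fin m) α → at a α a ≡ α
  at-self a α rewrite dec-true (a Fin.≟ a) refl = refl

  at-other : ∀ {m} (a w : Fin m) α → w ≢ a → at a α w ≡ 0ℝ
  at-other a w α w≢a rewrite dec-false (w Fin.≟ a) w≢a = refl

  at-nonnegative : ∀ {m} (a w : Fin m) {α} → NonNegative α → NonNegative (at a α w)
  at-nonnegative a w 0≤α with does (w Fin.≟ a)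
  ... | true  = 0≤α
  ... | false = zero⇒nonnegative {0ℝ} (mkZero (null-0 λ _ → refl))

  sum-at : ∀ {m} (a : Fin m) α (q : Fin m → ℚ) n → sum (λ w → seq (at a α w) n ℚ.* q w) ≡ seq α n ℚ.* q a
  sum-at a α q n = trans
    (sum-single (λ w → seq (at a α w) n ℚ.* q w) a λ w w≢a →
      trans (cong (λ x → seq x n ℚ.* q w) (at-other a w α w≢a)) (ℚₚ.*-zeroˡ (q w)))
    (cong (λ x → seq x n ℚ.* q a) (at-self a α))

  ≃-cong : ∀ x x′ y y′ → x ≐ x′ → y ≐ y′ → x ≃ y → x′ ≃ y′
  ≃-cong x x′ y y′ p q h =
    zero⇒≃ {x′} {y′} (zero-cong {x - y} {x′ - y′} (λ n → cong₂ ℚ._-_ (p n) (q n)) (≃⇒zero {x} {y} h))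

  module _ {m} (a b c : Fin m) (α β γ : ℝ) where

    -- Adding point masses lets the corners coincide: where they do, the weights accumulate.
    -- Segments are treated as triangles with a repeated corner.
    weights : Fin m → ℝ
    weights w = at a α w + at b β w + at c γ w

    sum-weights : ∀ (q : Fin m → ℚ) n →
      sum (λ w → seq (weights w) n ℚ.* q w) ≡ seq α n ℚ.* q a ℚ.+ seq β n ℚ.* q b ℚ.+ seq γ n ℚ.* q c
    sum-weights q n = begin
      sum (λ w → (A w ℚ.+ B w ℚ.+ C w) ℚ.* q w)
        ≡⟨ sum-cong-≗ (λ w → trans (ℚₚ.*-distribʳ-+ (q w) (A w ℚ.+ B w) (C w))
             (cong (ℚ._+ C w ℚ.* q w) (ℚₚ.*-distribʳ-+ (q w) (A w) (B w)))) ⟩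
      sum (λ w → A w ℚ.* q w ℚ.+ B w ℚ.* q w ℚ.+ C w ℚ.* q w)
        ≡⟨ ∑-distrib-+ (λ w → A w ℚ.* q w ℚ.+ B w ℚ.* q w) (λ w → C w ℚ.* q w) ⟩
      sum (λ w → A w ℚ.* q w ℚ.+ B w ℚ.* q w) ℚ.+ sum (λ w → C w ℚ.* q w)
        ≡⟨ cong₂ ℚ._+_ (trans (∑-distrib-+ (λ w → A w ℚ.* q w) (λ w → B w ℚ.* q w))
             (cong₂ ℚ._+_ (sum-at a α q n) (sum-at b β q n))) (sum-at c γ q n) ⟩
      seq α n ℚ.* q a ℚ.+ seq β n ℚ.* q b ℚ.+ seq γ n ℚ.* q c ∎
      where
      open ≡-Reasoning
      A B C : Fin m → ℚ
      A w = seq (at a α w) n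
      B w = seq (at b β w) n
      C w = seq (at c γ w) n

    ∑-weights : ∑ weights ≐ α + β + γ
    ∑-weights n = begin
      seq (∑ weights) n                       ≡⟨ seq-∑ weights n ⟩
      sum (λ w → seq (weights w) n)           ≡⟨ sum-cong-≗ (λ w → sym (ℚₚ.*-identityʳ (seq (weights w) n))) ⟩
      sum (λ w → seq (weights w) n ℚ.* 1ℚ)    ≡⟨ sum-weights (λ _ → 1ℚ) n ⟩
      seq α n ℚ.* 1ℚ ℚ.+ seq β n ℚ.* 1ℚ ℚ.+ seq γ n ℚ.* 1ℚ
        ≡⟨ cong₂ ℚ._+_ (cong₂ ℚ._+_ (ℚₚ.*-identityʳ (seq α n)) (ℚₚ.*-identityʳ (seq β n))) (ℚₚ.*-identityʳ (seq γ n)) ⟩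
      seq α n ℚ.+ seq β n ℚ.+ seq γ n         ∎
      where open ≡-Reasoning

    ∑-weights-* : ∀ (Q : Fin m → ℝ) → ∑ (λ w → weights w * Q w) ≐ α * Q a + β * Q b + γ * Q c
    ∑-weights-* Q n = trans (seq-∑ (λ w → weights w * Q w) n) (sum-weights (λ w → seq (Q w) n) n)

    ≃-∑-weights-* : ∀ x (Q : Fin m → ℝ) → x ≃ α * Q a + β * Q b + γ * Q c → x ≃ ∑ (λ w → weights w * Q w)
    ≃-∑-weights-* x Q = ≃-cong x x (α * Q a + β * Q b + γ * Q c) (∑ (λ w → weights w * Q w))
      (λ _ → refl) (λ n → sym (∑-weights-* Q n))

  ∈△⇒inHull : ∀ {m} (P : Fin m → ℝ²) {v a b c} → v ≢ a → v ≢ b → v ≢ c →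
    P v ∈△[ P a , P b , P c ] → InHullWithout P v (P v)
  ∈△⇒inHull {m} P {v} {a} {b} {c} v≢a v≢b v≢c (α , β , γ , 0≤α , 0≤β , 0≤γ , sum≃1 , eq₁ , eq₂) =
      weights a b c α β γ
    , (λ w → nonnegative⇒0≤ {weights a b c α β γ w} (nonnegative-+ {at a α w + at b β w} {at c γ w}
        (nonnegative-+ {at a α w} {at b β w} (at-nonnegative a w {α} 0≤α) (at-nonnegative b w {β} 0≤β))
        (at-nonnegative c w {γ} 0≤γ)))
    , ≐⇒≃ {weights a b c α β γ v} {0ℝ} (λ n →
        cong₂ ℚ._+_ (cong₂ ℚ._+_ (vanish a α v≢a n) (vanish b β v≢b n)) (vanish c γ v≢c n))
    , ≃-cong (α + β + γ) (∑ (weights a b c α β γ)) 1ℝ 1ℝ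
        (λ n → sym (∑-weights a b c α β γ n)) (λ _ → refl) sum≃1
    , ≃-∑-weights-* a b c α β γ (proj₁ (P v)) (λ w → proj₁ (P w)) eq₁
    , ≃-∑-weights-* a b c α β γ (proj₂ (P v)) (λ w → proj₂ (P w)) eq₂
    where
    vanish : ∀ u x → v ≢ u → ∀ n → seq (at u x v) n ≡ 0ℚ
    vanish u x v≢u n = cong (λ z → seq z n) (at-other u v x v≢u)

-- The crossing parity count in K_{3,3}.

module Parity where

  isolate : ∀ c v u w → c xor v xor u xor w ≡ false → w ≡ c xor v xor u
  isolate c v u w eq = trans (Q.isolate-id c v u w) (cong (_xor (c xor v xor u)) eq)

  off-diagonal : (Fin 3 → Fin 3 → Bool) → Bool
  off-diagonal f = (f 0F 1F xor f 1F 0F) xor (f 0F 2F xor f 2F 0F) xor (f 1F 2F xor f 2F 1F)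

  -- After `w j j′` is replaced by the other three terms, the six summands contain `c` six times and
  -- each `u j` and `v j` twice.
  off-diagonal-bilinear : ∀ c (u v : Fin 3 → Bool) (w : Fin 3 → Fin 3 → Bool) →
    (∀ j j′ → j ≢ j′ → c xor v j′ xor u j xor w j j′ ≡ false) → off-diagonal w ≡ false
  off-diagonal-bilinear c u v w h = trans
    (cong₂ _xor_ (pair 0F 1F (λ ()) (λ ())) (cong₂ _xor_ (pair 0F 2F (λ ()) (λ ())) (pair 1F 2F (λ ()) (λ ()))))
    (Q.bilinear-id c (u 0F) (u 1F) (u 2F) (v 0F) (v 1F) (v 2F))
    where
    pair : ∀ j j′ → j ≢ j′ → j′ ≢ j →
      w j j′ xor w j′ j ≡ (c xor v j′ xor u j) xor (c xor v j xor u j′)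
    pair j j′ j≢j′ j′≢j = cong₂ _xor_
      (isolate c (v j′) (u j) (w j j′) (h j j′ j≢j′)) (isolate c (v j) (u j′) (w j′ j) (h j′ j j′≢j))

  module _ {V : Set} (L : V → V → Bool) where

    -- With `L` the order of points on a convex curve, the sum is the crossing parity of the chord
    -- from `c i` to `ℓ i j` and the chord from `c i′` to `ℓ i′ j′`. The restriction to different
    -- indices on both sides selects independent edges of K_{3,3}.
    NonCrossingStars : (Fin 3 → V) → (Fin 3 → Fin 3 → V) → Set
    NonCrossingStars c ℓ = ∀ i i′ j j′ → i ≢ i′ → j ≢ j′ →
      L (c i) (c i′) xor L (c i) (ℓ i′ j′) xor L (ℓ i j) (c i′) xor L (ℓ i j) (ℓ i′ j′) ≡ false

    -- Summing over the pairs with `j ≢ j′` cancels every term that involves a centre, so a relation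
    -- among the leaves alone remains.
    stars-parity : ∀ {c ℓ} → NonCrossingStars c ℓ → ∀ i i′ → i ≢ i′ →
      off-diagonal (λ j j′ → L (ℓ i j) (ℓ i′ j′)) ≡ false
    stars-parity {c} {ℓ} h i i′ i≢i′ = off-diagonal-bilinear (L (c i) (c i′))
      (λ j → L (ℓ i j) (c i′)) (λ j′ → L (c i) (ℓ i′ j′)) (λ j j′ → L (ℓ i j) (ℓ i′ j′))
      (λ j j′ j≢j′ → h i i′ j j′ i≢i′ j≢j′)

    -- Every pair of cells in different rows and columns is counted once by rows
    -- and once by columns; for the nine decreasing pairs the two counts are
    -- opposite, and nine is odd.
    rows∧columns⇒⊥ : ∀ {a b m} → (∀ i i′ j j′ → i ≢ i′ → L (m i′ j) (m i j′) ≡ not (L (m i j′) (m i′ j))) →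
      NonCrossingStars a m → NonCrossingStars b (λ j i → m i j) → ⊥
    rows∧columns⇒⊥ {a} {b} {m} anti rows columns = contradiction
      where
      r : Fin 3 → Fin 3 → Fin 3 → Fin 3 → Bool
      r i i′ j j′ = L (m i j) (m i′ j′) xor L (m i j′) (m i′ j)
      row : ∀ i i′ → i ≢ i′ → r i i′ 0F 1F xor r i i′ 0F 2F xor r i i′ 1F 2F ≡ false
      row = stars-parity rows
      flip : ∀ i i′ j j′ → i ≢ i′ → L (m i j) (m i′ j′) xor L (m i′ j) (m i j′) ≡ true xor r i i′ j j′
      flip i i′ j j′ i≢i′ = trans (cong (L (m i j) (m i′ j′) xor_) (anti i i′ j j′ i≢i′))
        (Q.not-out (L (m i j) (m i′ j′)) (L (m i j′) (m i′ j)))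
      column : ∀ j j′ → j ≢ j′ →
        (true xor r 0F 1F j j′) xor (true xor r 0F 2F j j′) xor (true xor r 1F 2F j j′) ≡ false
      column j j′ j≢j′ = trans
        (sym (cong₂ _xor_ (flip 0F 1F j j′ λ ()) (cong₂ _xor_ (flip 0F 2F j j′ λ ()) (flip 1F 2F j j′ λ ()))))
        (stars-parity columns j j′ j≢j′)
      false≢true : false ≡ true → ⊥
      false≢true ()
      contradiction : ⊥
      contradiction = false≢true (trans (sym
        (cong₂ _xor_
          (cong₂ _xor_ (row 0F 1F λ ()) (cong₂ _xor_ (row 0F 2F λ ()) (row 1F 2F λ ())))
          (cong₂ _xor_ (column 0F 1F λ ()) (cong₂ _xor_ (column 0F 2F λ ()) (column 1F 2F λ ())))))
        (Q.total (r 0F 1F 0F 1F) (r 0F 1F 0F 2F) (r 0F 1F 1F 2F)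
               (r 0F 2F 0F 1F) (r 0F 2F 0F 2F) (r 0F 2F 1F 2F)
               (r 1F 2F 0F 1F) (r 1F 2F 0F 2F) (r 1F 2F 1F 2F)))

-- Orientations of all triples, and the two parity contradictions.

module Chirotopes where

  open import Defs
  open Reals
  open AffineDependence using (Meet; _∈△[_,_,_])
  open Collinearity
  open Quadruples
  open Hull
  open Parity using (rows∧columns⇒⊥)

  -- A double-negation shift, provable because the index set is finite. It brings the signs of all
  -- triples under a single double negation.
  ¬¬-Π : ∀ {n} {A : Fin n → Set} → (∀ i → ¬ ¬ A i) → ¬ ¬ (∀ i → A i)
  ¬¬-Π {ℕ.zero}  h ¬a = ¬a λ ()
  ¬¬-Π {ℕ.suc n} h ¬a = h zero λ a₀ → ¬¬-Π (λ i → h (suc i)) λ as → ¬a λ { zero → a₀ ; (suc i) → as i }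

  -- Equality of indices is decidable, so a triple with a repeated index receives the arbitrary sign
  -- `true`, and the double negation is used only for triples of different indices.
  ¬¬-guarded : ∀ {A B C : Set} {S : Bool → Set} → Dec A → Dec B → Dec C →
    (¬ A → ¬ B → ¬ C → ¬ ¬ ∃ S) → ¬ ¬ (∃[ s ] (¬ A → ¬ B → ¬ C → S s))
  ¬¬-guarded (yes a) _       _       h k = k (true , λ ¬a _ _ → ⊥-elim (¬a a))
  ¬¬-guarded (no _)  (yes b) _       h k = k (true , λ _ ¬b _ → ⊥-elim (¬b b))
  ¬¬-guarded (no _)  (no _)  (yes c) h k = k (true , λ _ _ ¬c → ⊥-elim (¬c c))
  ¬¬-guarded (no ¬a) (no ¬b) (no ¬c) h k = h ¬a ¬b ¬c λ (s , x) → k (s , λ _ _ _ → x)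

  Chirotope : ∀ {n} → (Fin n → ℝ²) → (Fin n → Fin n → Fin n → Bool) → Set
  Chirotope P σ = ∀ u v w → u ≢ v → u ≢ w → v ≢ w → HasSign (σ u v w) (det (P u) (P v) (P w))

  module _ {n} (P : Fin n → ℝ²) where

    ¬¬chirotope : (∀ u v w → u ≢ v → u ≢ w → v ≢ w → ¬ Zero (det (P u) (P v) (P w))) →
      ¬ ¬ (∃[ σ ] Chirotope P σ)
    ¬¬chirotope nonzero ¬σ = ¬¬-Π (λ u → ¬¬-Π (λ v → ¬¬-Π (λ w → decide u v w))) λ signs →
      ¬σ ((λ u v w → proj₁ (signs u v w)) , λ u v w → proj₂ (signs u v w))
      where
      decide : ∀ u v w → ¬ ¬ (∃[ s ] (u ≢ v → u ≢ w → v ≢ w → HasSign s (det (P u) (P v) (P w))))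
      decide u v w = ¬¬-guarded (u Fin.≟ v) (u Fin.≟ w) (v Fin.≟ w) λ u≢v u≢w v≢w →
        nonzero⇒¬¬sign (det (P u) (P v) (P w)) (nonzero u v w u≢v u≢w v≢w)

    module _ (distinct : ∀ u v → u ≢ v → ¬ P u ≈ P v)
             (avoids : ∀ u v w → u ≢ v → w ≢ u → w ≢ v → ¬ P w ∈[ P u , P v ]) where

      general-position : ∀ u v w → u ≢ v → u ≢ w → v ≢ w → ¬ Zero (det (P u) (P v) (P w))
      general-position u v w u≢v u≢w v≢w = det-nonzero (P u) (P v) (P w) (distinct u v u≢v)
        (avoids v w u v≢w u≢v u≢w) (avoids w u v (≢-sym u≢w) v≢w (≢-sym u≢v))
        (avoids u v w u≢v (≢-sym u≢w) (≢-sym v≢w))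

  -- Without crossings every quadruple is odd, since an even one has two meeting segments. The sum
  -- of the five odd values is odd, while double counting of the triples makes it even.
  K₅-crosses : (P : Fin 5 → ℝ²) → (∀ u v → u ≢ v → ¬ P u ≈ P v) →
    (∀ u v w → u ≢ v → w ≢ u → w ≢ v → ¬ P w ∈[ P u , P v ]) →
    ¬ (∀ u v w t → u ≢ v → u ≢ w → u ≢ t → v ≢ w → v ≢ t → w ≢ t → ¬ Meet (P u) (P v) (P w) (P t))
  K₅-crosses P distinct avoids ¬meet = ¬¬chirotope P (general-position P distinct avoids) λ (σ , sign) →
    contradiction σ sign
    where
    module _ (σ : Fin 5 → Fin 5 → Fin 5 → Bool) (sign : Chirotope P σ) where
      odd : ∀ x y z w → x ≢ y → x ≢ z → x ≢ w → y ≢ z → y ≢ w → z ≢ w →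
        σ y z w xor σ x z w xor σ x y w xor σ x y z ≡ true
      odd x y z w x≢y x≢z x≢w y≢z y≢w z≢w = ¬-not λ even → ¬meets
        (SignedQuadruple.even⇒meet (P x) (P y) (P z) (P w)
          (sign y z w y≢z y≢w z≢w) (sign x z w x≢z x≢w z≢w) (sign x y w x≢y x≢w y≢w) (sign x y z x≢y x≢z y≢z) even)
        where
        ¬meets : ¬ (Meet (P x) (P y) (P z) (P w) ⊎ Meet (P x) (P z) (P y) (P w) ⊎ Meet (P w) (P x) (P y) (P z))
        ¬meets (inj₁ m)        = ¬meet x y z w x≢y x≢z x≢w y≢z y≢w z≢w m
        ¬meets (inj₂ (inj₁ m)) = ¬meet x z y w x≢z x≢y x≢w (≢-sym y≢z) z≢w y≢w m
        ¬meets (inj₂ (inj₂ m)) =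
          ¬meet w x y z (≢-sym x≢w) (≢-sym y≢w) (≢-sym z≢w) x≢y x≢z y≢z m
      false≢true : false ≡ true → ⊥
      false≢true ()
      -- Each of the ten triples lies in two of the five quadruples.
      contradiction : ⊥
      contradiction = false≢true (trans
        (sym (Q.five-subsets (σ 0F 1F 2F) (σ 0F 1F 3F) (σ 0F 1F 4F) (σ 0F 2F 3F) (σ 0F 2F 4F)
               (σ 0F 3F 4F) (σ 1F 2F 3F) (σ 1F 2F 4F) (σ 1F 3F 4F) (σ 2F 3F 4F)))
        (cong₂ _xor_ (odd 0F 1F 2F 3F (λ ()) (λ ()) (λ ()) (λ ()) (λ ()) (λ ()))
          (cong₂ _xor_ (odd 0F 1F 2F 4F (λ ()) (λ ()) (λ ()) (λ ()) (λ ()) (λ ()))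
            (cong₂ _xor_ (odd 0F 1F 3F 4F (λ ()) (λ ()) (λ ()) (λ ()) (λ ()) (λ ()))
              (cong₂ _xor_ (odd 0F 2F 3F 4F (λ ()) (λ ()) (λ ()) (λ ()) (λ ()) (λ ()))
                (odd 1F 2F 3F 4F (λ ()) (λ ()) (λ ()) (λ ()) (λ ()) (λ ())))))))

  ∈[]⇒∈△ : ∀ {x y z} → x ∈[ y , z ] → x ∈△[ y , z , z ]
  ∈[]⇒∈△ {x} {y} {z} (s , t , 0≤s , 0≤t , sum , eq₁ , eq₂) =
      s , t , 0ℝ , 0≤⇒nonnegative {s} 0≤s , 0≤⇒nonnegative {t} 0≤t , zero⇒nonnegative {0ℝ} 0ℝ-zero
    , ≃-cong (s + t) (s + t + 0ℝ) 1ℝ 1ℝ (λ n → sym (ℚₚ.+-identityʳ (seq s n ℚ.+ seq t n))) (λ _ → refl) sum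
    , coordinate (proj₁ x) (proj₁ y) (proj₁ z) eq₁
    , coordinate (proj₂ x) (proj₂ y) (proj₂ z) eq₂
    where
    coordinate : ∀ p q r → p ≃ s * q + t * r → p ≃ s * q + t * r + 0ℝ * r
    coordinate p q r = ≃-cong p p (s * q + t * r) (s * q + t * r + 0ℝ * r) (λ _ → refl)
      (λ n → sym (I.pad (seq s n ℚ.* seq q n ℚ.+ seq t n ℚ.* seq r n) (seq r n)))

  module ConvexFamily {n} (P : Fin n → ℝ²) (distinct : ∀ u v → u ≢ v → ¬ P u ≈ P v) (convex : ConvexPosition P) where

    ¬∈△ : ∀ x y z w → x ≢ y → x ≢ z → x ≢ w → ¬ P x ∈△[ P y , P z , P w ]
    ¬∈△ x y z w x≢y x≢z x≢w h = convex x (∈△⇒inHull P x≢y x≢z x≢w h)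

    ¬¬signs : ¬ ¬ (∃[ σ ] Chirotope P σ)
    ¬¬signs = ¬¬chirotope P (general-position P distinct λ u v w u≢v w≢u w≢v h →
      ¬∈△ w u v v w≢u w≢v w≢v (∈[]⇒∈△ {P w} {P u} {P v} h))

    module _ {σ} (sign : Chirotope P σ) where

      -- An odd quadruple has a point in the triangle of the others, against convex position.
      even : ∀ x y z w → x ≢ y → x ≢ z → x ≢ w → y ≢ z → y ≢ w → z ≢ w →
        σ y z w xor σ x z w xor σ x y w xor σ x y z ≡ false
      even x y z w x≢y x≢z x≢w y≢z y≢w z≢w = ¬-not λ odd → ¬hull
        (SignedQuadruple.odd⇒∈△ (P x) (P y) (P z) (P w)
          (sign y z w y≢z y≢w z≢w) (sign x z w x≢z x≢w z≢w) (sign x y w x≢y x≢w y≢w) (sign x y z x≢y x≢z y≢z) odd)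
        where
        ¬hull : ¬ (P x ∈△[ P y , P z , P w ] ⊎ P y ∈△[ P z , P w , P x ] ⊎
                   P z ∈△[ P w , P x , P y ] ⊎ P w ∈△[ P x , P y , P z ])
        ¬hull (inj₁ h)               = ¬∈△ x y z w x≢y x≢z x≢w h
        ¬hull (inj₂ (inj₁ h))        = ¬∈△ y z w x y≢z y≢w (≢-sym x≢y) h
        ¬hull (inj₂ (inj₂ (inj₁ h))) = ¬∈△ z w x y z≢w (≢-sym x≢z) (≢-sym y≢z) h
        ¬hull (inj₂ (inj₂ (inj₂ h))) = ¬∈△ w x y z (≢-sym x≢w) (≢-sym y≢w) (≢-sym z≢w) h

      ¬meet⇒same-side : ∀ x y z w → x ≢ y → x ≢ z → x ≢ w → y ≢ z → y ≢ w → z ≢ w →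
        ¬ Meet (P x) (P y) (P z) (P w) → σ x y w ≡ σ x y z
      ¬meet⇒same-side x y z w x≢y x≢z x≢w y≢z y≢w z≢w ¬meet =
        decidable-stable (σ x y w ≟ σ x y z) λ neq → ¬meet (SignedQuadruple.even∧opposite⇒meet (P x) (P y) (P z) (P w)
        (sign y z w y≢z y≢w z≢w) (sign x z w x≢z x≢w z≢w) (sign x y w x≢y x≢w y≢w) (sign x y z x≢y x≢z y≢z)
        (even x y z w x≢y x≢z x≢w y≢z y≢w z≢w) (¬-not neq))

      antisym : ∀ o x y → o ≢ x → o ≢ y → x ≢ y → σ o y x ≡ not (σ o x y)
      antisym o x y o≢x o≢y x≢y = sign-unique (det (P o) (P y) (P x)) (sign o y x o≢y o≢x (≢-sym x≢y))
        (sign-cong (neg (det (P o) (P x) (P y))) (det (P o) (P y) (P x))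
          (λ n → I.det-swap (seq (proj₁ (P o)) n) (seq (proj₂ (P o)) n) (seq (proj₁ (P x)) n)
            (seq (proj₂ (P x)) n) (seq (proj₁ (P y)) n) (seq (proj₂ (P y)) n))
          (sign-neg (sign o x y o≢x o≢y x≢y)))

      -- Seen from o, the points are linearly ordered, and the parity of the
      -- number of crossings of two chords is bilinear in this order.
      ¬meet⇒parity : ∀ o x y z w → o ≢ x → o ≢ y → o ≢ z → o ≢ w →
        x ≢ y → x ≢ z → x ≢ w → y ≢ z → y ≢ w → z ≢ w → ¬ Meet (P x) (P y) (P z) (P w) →
        σ o x z xor σ o x w xor σ o y z xor σ o y w ≡ false
      ¬meet⇒parity o x y z w o≢x o≢y o≢z o≢w x≢y x≢z x≢w y≢z y≢w z≢w ¬meet = trans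
        (sym (Q.elimination (σ x y z) (σ o y z) (σ o x z) (σ o x y) (σ o y w) (σ o x w)))
        (cong₂ _xor_ (even o x y z o≢x o≢y o≢z x≢y x≢z y≢z)
          (trans (cong (_xor σ o y w xor σ o x w xor σ o x y)
              (sym (¬meet⇒same-side x y z w x≢y x≢z x≢w y≢z y≢w z≢w ¬meet)))
            (even o x y w o≢x o≢y o≢w x≢y x≢w y≢w)))

    module _ {o : Fin n} {a b : Fin 3 → Fin n} {m : Fin 3 → Fin 3 → Fin n}
      (o≢a : ∀ i → o ≢ a i) (o≢b : ∀ j → o ≢ b j) (o≢m : ∀ i j → o ≢ m i j)
      (a≢m : ∀ i i′ j → a i ≢ m i′ j) (b≢m : ∀ j i j′ → b j ≢ m i j′)
      (a-distinct : ∀ i i′ → i ≢ i′ → a i ≢ a i′) (b-distinct : ∀ j j′ → j ≢ j′ → b j ≢ b j′)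
      (m-distinct₁ : ∀ i i′ j j′ → i ≢ i′ → m i j ≢ m i′ j′)
      (m-distinct₂ : ∀ i i′ j j′ → j ≢ j′ → m i j ≢ m i′ j′)
      (a-stars : ∀ i i′ j j′ → i ≢ i′ → ¬ Meet (P (a i)) (P (m i j)) (P (a i′)) (P (m i′ j′)))
      (b-stars : ∀ i i′ j j′ → j ≢ j′ → ¬ Meet (P (b j)) (P (m i j)) (P (b j′)) (P (m i′ j′))) where

      -- Rows are the stars of the `a i`, columns the stars of the `b j`, and both are counted in
      -- the one order seen from `o`. Chords of an `a`-star may cross chords of a `b`-star freely.
      no-grid : ⊥
      no-grid = ¬¬signs λ (σ , sign) → rows∧columns⇒⊥ (σ o) {a} {b} {m}
        (λ i i′ j j′ i≢i′ → antisym sign o (m i j′) (m i′ j) (o≢m i j′) (o≢m i′ j) (m-distinct₁ i i′ j′ j i≢i′))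
        (λ i i′ j j′ i≢i′ j≢j′ → ¬meet⇒parity sign o (a i) (m i j) (a i′) (m i′ j′)
          (o≢a i) (o≢m i j) (o≢a i′) (o≢m i′ j′)
          (a≢m i i j) (a-distinct i i′ i≢i′) (a≢m i i′ j′) (≢-sym (a≢m i′ i j)) (m-distinct₁ i i′ j j′ i≢i′)
          (a≢m i′ i′ j′) (a-stars i i′ j j′ i≢i′))
        (λ j j′ i i′ j≢j′ i≢i′ → ¬meet⇒parity sign o (b j) (m i j) (b j′) (m i′ j′)
          (o≢b j) (o≢m i j) (o≢b j′) (o≢m i′ j′)
          (b≢m j i j) (b-distinct j j′ j≢j′) (b≢m j i′ j′) (≢-sym (b≢m j′ i j)) (m-distinct₂ i i′ j j′ j≢j′)
          (b≢m j′ i′ j′) (b-stars i i′ j j′ j≢j′))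

-- Segments between rational points.

module Segments where

  open import Defs
  open Reals
  open AffineDependence using (Meet)
  open Collinearity using (0ℝ-zero)
  open Hull using (≃-cong)

  ℚ² : Set
  ℚ² = ℚ × ℚ

  point : ℚ² → ℝ²
  point (x , y) = fromℚ x , fromℚ y

  detℚ : ℚ² → ℚ² → ℚ² → ℚ
  detℚ (a₁ , a₂) (b₁ , b₂) (c₁ , c₂) = (b₁ ℚ.- a₁) ℚ.* (c₂ ℚ.- a₂) ℚ.- (c₁ ℚ.- a₁) ℚ.* (b₂ ℚ.- a₂)

  constant : ∀ {q} → 0ℚ ℚ.≤ q → BoundedNonNeg (fromℚ q)
  constant {q} 0≤q = 1ℚ ℚ.+ q , ℚₚ.+-mono-<-≤ (ℚₚ.positive⁻¹ 1ℚ) 0≤q , λ n →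
    0≤q , subst (ℚ._≤ 1ℚ ℚ.+ q) (ℚₚ.+-identityˡ q) (ℚₚ.+-monoˡ-≤ q (ℚₚ.<⇒≤ (ℚₚ.positive⁻¹ 1ℚ)))

  -- The common point satisfies p - a = t (b - a) = t′ (c - a). Taking the determinant with b - a
  -- gives D t′ = 0, and multiplication by `r` gives t′ = 0, so p = a.
  meet-at-common-endpoint : ∀ a b c r → r ℚ.* detℚ a b c ≡ 1ℚ → ∀ p →
    p ∈[ point a , point b ] → p ∈[ point a , point c ] → p ≈ point a
  meet-at-common-endpoint (a₁ , a₂) (b₁ , b₂) (c₁ , c₂) r rD≡1 (p₁ , p₂)
    (s , t , _ , _ , sum , eq₁ , eq₂) (s′ , t′ , _ , _ , sum′ , eq₁′ , eq₂′) =
      coordinate a₁ c₁ p₁ eq₁′ , coordinate a₂ c₂ p₂ eq₂′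
    where
    D : ℚ
    D = detℚ (a₁ , a₂) (b₁ , b₂) (c₁ , c₂)
    S S′ : ℝ
    S = s + t - 1ℝ
    S′ = s′ + t′ - 1ℝ
    S-zero : Zero S
    S-zero = ≃⇒zero {s + t} {1ℝ} sum
    S′-zero : Zero S′
    S′-zero = ≃⇒zero {s′ + t′} {1ℝ} sum′
    -- `E` equals (p - a) - t (b - a): the multiple of `S` eliminates the weight `s`. Likewise `E′`
    -- for the other segment, so the difference of the two no longer involves `p`.
    E : ℚ → ℚ → ℝ → ℝ
    E a b p = (p - (s * fromℚ a + t * fromℚ b)) + fromℚ a * S
    E′ : ℚ → ℚ → ℝ → ℝ
    E′ a c p = (p - (s′ * fromℚ a + t′ * fromℚ c)) + fromℚ a * S′
    E-zero : ∀ a b p → p ≃ s * fromℚ a + t * fromℚ b → Zero (E a b p)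
    E-zero a b p eq = zero-+ {p - (s * fromℚ a + t * fromℚ b)} {fromℚ a * S}
      (≃⇒zero {p} {s * fromℚ a + t * fromℚ b} eq) (zero-scale (fromℚ a) {S} S-zero)
    E′-zero : ∀ a c p → p ≃ s′ * fromℚ a + t′ * fromℚ c → Zero (E′ a c p)
    E′-zero a c p eq = zero-+ {p - (s′ * fromℚ a + t′ * fromℚ c)} {fromℚ a * S′}
      (≃⇒zero {p} {s′ * fromℚ a + t′ * fromℚ c} eq) (zero-scale (fromℚ a) {S′} S′-zero)
    Δ₁ Δ₂ : ℝ
    Δ₁ = E a₁ b₁ p₁ - E′ a₁ c₁ p₁
    Δ₂ = E a₂ b₂ p₂ - E′ a₂ c₂ p₂
    Δ₁-zero : Zero Δ₁
    Δ₁-zero = zero-minus {E a₁ b₁ p₁} {E′ a₁ c₁ p₁} (E-zero a₁ b₁ p₁ eq₁) (E′-zero a₁ c₁ p₁ eq₁′)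
    Δ₂-zero : Zero Δ₂
    Δ₂-zero = zero-minus {E a₂ b₂ p₂} {E′ a₂ c₂ p₂} (E-zero a₂ b₂ p₂ eq₂) (E′-zero a₂ c₂ p₂ eq₂′)
    Dt-zero : Zero (fromℚ D * t′)
    Dt-zero = zero-cong {fromℚ (b₁ ℚ.- a₁) * Δ₂ - fromℚ (b₂ ℚ.- a₂) * Δ₁} {fromℚ D * t′}
      (λ n → I.common-endpoint a₁ a₂ b₁ b₂ c₁ c₂ (seq p₁ n) (seq p₂ n) (seq s n) (seq t n) (seq s′ n) (seq t′ n))
      (zero-minus {fromℚ (b₁ ℚ.- a₁) * Δ₂} {fromℚ (b₂ ℚ.- a₂) * Δ₁}
        (zero-scale (fromℚ (b₁ ℚ.- a₁)) {Δ₂} Δ₂-zero) (zero-scale (fromℚ (b₂ ℚ.- a₂)) {Δ₁} Δ₁-zero))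
    t′-zero : Zero t′
    t′-zero = zero-cong {fromℚ r * (fromℚ D * t′)} {t′}
      (λ n → trans (sym (ℚₚ.*-assoc r D (seq t′ n))) (trans (cong (ℚ._* seq t′ n) rD≡1) (ℚₚ.*-identityˡ (seq t′ n))))
      (zero-scale (fromℚ r) {fromℚ D * t′} Dt-zero)
    coordinate : ∀ a c p → p ≃ s′ * fromℚ a + t′ * fromℚ c → p ≃ fromℚ a
    coordinate a c p eq = zero⇒≃ {p} {fromℚ a}
      (zero-cong {E′ a c p + fromℚ (c ℚ.- a) * t′} {p - fromℚ a}
        (λ n → I.at-endpoint a c (seq p n) (seq s′ n) (seq t′ n))
        (zero-+ {E′ a c p} {fromℚ (c ℚ.- a) * t′} (E′-zero a c p eq) (zero-scale (fromℚ (c ℚ.- a)) {t′} t′-zero)))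

  infix 8 _∙_

  _∙_ : ℚ² → ℚ² → ℚ
  (α , β) ∙ (x , y) = α ℚ.* x ℚ.+ β ℚ.* y

  -- Up to the null term `Z`, the slack at `p` is the combination, with the weights `s` and `t`, of
  -- the nonnegative slacks at the endpoints.
  segment-bound : ∀ α β a b M → (α , β) ∙ a ℚ.≤ M → (α , β) ∙ b ℚ.≤ M → ∀ p → p ∈[ point a , point b ] →
    NonNegative (fromℚ M - (fromℚ α * proj₁ p + fromℚ β * proj₂ p))
  segment-bound α β (a₁ , a₂) (b₁ , b₂) M a≤M b≤M (p₁ , p₂) (s , t , 0≤s , 0≤t , sum , eq₁ , eq₂) =
    nonnegative-cong {X + neg Z} {fromℚ M - (fromℚ α * p₁ + fromℚ β * p₂)}
      (λ n → I.segment-bound a₁ a₂ b₁ b₂ (seq p₁ n) (seq p₂ n) (seq s n) (seq t n) α β M)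
      (nonnegative-+ {X} {neg Z}
        (nonnegative-+ {fromℚ A * s} {fromℚ B * t}
          (nonnegative-* {fromℚ A} {s} (constant (≤⇒0≤ a≤M)) (0≤⇒nonnegative {s} 0≤s))
          (nonnegative-* {fromℚ B} {t} (constant (≤⇒0≤ b≤M)) (0≤⇒nonnegative {t} 0≤t)))
        (zero⇒nonnegative {neg Z} (zero-neg {Z} Z-zero)))
    where
    A B : ℚ
    A = M ℚ.- (α , β) ∙ (a₁ , a₂)
    B = M ℚ.- (α , β) ∙ (b₁ , b₂)
    S E₁ E₂ X Z : ℝ
    S = s + t - 1ℝ
    E₁ = p₁ - (s * fromℚ a₁ + t * fromℚ b₁)
    E₂ = p₂ - (s * fromℚ a₂ + t * fromℚ b₂)
    X = fromℚ A * s + fromℚ B * t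
    Z = (fromℚ M * S + fromℚ α * E₁) + fromℚ β * E₂
    Z-zero : Zero Z
    Z-zero = zero-+ {fromℚ M * S + fromℚ α * E₁} {fromℚ β * E₂}
      (zero-+ {fromℚ M * S} {fromℚ α * E₁}
        (zero-scale (fromℚ M) {S} (≃⇒zero {s + t} {1ℝ} sum))
        (zero-scale (fromℚ α) {E₁} (≃⇒zero {p₁} {s * fromℚ a₁ + t * fromℚ b₁} eq₁)))
      (zero-scale (fromℚ β) {E₂} (≃⇒zero {p₂} {s * fromℚ a₂ + t * fromℚ b₂} eq₂))

  -- At a common point `f` would be at most `M` and, by the bound for the negated functional, at
  -- least `M′`; the two slacks add up to the negative number `M - M′`.
  separated⇒¬meet : ∀ f a b c d M M′ → f ∙ a ℚ.≤ M → f ∙ b ℚ.≤ M → M ℚ.< M′ → M′ ℚ.≤ f ∙ c → M′ ℚ.≤ f ∙ d →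
    ¬ Meet (point a) (point b) (point c) (point d)
  separated⇒¬meet (α , β) a b c d M M′ a≤ b≤ M<M′ ≤c ≤d ((p₁ , p₂) , p∈ab , p∈cd) =
    positive⇒¬nonpositive {fromℚ (M′ ℚ.- M)} (mkPositive (M′ ℚ.- M , <⇒0< M<M′ , always (λ _ → ℚₚ.≤-refl)))
      (nonnegative-cong {X + Y} {neg (fromℚ (M′ ℚ.- M))}
        (λ n → I.opposite-bounds M M′ α β (seq p₁ n) (seq p₂ n))
        (nonnegative-+ {X} {Y} (segment-bound α β a b M a≤ b≤ (p₁ , p₂) p∈ab)
          (segment-bound (ℚ.- α) (ℚ.- β) c d (ℚ.- M′) (flip c ≤c) (flip d ≤d) (p₁ , p₂) p∈cd)))
    where
    X Y : ℝ
    X = fromℚ M - (fromℚ α * p₁ + fromℚ β * p₂)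
    Y = fromℚ (ℚ.- M′) - (fromℚ (ℚ.- α) * p₁ + fromℚ (ℚ.- β) * p₂)
    flip : ∀ c → M′ ℚ.≤ (α , β) ∙ c → (ℚ.- α , ℚ.- β) ∙ c ℚ.≤ ℚ.- M′
    flip (x , y) ≤c = subst (ℚ._≤ ℚ.- M′) (I.neg-functional α β x y) (ℚₚ.neg-antimono-≤ ≤c)

  -- Defined by recursion so that `ι (suc n)` unfolds to `1ℚ + ι n`, the form in which the
  -- determinants of the stars are computed.
  ι : ℕ → ℚ
  ι ℕ.zero    = 0ℚ
  ι (ℕ.suc n) = 1ℚ ℚ.+ ι n

  ι-<-suc : ∀ n → ι n ℚ.< ι (ℕ.suc n)
  ι-<-suc n = subst (ℚ._< 1ℚ ℚ.+ ι n) (ℚₚ.+-identityˡ (ι n)) (ℚₚ.+-monoˡ-< (ι n) (ℚₚ.positive⁻¹ 1ℚ))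

  ι-≥0 : ∀ n → 0ℚ ℚ.≤ ι n
  ι-≥0 ℕ.zero    = ℚₚ.≤-refl
  ι-≥0 (ℕ.suc n) = ℚₚ.≤-trans (ι-≥0 n) (ℚₚ.<⇒≤ (ι-<-suc n))

  ι-mono-≤ : ∀ {m n} → m ℕ.≤ n → ι m ℚ.≤ ι n
  ι-mono-≤ {n = n} ℕ.z≤n = ι-≥0 n
  ι-mono-≤ (ℕ.s≤s m≤n)   = ℚₚ.+-monoʳ-≤ 1ℚ (ι-mono-≤ m≤n)

  ι-mono-< : ∀ {m n} → m ℕ.< n → ι m ℚ.< ι n
  ι-mono-< {m} m<n = ℚₚ.<-≤-trans (ι-<-suc m) (ι-mono-≤ m<n)

  ι-injective : ∀ {m n} → ι m ≡ ι n → m ≡ n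
  ι-injective {m} {n} eq with ℕₚ.<-cmp m n
  ... | tri< m<n _ _ = ⊥-elim (ℚₚ.<-irrefl eq (ι-mono-< m<n))
  ... | tri≈ _ m≡n _ = m≡n
  ... | tri> _ _ n<m = ⊥-elim (ℚₚ.<-irrefl (sym eq) (ι-mono-< n<m))

  ∈[]-sym : ∀ p a b → p ∈[ a , b ] → p ∈[ b , a ]
  ∈[]-sym (p₁ , p₂) (a₁ , a₂) (b₁ , b₂) (s , t , 0≤s , 0≤t , sum , eq₁ , eq₂) =
      t , s , 0≤t , 0≤s
    , ≃-cong (s + t) (t + s) 1ℝ 1ℝ (λ n → ℚₚ.+-comm (seq s n) (seq t n)) (λ _ → refl) sum
    , coordinate p₁ a₁ b₁ eq₁
    , coordinate p₂ a₂ b₂ eq₂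
    where
    coordinate : ∀ p a b → p ≃ s * a + t * b → p ≃ t * b + s * a
    coordinate p a b = ≃-cong p p (s * a + t * b) (t * b + s * a) (λ _ → refl)
      (λ n → ℚₚ.+-comm (seq s n ℚ.* seq a n) (seq t n ℚ.* seq b n))

  ∈[]-right : ∀ a b → b ∈[ a , b ]
  ∈[]-right (a₁ , a₂) (b₁ , b₂) = 0ℝ , 1ℝ
    , nonnegative⇒0≤ {0ℝ} (zero⇒nonnegative {0ℝ} 0ℝ-zero)
    , nonnegative⇒0≤ {1ℝ} (mkNonNegative (pos⇒nonneg
        (1ℚ , ℚₚ.positive⁻¹ 1ℚ , always λ _ → ℚₚ.≤-refl)))
    , ≐⇒≃ {0ℝ + 1ℝ} {1ℝ} (λ _ → ℚₚ.+-identityˡ 1ℚ)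
    , coordinate a₁ b₁
    , coordinate a₂ b₂
    where
    coordinate : ∀ a b → b ≃ 0ℝ * a + 1ℝ * b
    coordinate a b = ≐⇒≃ {b} {0ℝ * a + 1ℝ * b} λ n → sym (trans
      (cong₂ ℚ._+_ (ℚₚ.*-zeroˡ (seq a n)) (ℚₚ.*-identityˡ (seq b n))) (ℚₚ.+-identityˡ (seq b n)))

  fromℚ-injective : ∀ {x y} → fromℚ x ≃ fromℚ y → x ≡ y
  fromℚ-injective {x} {y} eq with ℚₚ.<-cmp x y
  ... | tri≈ _ x≡y _ = x≡y
  ... | tri< x<y _ _ = ⊥-elim (zero⇒¬positive {neg (fromℚ x - fromℚ y)}
        (zero-neg {fromℚ x - fromℚ y} (≃⇒zero {fromℚ x} {fromℚ y} eq))
        (mkPositive (y ℚ.- x , <⇒0< x<y , always λ _ → ℚₚ.≤-reflexive (sym (I.neg-difference x y)))))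
  ... | tri> _ _ y<x = ⊥-elim (zero⇒¬positive {fromℚ x - fromℚ y} (≃⇒zero {fromℚ x} {fromℚ y} eq)
        (mkPositive (x ℚ.- y , <⇒0< y<x , always λ _ → ℚₚ.≤-refl)))

-- A two-layer drawing of the complete graph on five vertices.

module K₅Drawing where

  open import Defs
  open AffineDependence using (Meet)
  open Segments

  -- A triangle with two interior points, in general position and with one crossing. Small natural
  -- coordinates let the remaining conditions be checked by evaluation.
  K₅ : Fin 5 → ℕ × ℕ
  K₅ 0F = 0 , 0
  K₅ 1F = 9 , 0
  K₅ 2F = 0 , 9
  K₅ 3F = 2 , 3
  K₅ 4F = 4 , 1

  K₅-point : Fin 5 → ℚ²
  K₅-point c = ι (proj₁ (K₅ c)) , ι (proj₂ (K₅ c))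

  -- The only crossing is that of the edges 13 and 24.
  K₅-layer : Fin 5 → Fin 5 → Fin 2
  K₅-layer 2F 4F = 1F
  K₅-layer _  _  = 0F

  K₅-bounded : ∀ c → proj₁ (K₅ c) ℕ.≤ 9 × proj₂ (K₅ c) ℕ.≤ 9
  K₅-bounded = from-yes (Finₚ.all? λ c → (proj₁ (K₅ c) ℕₚ.≤? 9) ×-dec (proj₂ (K₅ c) ℕₚ.≤? 9))

  K₅-injective : ∀ c d → proj₁ (K₅ c) ≡ proj₁ (K₅ d) → proj₂ (K₅ c) ≡ proj₂ (K₅ d) → c ≡ d
  K₅-injective = from-yes (Finₚ.all? λ c → Finₚ.all? λ d →
    (proj₁ (K₅ c) ℕₚ.≟ proj₁ (K₅ d)) →-dec ((proj₂ (K₅ c) ℕₚ.≟ proj₂ (K₅ d)) →-dec (c Fin.≟ d)))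

  K₅-general : ∀ c d e → c ≢ d → c ≢ e → d ≢ e → detℚ (K₅-point c) (K₅-point d) (K₅-point e) ≢ 0ℚ
  K₅-general = from-yes (Finₚ.all? λ c → Finₚ.all? λ d → Finₚ.all? λ e →
    ¬? (c Fin.≟ d) →-dec (¬? (c Fin.≟ e) →-dec (¬? (d Fin.≟ e) →-dec
      ¬? (detℚ (K₅-point c) (K₅-point d) (K₅-point e) ℚₚ.≟ 0ℚ))))

  Separates : ℚ² → ℚ² → ℚ² → ℚ² → ℚ² → Set
  Separates f a b c d = f ∙ a ℚ.⊔ f ∙ b ℚ.< f ∙ c ℚ.⊓ f ∙ d

  separates⇒¬meet : ∀ f a b c d → Separates f a b c d → ¬ Meet (point a) (point b) (point c) (point d)
  separates⇒¬meet f a b c d sep = separated⇒¬meet f a b c d (f ∙ a ℚ.⊔ f ∙ b) (f ∙ c ℚ.⊓ f ∙ d)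
    (ℚₚ.p≤p⊔q (f ∙ a) (f ∙ b)) (ℚₚ.p≤q⊔p (f ∙ a) (f ∙ b)) sep
    (ℚₚ.p⊓q≤p (f ∙ c) (f ∙ d)) (ℚₚ.p⊓q≤q (f ∙ c) (f ∙ d))

  normal : ℚ² → ℚ² → ℚ²
  normal (a₁ , a₂) (b₁ , b₂) = a₂ ℚ.- b₂ , b₁ ℚ.- a₁

  -- Of two disjoint segments, the line through one has the other on one side.
  LineSeparates : ℚ² → ℚ² → ℚ² → ℚ² → Set
  LineSeparates a b c d = Separates (normal a b) a b c d ⊎ Separates (normal b a) a b c d ⊎
    Separates (normal c d) a b c d ⊎ Separates (normal d c) a b c d

  lineSeparates⇒¬meet : ∀ a b c d → LineSeparates a b c d → ¬ Meet (point a) (point b) (point c) (point d)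
  lineSeparates⇒¬meet a b c d (inj₁ s)               = separates⇒¬meet (normal a b) a b c d s
  lineSeparates⇒¬meet a b c d (inj₂ (inj₁ s))        = separates⇒¬meet (normal b a) a b c d s
  lineSeparates⇒¬meet a b c d (inj₂ (inj₂ (inj₁ s))) = separates⇒¬meet (normal c d) a b c d s
  lineSeparates⇒¬meet a b c d (inj₂ (inj₂ (inj₂ s))) = separates⇒¬meet (normal d c) a b c d s

  separates? : ∀ f a b c d → Dec (Separates f a b c d)
  separates? f a b c d = (f ∙ a ℚ.⊔ f ∙ b) ℚₚ.<? (f ∙ c ℚ.⊓ f ∙ d)

  lineSeparates? : ∀ a b c d → Dec (LineSeparates a b c d)
  lineSeparates? a b c d = separates? (normal a b) a b c d ⊎-dec separates? (normal b a) a b c d ⊎-dec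
    separates? (normal c d) a b c d ⊎-dec separates? (normal d c) a b c d

  K₅-separated : ∀ c d c′ d′ → c Fin.< d → c′ Fin.< d′ → c ≢ c′ → c ≢ d′ → d ≢ c′ → d ≢ d′ →
    K₅-layer c d ≡ K₅-layer c′ d′ → LineSeparates (K₅-point c) (K₅-point d) (K₅-point c′) (K₅-point d′)
  K₅-separated = from-yes (Finₚ.all? λ c → Finₚ.all? λ d → Finₚ.all? λ c′ → Finₚ.all? λ d′ →
    (c Finₚ.<? d) →-dec ((c′ Finₚ.<? d′) →-dec (¬? (c Fin.≟ c′) →-dec (¬? (c Fin.≟ d′) →-dec
    (¬? (d Fin.≟ c′) →-dec (¬? (d Fin.≟ d′) →-dec ((K₅-layer c d Fin.≟ K₅-layer c′ d′) →-dec
    lineSeparates? (K₅-point c) (K₅-point d) (K₅-point c′) (K₅-point d′))))))))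

-- Positions of all vertices, and the two layers.

module Layout where

  open import Defs
  open AffineDependence using (Meet)
  open Segments
  open K₅Drawing
  open Reals using (p-q≡0⇒p≡q)

  module _ (p q : ℕ) where

    -- The subdivision of K_{p,q}, with m i j on the edge from a i to b j, and K₅.
    data Vertexᵛ : Set where
      k : Fin 5 → Vertexᵛ
      a : Fin p → Vertexᵛ
      b : Fin q → Vertexᵛ
      m : Fin p → Fin q → Vertexᵛ

  -- K₅ lies in the square [0, 9]², the star of a i in a vertical and the star of b j
  -- in a horizontal strip of width one; offset gives the positions of the strips.

  offset : ∀ {n} → Fin n → ℕ
  -- Ten clears the square of `K₅`; steps of two leave a gap between consecutive strips of width
  -- one.
  offset i = 10 ℕ.+ (toℕ i ℕ.+ toℕ i)

  offset-injective : ∀ {n} {i j : Fin n} → offset i ≡ offset j → i ≡ j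
  offset-injective {i = i} {j} eq with ℕₚ.<-cmp (toℕ i) (toℕ j)
  ... | tri< i<j _ _ = ⊥-elim (ℕₚ.<-irrefl eq (ℕₚ.+-monoʳ-< 10 (ℕₚ.+-mono-< i<j i<j)))
  ... | tri≈ _ i≡j _ = Finₚ.toℕ-injective i≡j
  ... | tri> _ _ j<i = ⊥-elim (ℕₚ.<-irrefl (sym eq) (ℕₚ.+-monoʳ-< 10 (ℕₚ.+-mono-< j<i j<i)))

  offset-gap : ∀ {n} {i j : Fin n} → i Fin.< j → ℕ.suc (offset i) ℕ.< offset j
  offset-gap {i = i} {j} i<j = ℕₚ.+-monoʳ-< 10 (ℕₚ.≤-trans (ℕ.s≤s (ℕₚ.≤-reflexive (sym (ℕₚ.+-suc (toℕ i) (toℕ i)))))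
    (ℕₚ.+-mono-≤ i<j i<j))

  module _ {p q : ℕ} where

    V : Set
    V = Vertexᵛ p q

    -- The shift by one in both coordinates of `m i j` gives the edges of a star different
    -- directions; without it they would overlap on one vertical or horizontal line.
    X Y : V → ℕ
    X (k c)   = proj₁ (K₅ c)
    X (a i)   = offset i
    X (b j)   = 0
    X (m i j) = ℕ.suc (offset i)
    Y (k c)   = proj₂ (K₅ c)
    Y (a i)   = 0
    Y (b j)   = offset j
    Y (m i j) = ℕ.suc (offset j)

    place : V → ℚ²
    place v = ι (X v) , ι (Y v)

    P : V → ℝ²
    P v = point (place v)

    9<offset : ∀ {n} (i : Fin n) → 9 ℕ.< offset i
    9<offset i = ℕₚ.m≤m+n 10 (toℕ i ℕ.+ toℕ i)

    XY-injective : ∀ u v → X u ≡ X v → Y u ≡ Y v → u ≡ v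
    XY-injective (k c)   (k d)     x y = cong k (K₅-injective c d x y)
    XY-injective (k c)   (a i)     x y = ⊥-elim (ℕₚ.<-irrefl x (ℕₚ.≤-<-trans (proj₁ (K₅-bounded c)) (9<offset i)))
    XY-injective (k c)   (b j)     x y = ⊥-elim (ℕₚ.<-irrefl y (ℕₚ.≤-<-trans (proj₂ (K₅-bounded c)) (9<offset j)))
    XY-injective (k c)   (m i j)   x y =
      ⊥-elim (ℕₚ.<-irrefl x (ℕₚ.≤-<-trans (proj₁ (K₅-bounded c)) (ℕₚ.m<n⇒m<1+n (9<offset i))))
    XY-injective (a i)   (a i′)    x y = cong a (offset-injective x)
    XY-injective (a i)   (b j)     () y
    XY-injective (a i)   (m i′ j)  x ()
    XY-injective (b j)   (b j′)    x y = cong b (offset-injective y)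
    XY-injective (b j)   (m i j′)  () y
    XY-injective (m i j) (m i′ j′) x y =
      cong₂ m (offset-injective (ℕₚ.suc-injective x)) (offset-injective (ℕₚ.suc-injective y))
    XY-injective (a i)   (k c)     x y = sym (XY-injective (k c) (a i) (sym x) (sym y))
    XY-injective (b j)   (k c)     x y = sym (XY-injective (k c) (b j) (sym x) (sym y))
    XY-injective (m i j) (k c)     x y = sym (XY-injective (k c) (m i j) (sym x) (sym y))
    XY-injective (b j)   (a i)     () y
    XY-injective (m i′ j) (a i)    x ()
    XY-injective (m i j′) (b j)    () y

    P-injective : ∀ u v → P u ≈ P v → u ≡ v
    P-injective u v (x , y) = XY-injective u v
      (ι-injective (fromℚ-injective {ι (X u)} {ι (X v)} x)) (ι-injective (fromℚ-injective {ι (Y u)} {ι (Y v)} y))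

    below-x : ∀ u v u′ v′ n → X u ℕ.≤ n → X v ℕ.≤ n → n ℕ.< X u′ → n ℕ.< X v′ →
      ¬ Meet (P u) (P v) (P u′) (P v′)
    below-x u v u′ v′ n u≤n v≤n n<u′ n<v′ = separated⇒¬meet (1ℚ , 0ℚ)
      (place u) (place v) (place u′) (place v′) (ι n) (ι (ℕ.suc n))
      (subst (ℚ._≤ ι n) (first u) (ι-mono-≤ u≤n)) (subst (ℚ._≤ ι n) (first v) (ι-mono-≤ v≤n)) (ι-<-suc n)
      (subst (ι (ℕ.suc n) ℚ.≤_) (first u′) (ι-mono-≤ n<u′)) (subst (ι (ℕ.suc n) ℚ.≤_) (first v′) (ι-mono-≤ n<v′))
      where
      first : ∀ w → ι (X w) ≡ (1ℚ , 0ℚ) ∙ place w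
      first w = sym (trans (cong₂ ℚ._+_ (ℚₚ.*-identityˡ (ι (X w))) (ℚₚ.*-zeroˡ (ι (Y w)))) (ℚₚ.+-identityʳ (ι (X w))))

    below-y : ∀ u v u′ v′ n → Y u ℕ.≤ n → Y v ℕ.≤ n → n ℕ.< Y u′ → n ℕ.< Y v′ →
      ¬ Meet (P u) (P v) (P u′) (P v′)
    below-y u v u′ v′ n u≤n v≤n n<u′ n<v′ = separated⇒¬meet (0ℚ , 1ℚ)
      (place u) (place v) (place u′) (place v′) (ι n) (ι (ℕ.suc n))
      (subst (ℚ._≤ ι n) (second u) (ι-mono-≤ u≤n)) (subst (ℚ._≤ ι n) (second v) (ι-mono-≤ v≤n)) (ι-<-suc n)
      (subst (ι (ℕ.suc n) ℚ.≤_) (second u′) (ι-mono-≤ n<u′)) (subst (ι (ℕ.suc n) ℚ.≤_) (second v′) (ι-mono-≤ n<v′))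
      where
      second : ∀ w → ι (Y w) ≡ (0ℚ , 1ℚ) ∙ place w
      second w = sym (trans (cong₂ ℚ._+_ (ℚₚ.*-zeroˡ (ι (X w))) (ℚₚ.*-identityˡ (ι (Y w)))) (ℚₚ.+-identityˡ (ι (Y w))))

    meet-sym : ∀ x y z w → Meet x y z w → Meet z w x y
    meet-sym _ _ _ _ (p , h , h′) = p , h′ , h

    left-of-a : ∀ i j u v → X u ℕ.< offset i → X v ℕ.< offset i → ¬ Meet (P (a i)) (P (m i j)) (P u) (P v)
    left-of-a i j u v (ℕ.s≤s u<) (ℕ.s≤s v<) h = below-x u v (a i) (m i j) _ u< v< ℕₚ.≤-refl (ℕₚ.n≤1+n _)
        (meet-sym (P (a i)) (P (m i j)) (P u) (P v) h)

    right-of-a : ∀ i j u v → ℕ.suc (offset i) ℕ.< X u → ℕ.suc (offset i) ℕ.< X v →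
      ¬ Meet (P (a i)) (P (m i j)) (P u) (P v)
    right-of-a i j u v = below-x (a i) (m i j) u v (ℕ.suc (offset i)) (ℕₚ.n≤1+n _) ℕₚ.≤-refl

    below-b : ∀ i j u v → Y u ℕ.< offset j → Y v ℕ.< offset j → ¬ Meet (P (b j)) (P (m i j)) (P u) (P v)
    below-b i j u v (ℕ.s≤s u<) (ℕ.s≤s v<) h = below-y u v (b j) (m i j) _ u< v< ℕₚ.≤-refl (ℕₚ.n≤1+n _)
        (meet-sym (P (b j)) (P (m i j)) (P u) (P v) h)

    above-b : ∀ i j u v → ℕ.suc (offset j) ℕ.< Y u → ℕ.suc (offset j) ℕ.< Y v →
      ¬ Meet (P (b j)) (P (m i j)) (P u) (P v)
    above-b i j u v = below-y (b j) (m i j) u v (ℕ.suc (offset j)) (ℕₚ.n≤1+n _) ℕₚ.≤-refl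

    star : ∀ u v w → detℚ (place u) (place v) (place w) ≢ 0ℚ → ∀ x →
      x ∈[ P u , P v ] → x ∈[ P u , P w ] → x ≈ P u
    star u v w D≢0 = meet-at-common-endpoint (place u) (place v) (place w) (proj₁ inverse) (proj₂ inverse)
      where
      inverse : ∃[ r ] r ℚ.* detℚ (place u) (place v) (place w) ≡ 1ℚ
      inverse = ℚ.1/_ D {{D-nonZero}} , ℚₚ.*-inverseˡ D {{D-nonZero}}
        where
        D = detℚ (place u) (place v) (place w)
        D-nonZero : ℚ.NonZero D
        D-nonZero = ℚ.≢-nonZero D≢0

    ι-offset-≢ : ∀ {n} {i j : Fin n} → i ≢ j → ι (ℕ.suc (offset i)) ℚ.- ι (ℕ.suc (offset j)) ≢ 0ℚ
    ι-offset-≢ {i = i} {j} i≢j eq = i≢j (offset-injective (ℕₚ.suc-injective (ι-injective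
      (p-q≡0⇒p≡q (ι (ℕ.suc (offset i))) (ι (ℕ.suc (offset j))) eq))))

    star-a : ∀ i j j′ → j ≢ j′ → ∀ x → x ∈[ P (a i) , P (m i j) ] → x ∈[ P (a i) , P (m i j′) ] → x ≈ P (a i)
    star-a i j j′ j≢j′ = star (a i) (m i j) (m i j′) λ eq → ι-offset-≢ (≢-sym j≢j′)
      (trans (sym (I.vertical-star (ι (offset i)) (ι (ℕ.suc (offset j))) (ι (ℕ.suc (offset j′))))) eq)

    star-b : ∀ i i′ j → i ≢ i′ → ∀ x → x ∈[ P (b j) , P (m i j) ] → x ∈[ P (b j) , P (m i′ j) ] → x ≈ P (b j)
    star-b i i′ j i≢i′ = star (b j) (m i j) (m i′ j) λ eq → ι-offset-≢ i≢i′
      (trans (sym (I.horizontal-star (ι (offset j)) (ι (ℕ.suc (offset i))) (ι (ℕ.suc (offset i′))))) eq)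

    star-k : ∀ c d e → c ≢ d → c ≢ e → d ≢ e → ∀ x →
      x ∈[ P (k c) , P (k d) ] → x ∈[ P (k c) , P (k e) ] → x ≈ P (k c)
    star-k c d e c≢d c≢e d≢e = star (k c) (k d) (k e) (K₅-general c d e c≢d c≢e d≢e)

    -- Each edge is listed in one direction only: the centre of the star first, or the smaller index
    -- in `K₅`.
    data Canonical : V → V → Set where
      am : ∀ i j → Canonical (a i) (m i j)
      bm : ∀ i j → Canonical (b j) (m i j)
      kk : ∀ {c d} → c Fin.< d → Canonical (k c) (k d)

    layer : ∀ {u v} → Canonical u v → Fin 2
    layer (am i j)       = 0F
    layer (bm i j)       = 1F
    layer (kk {c} {d} _) = K₅-layer c d

    -- A vertex is regarded as a degenerate segment, so that the separation lemmas for segments also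
    -- show that edges avoid vertices.
    touches⇒meet : ∀ u v w → P w ∈[ P u , P v ] → Meet (P u) (P v) (P w) (P w)
    touches⇒meet u v w h = P w , h , ∈[]-right (P w) (P w)

    collinear⇒≡ : ∀ u v w → (∀ x → x ∈[ P u , P v ] → x ∈[ P u , P w ] → x ≈ P u) → P w ∈[ P u , P v ] → w ≡ u
    collinear⇒≡ u v w at-u h = P-injective w u (at-u (P w) h (∈[]-right (P u) (P w)))

    canonical-avoids : ∀ {u v} → Canonical u v → ∀ w → w ≢ u → w ≢ v → ¬ P w ∈[ P u , P v ]
    canonical-avoids (am i j) (k c) _ _ h = left-of-a i j (k c) (k c) X< X< (touches⇒meet (a i) (m i j) (k c) h)
      where X< = ℕₚ.≤-<-trans (proj₁ (K₅-bounded c)) (9<offset i)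
    canonical-avoids (am i j) (b j′) _ _ h =
      left-of-a i j (b j′) (b j′) ℕ.z<s ℕ.z<s (touches⇒meet (a i) (m i j) (b j′) h)
    canonical-avoids (am i j) (a i′) w≢u _ h with Finₚ.<-cmp i i′
    ... | tri< i<i′ _ _ =
      right-of-a i j (a i′) (a i′) (offset-gap i<i′) (offset-gap i<i′) (touches⇒meet (a i) (m i j) (a i′) h)
    ... | tri≈ _ refl _ = w≢u refl
    ... | tri> _ _ i′<i = left-of-a i j (a i′) (a i′) X< X< (touches⇒meet (a i) (m i j) (a i′) h)
      where X< = ℕₚ.<-trans (ℕₚ.n<1+n _) (offset-gap i′<i)
    canonical-avoids (am i j) (m i′ j′) w≢u w≢v h with Finₚ.<-cmp i i′
    ... | tri< i<i′ _ _ = right-of-a i j (m i′ j′) (m i′ j′) X> X> (touches⇒meet (a i) (m i j) (m i′ j′) h)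
      where X> = ℕₚ.m<n⇒m<1+n (offset-gap i<i′)
    ... | tri≈ _ refl _ = w≢u (collinear⇒≡ (a i) (m i j) (m i j′) (star-a i j j′ λ { refl → w≢v refl }) h)
    ... | tri> _ _ i′<i =
      left-of-a i j (m i′ j′) (m i′ j′) (offset-gap i′<i) (offset-gap i′<i) (touches⇒meet (a i) (m i j) (m i′ j′) h)
    canonical-avoids (bm i j) (k c) _ _ h = below-b i j (k c) (k c) Y< Y< (touches⇒meet (b j) (m i j) (k c) h)
      where Y< = ℕₚ.≤-<-trans (proj₂ (K₅-bounded c)) (9<offset j)
    canonical-avoids (bm i j) (a i′) _ _ h =
      below-b i j (a i′) (a i′) ℕ.z<s ℕ.z<s (touches⇒meet (b j) (m i j) (a i′) h)
    canonical-avoids (bm i j) (b j′) w≢u _ h with Finₚ.<-cmp j j′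
    ... | tri< j<j′ _ _ =
      above-b i j (b j′) (b j′) (offset-gap j<j′) (offset-gap j<j′) (touches⇒meet (b j) (m i j) (b j′) h)
    ... | tri≈ _ refl _ = w≢u refl
    ... | tri> _ _ j′<j = below-b i j (b j′) (b j′) Y< Y< (touches⇒meet (b j) (m i j) (b j′) h)
      where Y< = ℕₚ.<-trans (ℕₚ.n<1+n _) (offset-gap j′<j)
    canonical-avoids (bm i j) (m i′ j′) w≢u w≢v h with Finₚ.<-cmp j j′
    ... | tri< j<j′ _ _ = above-b i j (m i′ j′) (m i′ j′) Y> Y> (touches⇒meet (b j) (m i j) (m i′ j′) h)
      where Y> = ℕₚ.m<n⇒m<1+n (offset-gap j<j′)
    ... | tri≈ _ refl _ = w≢u (collinear⇒≡ (b j) (m i j) (m i′ j) (star-b i i′ j λ { refl → w≢v refl }) h)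
    ... | tri> _ _ j′<j =
      below-b i j (m i′ j′) (m i′ j′) (offset-gap j′<j) (offset-gap j′<j) (touches⇒meet (b j) (m i j) (m i′ j′) h)
    canonical-avoids (kk {c} {d} c<d) (k e) w≢u w≢v h = w≢u (collinear⇒≡ (k c) (k d) (k e)
      (star-k c d e (Finₚ.<⇒≢ c<d) (λ { refl → w≢u refl }) (λ { refl → w≢v refl })) h)
    canonical-avoids (kk {c} {d} _) (a i) _ _ h = below-x (k c) (k d) (a i) (a i) 9
      (proj₁ (K₅-bounded c)) (proj₁ (K₅-bounded d)) (9<offset i) (9<offset i) (touches⇒meet (k c) (k d) (a i) h)
    canonical-avoids (kk {c} {d} _) (b j) _ _ h = below-y (k c) (k d) (b j) (b j) 9
      (proj₂ (K₅-bounded c)) (proj₂ (K₅-bounded d)) (9<offset j) (9<offset j) (touches⇒meet (k c) (k d) (b j) h)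
    canonical-avoids (kk {c} {d} _) (m i j) _ _ h = below-x (k c) (k d) (m i j) (m i j) 9
      (proj₁ (K₅-bounded c)) (proj₁ (K₅-bounded d)) X> X> (touches⇒meet (k c) (k d) (m i j) h)
      where X> = ℕₚ.m<n⇒m<1+n (9<offset i)

    CommonEnd : V → V → V → V → ℝ² → Set
    CommonEnd u v u′ v′ x = ∃[ w ] ((w ≡ u ⊎ w ≡ v) × (w ≡ u′ ⊎ w ≡ v′) × x ≈ P w)

    am-left-of-kk : ∀ i j c d → ¬ Meet (P (a i)) (P (m i j)) (P (k c)) (P (k d))
    am-left-of-kk i j c d = left-of-a i j (k c) (k d)
      (ℕₚ.≤-<-trans (proj₁ (K₅-bounded c)) (9<offset i)) (ℕₚ.≤-<-trans (proj₁ (K₅-bounded d)) (9<offset i))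

    bm-above-kk : ∀ i j c d → ¬ Meet (P (b j)) (P (m i j)) (P (k c)) (P (k d))
    bm-above-kk i j c d = below-b i j (k c) (k d)
      (ℕₚ.≤-<-trans (proj₂ (K₅-bounded c)) (9<offset j)) (ℕₚ.≤-<-trans (proj₂ (K₅-bounded d)) (9<offset j))

    -- An `am` edge and a `bm` edge have different layers, so no clause treats them. Strips separate
    -- stars with different centres, and stars from `K₅`; nonzero determinants settle edges with a
    -- common end; disjoint edges of `K₅` fall to the finite check.
    non-crossing : ∀ {u v u′ v′} (e : Canonical u v) (f : Canonical u′ v′) → layer e ≡ layer f →
      ¬ (u ≡ u′ × v ≡ v′) → ∀ x → x ∈[ P u , P v ] → x ∈[ P u′ , P v′ ] → CommonEnd u v u′ v′ x
    non-crossing (am i j) (am i′ j′) _ e≢f x h h′ with Finₚ.<-cmp i i′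
    ... | tri< i<i′ _ _ = ⊥-elim (right-of-a i j (a i′) (m i′ j′)
      (offset-gap i<i′) (ℕₚ.m<n⇒m<1+n (offset-gap i<i′)) (x , h , h′))
    ... | tri≈ _ refl _ = a i , inj₁ refl , inj₁ refl , star-a i j j′ (λ { refl → e≢f (refl , refl) }) x h h′
    ... | tri> _ _ i′<i = ⊥-elim (right-of-a i′ j′ (a i) (m i j)
      (offset-gap i′<i) (ℕₚ.m<n⇒m<1+n (offset-gap i′<i)) (x , h′ , h))
    non-crossing (bm i j) (bm i′ j′) _ e≢f x h h′ with Finₚ.<-cmp j j′
    ... | tri< j<j′ _ _ = ⊥-elim (above-b i j (b j′) (m i′ j′)
      (offset-gap j<j′) (ℕₚ.m<n⇒m<1+n (offset-gap j<j′)) (x , h , h′))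
    ... | tri≈ _ refl _ = b j , inj₁ refl , inj₁ refl , star-b i i′ j (λ { refl → e≢f (refl , refl) }) x h h′
    ... | tri> _ _ j′<j = ⊥-elim (above-b i′ j′ (b j) (m i j)
      (offset-gap j′<j) (ℕₚ.m<n⇒m<1+n (offset-gap j′<j)) (x , h′ , h))
    non-crossing (am i j) (kk {c} {d} _) _ _ x h h′ = ⊥-elim (am-left-of-kk i j c d (x , h , h′))
    non-crossing (kk {c} {d} _) (am i j) _ _ x h h′ = ⊥-elim (am-left-of-kk i j c d (x , h′ , h))
    non-crossing (bm i j) (kk {c} {d} _) _ _ x h h′ = ⊥-elim (bm-above-kk i j c d (x , h , h′))
    non-crossing (kk {c} {d} _) (bm i j) _ _ x h h′ = ⊥-elim (bm-above-kk i j c d (x , h′ , h))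
    non-crossing (kk {c} {d} c<d) (kk {c′} {d′} c′<d′) same-layer e≢f x h h′
      with c Fin.≟ c′ | c Fin.≟ d′ | d Fin.≟ c′ | d Fin.≟ d′
    ... | yes refl | _ | _ | yes refl = ⊥-elim (e≢f (refl , refl))
    ... | yes refl | _ | _ | no d≢d′ = k c , inj₁ refl , inj₁ refl ,
      star-k c d d′ (Finₚ.<⇒≢ c<d) (Finₚ.<⇒≢ c′<d′) d≢d′ x h h′
    ... | no c≢c′ | _ | _ | yes refl = k d , inj₂ refl , inj₂ refl ,
      star-k d c c′ (≢-sym (Finₚ.<⇒≢ c<d)) (≢-sym (Finₚ.<⇒≢ c′<d′)) c≢c′ x
        (∈[]-sym x (P (k c)) (P (k d)) h) (∈[]-sym x (P (k c′)) (P (k d)) h′)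
    ... | no c≢c′ | yes refl | _ | no d≢d′ = k c , inj₁ refl , inj₂ refl ,
      star-k c d c′ (Finₚ.<⇒≢ c<d) c≢c′ (λ { refl → Finₚ.<-asym c<d c′<d′ }) x
        h (∈[]-sym x (P (k c′)) (P (k c)) h′)
    ... | no c≢c′ | no c≢d′ | yes refl | no d≢d′ = k d , inj₂ refl , inj₁ refl ,
      star-k d c d′ (≢-sym (Finₚ.<⇒≢ c<d)) d≢d′ c≢d′ x (∈[]-sym x (P (k c)) (P (k d)) h) h′
    ... | no c≢c′ | no c≢d′ | no d≢c′ | no d≢d′ = ⊥-elim (lineSeparates⇒¬meet
      (place (k c)) (place (k d)) (place (k c′)) (place (k d′))
      (K₅-separated c d c′ d′ c<d c′<d′ c≢c′ c≢d′ d≢c′ d≢d′ same-layer) (x , h , h′))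

-- The graph on numbered vertices and its drawing.

module Subdivision where

  open import Defs hiding (_+_; _*_; _<_; _≤_)
  open Segments using (∈[]-sym)
  open Layout
  open import Function.Construct.Composition using (_↔-∘_)
  open import Function.Construct.Identity using (↔-id)
  open import Data.Sum.Function.Propositional using (_⊎-↔_)

  module _ (p q : ℕ) where

    private
      n : ℕ
      n = 5 ℕ.+ (p ℕ.+ (q ℕ.+ p ℕ.* q))

      W : Set
      W = Vertexᵛ p q

    vertices : Fin n ↔ W
    vertices = (tagged ↔-∘ (↔-id _ ⊎-↔ ((↔-id _ ⊎-↔ ((↔-id _ ⊎-↔ Finₚ.*↔×) ↔-∘ Finₚ.+↔⊎)) ↔-∘ Finₚ.+↔⊎))) ↔-∘ Finₚ.+↔⊎
      where
      tag : Fin 5 ⊎ (Fin p ⊎ (Fin q ⊎ (Fin p × Fin q))) → W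
      tag (inj₁ c)                      = k c
      tag (inj₂ (inj₁ i))               = a i
      tag (inj₂ (inj₂ (inj₁ j)))        = b j
      tag (inj₂ (inj₂ (inj₂ (i , j))))  = m i j
      untag : W → Fin 5 ⊎ (Fin p ⊎ (Fin q ⊎ (Fin p × Fin q)))
      untag (k c)   = inj₁ c
      untag (a i)   = inj₂ (inj₁ i)
      untag (b j)   = inj₂ (inj₂ (inj₁ j))
      untag (m i j) = inj₂ (inj₂ (inj₂ (i , j)))
      tag-untag : ∀ v → tag (untag v) ≡ v
      tag-untag (k _)   = refl
      tag-untag (a _)   = refl
      tag-untag (b _)   = refl
      tag-untag (m _ _) = refl
      untag-tag : ∀ x → untag (tag x) ≡ x
      untag-tag (inj₁ _)                = refl
      untag-tag (inj₂ (inj₁ _))         = refl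
      untag-tag (inj₂ (inj₂ (inj₁ _)))  = refl
      untag-tag (inj₂ (inj₂ (inj₂ _)))  = refl
      tagged : (Fin 5 ⊎ (Fin p ⊎ (Fin q ⊎ (Fin p × Fin q)))) ↔ W
      tagged = mk↔ₛ′ tag untag tag-untag untag-tag

    decode : Fin n → W
    decode = Inverse.to vertices

    encode : W → Fin n
    encode = Inverse.from vertices

    decode-encode : ∀ v → decode (encode v) ≡ v
    decode-encode = Inverse.strictlyInverseˡ vertices

    encode-decode : ∀ v → encode (decode v) ≡ v
    encode-decode = Inverse.strictlyInverseʳ vertices

    decode-injective : ∀ {u v} → decode u ≡ decode v → u ≡ v
    decode-injective {u} {v} eq = trans (sym (encode-decode u)) (trans (cong encode eq) (encode-decode v))

    encode-injective : ∀ {u v} → encode u ≡ encode v → u ≡ v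
    encode-injective {u} {v} eq = trans (sym (decode-encode u)) (trans (cong decode eq) (decode-encode v))

    adjacentᵛ : W → W → Bool
    adjacentᵛ (k c)   (k d)   = not ⌊ c Fin.≟ d ⌋
    adjacentᵛ (a i)   (m i′ _) = ⌊ i Fin.≟ i′ ⌋
    adjacentᵛ (m i′ _) (a i)   = ⌊ i Fin.≟ i′ ⌋
    adjacentᵛ (b j)   (m _ j′) = ⌊ j Fin.≟ j′ ⌋
    adjacentᵛ (m _ j′) (b j)   = ⌊ j Fin.≟ j′ ⌋
    adjacentᵛ _       _       = false

    ≟-sym : ∀ {n} (c d : Fin n) → ⌊ c Fin.≟ d ⌋ ≡ ⌊ d Fin.≟ c ⌋
    ≟-sym c d with c Fin.≟ d | d Fin.≟ c
    ... | yes _   | yes _   = refl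
    ... | no _    | no _    = refl
    ... | yes c≡d | no d≢c  = ⊥-elim (d≢c (sym c≡d))
    ... | no c≢d  | yes d≡c = ⊥-elim (c≢d (sym d≡c))

    adjacent-sym : ∀ u v → adjacentᵛ u v ≡ adjacentᵛ v u
    adjacent-sym (k c)   (k d)   = cong not (≟-sym c d)
    adjacent-sym (k _)   (a _)   = refl
    adjacent-sym (k _)   (b _)   = refl
    adjacent-sym (k _)   (m _ _) = refl
    adjacent-sym (a _)   (k _)   = refl
    adjacent-sym (a _)   (a _)   = refl
    adjacent-sym (a _)   (b _)   = refl
    adjacent-sym (a _)   (m _ _) = refl
    adjacent-sym (b _)   (k _)   = refl
    adjacent-sym (b _)   (a _)   = refl
    adjacent-sym (b _)   (b _)   = refl
    adjacent-sym (b _)   (m _ _) = refl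
    adjacent-sym (m _ _) (k _)   = refl
    adjacent-sym (m _ _) (a _)   = refl
    adjacent-sym (m _ _) (b _)   = refl
    adjacent-sym (m _ _) (m _ _) = refl

    adjacent-irrefl : ∀ v → adjacentᵛ v v ≡ false
    adjacent-irrefl (k c) with c Fin.≟ c
    ... | yes _  = refl
    ... | no c≢c = ⊥-elim (c≢c refl)
    adjacent-irrefl (a _)   = refl
    adjacent-irrefl (b _)   = refl
    adjacent-irrefl (m _ _) = refl

    adjacent⇒canonical : ∀ u v → T (adjacentᵛ u v) → Canonical u v ⊎ Canonical v u
    adjacent⇒canonical (k c) (k d) c≢d with Finₚ.<-cmp c d
    ... | tri< c<d _ _ = inj₁ (kk c<d)
    ... | tri≈ _ c≡d _ = ⊥-elim (toWitnessFalse c≢d c≡d)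
    ... | tri> _ _ d<c = inj₂ (kk d<c)
    adjacent⇒canonical (a i) (m i′ j) i≡i′ with refl ← toWitness i≡i′ = inj₁ (am i j)
    adjacent⇒canonical (m i′ j) (a i) i≡i′ with refl ← toWitness i≡i′ = inj₂ (am i j)
    adjacent⇒canonical (b j) (m i j′) j≡j′ with refl ← toWitness j≡j′ = inj₁ (bm i j)
    adjacent⇒canonical (m i j′) (b j) j≡j′ with refl ← toWitness j≡j′ = inj₂ (bm i j)

    G : Graph
    G = record
      { order  = n
      ; adj    = λ u v → adjacentᵛ (decode u) (decode v)
      ; symm   = λ u v → adjacent-sym (decode u) (decode v)
      ; irrefl = λ v → adjacent-irrefl (decode v)
      }

    open Graph G using (Vertex; Edge; edge; _isEndOf_; adj)

    private
      position : Vertex → ℝ²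
      position v = P (decode v)

    -- An edge stores its ends in the order of their numbers, whereas `Canonical` puts the centre
    -- first; this relation mediates between the two.
    Orientation : Edge → Vertex → Vertex → Set
    Orientation e u v = (u ≡ Edge.src e × v ≡ Edge.tgt e) ⊎ (u ≡ Edge.tgt e × v ≡ Edge.src e)

    canonical : ∀ e → ∃[ u ] ∃[ v ] (Orientation e u v × Canonical (decode u) (decode v))
    canonical (edge u v _ uv) with adjacent⇒canonical (decode u) (decode v) uv
    ... | inj₁ e = u , v , inj₁ (refl , refl) , e
    ... | inj₂ e = v , u , inj₂ (refl , refl) , e

    on-orientation : ∀ e u v → Orientation e u v → ∀ x →
      x ∈[ position (Edge.src e) , position (Edge.tgt e) ] → x ∈[ position u , position v ]
    on-orientation e u v (inj₁ (refl , refl)) x h = h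
    on-orientation e u v (inj₂ (refl , refl)) x h = ∈[]-sym x (position v) (position u) h

    end-of-orientation : ∀ e u v → Orientation e u v → ∀ w → w ≡ u ⊎ w ≡ v → w isEndOf e
    end-of-orientation e u v (inj₁ (refl , refl)) w h        = h
    end-of-orientation e u v (inj₂ (refl , refl)) w (inj₁ h) = inj₂ h
    end-of-orientation e u v (inj₂ (refl , refl)) w (inj₂ h) = inj₁ h

    orientation-injective : ∀ e f u v → Orientation e u v → Orientation f u v → e ≡ f
    orientation-injective (edge s t s<t st) (edge .s .t s<t′ st′) u v (inj₁ (refl , refl)) (inj₁ (refl , refl)) =
      cong₂ (edge s t) (ℕₚ.<-irrelevant s<t s<t′) (T-irrelevant st st′)
    orientation-injective (edge s t s<t st) (edge .s .t s<t′ st′) u v (inj₂ (refl , refl)) (inj₂ (refl , refl)) =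
      cong₂ (edge s t) (ℕₚ.<-irrelevant s<t s<t′) (T-irrelevant st st′)
    orientation-injective e f u v (inj₁ (refl , refl)) (inj₂ (refl , refl)) =
      ⊥-elim (Finₚ.<-asym (Edge.src<tgt e) (Edge.src<tgt f))
    orientation-injective e f u v (inj₂ (refl , refl)) (inj₁ (refl , refl)) =
      ⊥-elim (Finₚ.<-asym (Edge.src<tgt e) (Edge.src<tgt f))

    drawing : Drawing G
    drawing = record
      { pos      = position
      ; distinct = λ u v u≢v eq → u≢v (decode-injective (P-injective (decode u) (decode v) eq))
      ; avoids   = edge-avoids
      }
      where
      edge-avoids : ∀ e w → ¬ (w isEndOf e) →
        ¬ (position w ∈[ position (Edge.src e) , position (Edge.tgt e) ])
      edge-avoids e w ¬end h with canonical e
      ... | u , v , o , c = canonical-avoids c (decode w)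
        (λ eq → ¬end (end-of-orientation e u v o w (inj₁ (decode-injective eq))))
        (λ eq → ¬end (end-of-orientation e u v o w (inj₂ (decode-injective eq))))
        (on-orientation e u v o (position w) h)

    drawable : DrawableIn G 2
    drawable = drawing , edge-layer , λ e f e≢f same-layer (x , x∈e , x∈f , ¬common) →
      ¬common (common e f e≢f same-layer x x∈e x∈f)
      where
      edge-layer : Edge → Fin 2
      edge-layer e = layer (proj₂ (proj₂ (proj₂ (canonical e))))
      common : ∀ e f → e ≢ f → edge-layer e ≡ edge-layer f → ∀ x →
        x ∈[ position (Edge.src e) , position (Edge.tgt e) ] →
        x ∈[ position (Edge.src f) , position (Edge.tgt f) ] →
        ∃[ w ] (w isEndOf e × w isEndOf f × x ≈ position w)
      common e f e≢f same-layer x x∈e x∈f with canonical e | canonical f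
      ... | u , v , o , c | u′ , v′ , o′ , c′ = pull-back (non-crossing c c′ same-layer
          (λ (u≡u′ , v≡v′) → e≢f (orientation-injective e f u v o
            (subst₂ (Orientation f) (decode-injective (sym u≡u′)) (decode-injective (sym v≡v′)) o′)))
          x (on-orientation e u v o x x∈e) (on-orientation f u′ v′ o′ x x∈f))
        where
        end : ∀ {w u v} → w ≡ decode u ⊎ w ≡ decode v → encode w ≡ u ⊎ encode w ≡ v
        end {u = u} (inj₁ refl) = inj₁ (encode-decode u)
        end {v = v} (inj₂ refl) = inj₂ (encode-decode v)
        pull-back : CommonEnd (decode u) (decode v) (decode u′) (decode v′) x →
          ∃[ w ] (w isEndOf e × w isEndOf f × x ≈ position w)
        pull-back (w , h , h′ , eq) = encode w
          , end-of-orientation e u v o (encode w) (end h)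
          , end-of-orientation f u′ v′ o′ (encode w) (end h′)
          , subst (λ z → x ≈ P z) (sym (decode-encode w)) eq

-- Monochromatic 3×3 grids.

module Pigeonhole where

  Distinct : ∀ {A : Set} → (Fin 3 → A) → Set
  Distinct h = ∀ i j → i ≢ j → h i ≢ h j

  triple : ∀ {A : Set} → A → A → A → Fin 3 → A
  triple x y z 0F = x
  triple x y z 1F = y
  triple x y z 2F = z

  triple-distinct : ∀ {A : Set} {x y z : A} → x ≢ y → x ≢ z → y ≢ z → Distinct (triple x y z)
  triple-distinct xy xz yz 0F 0F i≢j = ⊥-elim (i≢j refl)
  triple-distinct xy xz yz 0F 1F _   = xy
  triple-distinct xy xz yz 0F 2F _   = xz
  triple-distinct xy xz yz 1F 0F _   = ≢-sym xy
  triple-distinct xy xz yz 1F 1F i≢j = ⊥-elim (i≢j refl)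
  triple-distinct xy xz yz 1F 2F _   = yz
  triple-distinct xy xz yz 2F 0F _   = ≢-sym xz
  triple-distinct xy xz yz 2F 1F _   = ≢-sym yz
  triple-distinct xy xz yz 2F 2F i≢j = ⊥-elim (i≢j refl)

  many : ℕ → ℕ
  many c = ℕ.suc c ℕ.* ℕ.suc c

  -- Two points of the same colour in every block, then two blocks with the same colour.
  monochromatic-triple : ∀ {c} (f : Fin (many c) → Fin c) →
    ∃[ h ] (Distinct h × ∀ i → f (h i) ≡ f (h 0F))
  monochromatic-triple {c} f = triple (at x (first x)) (at x (second x)) (at x′ (first x′))
    , triple-distinct
        (λ eq → Finₚ.<⇒≢ (first<second x) (proj₂ (Finₚ.combine-injective x (first x) x (second x) eq)))
        (λ eq → Finₚ.<⇒≢ x<x′ (proj₁ (Finₚ.combine-injective x (first x) x′ (first x′) eq)))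
        (λ eq → Finₚ.<⇒≢ x<x′ (proj₁ (Finₚ.combine-injective x (second x) x′ (first x′) eq)))
    , λ { 0F → refl ; 1F → sym (same-colour x) ; 2F → sym same-block-colour }
    where
    at : Fin (ℕ.suc c) → Fin (ℕ.suc c) → Fin (many c)
    at = Fin.combine
    in-block : ∀ x → ∃₂ λ y y′ → y Fin.< y′ × f (at x y) ≡ f (at x y′)
    in-block x = Finₚ.pigeonhole (ℕₚ.n<1+n c) (λ y → f (at x y))
    first second : Fin (ℕ.suc c) → Fin (ℕ.suc c)
    first x = proj₁ (in-block x)
    second x = proj₁ (proj₂ (in-block x))
    first<second : ∀ x → first x Fin.< second x
    first<second x = proj₁ (proj₂ (proj₂ (in-block x)))
    same-colour : ∀ x → f (at x (first x)) ≡ f (at x (second x))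
    same-colour x = proj₂ (proj₂ (proj₂ (in-block x)))
    blocks : ∃₂ λ x x′ → x Fin.< x′ × f (at x (first x)) ≡ f (at x′ (first x′))
    blocks = Finₚ.pigeonhole (ℕₚ.n<1+n c) (λ x → f (at x (first x)))
    x x′ : Fin (ℕ.suc c)
    x = proj₁ blocks
    x′ = proj₁ (proj₂ blocks)
    x<x′ : x Fin.< x′
    x<x′ = proj₁ (proj₂ (proj₂ blocks))
    same-block-colour : f (at x (first x)) ≡ f (at x′ (first x′))
    same-block-colour = proj₂ (proj₂ (proj₂ blocks))

  -- A whole column is coloured by the vector of its entries, for which there are `c ^ rows c`
  -- possibilities.
  rows columns : ℕ → ℕ
  rows c = many c
  columns c = many (c ℕ.^ rows c)

  -- Three columns with the same vector agree in every row, so three rows that agree within one of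
  -- these columns complete the grid. `funToFin` numbers the vectors.
  monochromatic-grid : ∀ {c} (f : Fin (rows c) → Fin (columns c) → Fin c) →
    ∃[ r ] ∃[ s ] (Distinct r × Distinct s × ∀ i j → f (r i) (s j) ≡ f (r 0F) (s 0F))
  monochromatic-grid {c} f = r , s , r-distinct , s-distinct , λ i j → trans (same-vector (r i) j) (same-row i)
    where
    columns-triple : ∃[ s ] (Distinct s × ∀ j → Fin.funToFin (λ i → f i (s j)) ≡ Fin.funToFin (λ i → f i (s 0F)))
    columns-triple = monochromatic-triple (λ j → Fin.funToFin (λ i → f i j))
    s : Fin 3 → Fin (columns c)
    s = proj₁ columns-triple
    s-distinct : Distinct s
    s-distinct = proj₁ (proj₂ columns-triple)
    same-vector : ∀ i j → f i (s j) ≡ f i (s 0F)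
    same-vector i j = trans (sym (Finₚ.finToFun-funToFin (λ i → f i (s j)) i))
      (trans (cong (λ v → Fin.finToFun v i) (proj₂ (proj₂ columns-triple) j))
        (Finₚ.finToFun-funToFin (λ i → f i (s 0F)) i))
    rows-triple : ∃[ r ] (Distinct r × ∀ i → f (r i) (s 0F) ≡ f (r 0F) (s 0F))
    rows-triple = monochromatic-triple (λ i → f i (s 0F))
    r : Fin 3 → Fin (rows c)
    r = proj₁ rows-triple
    r-distinct : Distinct r
    r-distinct = proj₁ (proj₂ rows-triple)
    same-row : ∀ i → f (r i) (s 0F) ≡ f (r 0F) (s 0F)
    same-row = proj₂ (proj₂ rows-triple)

-- Lower bounds for the geometric thickness and the book thickness.

module Thickness where

  open import Defs hiding (_+_; _*_; _<_; _≤_)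
  open AffineDependence using (Meet)
  open Chirotopes using (module ConvexFamily; K₅-crosses)
  open Segments using (∈[]-sym)
  open Layout
  open Subdivision
  open Pigeonhole

  module _ (p q : ℕ) where

    private
      Gᵖ : Graph
      Gᵖ = G p q

      ⟦_⟧ : Vertexᵛ p q → Fin (Graph.order Gᵖ)
      ⟦_⟧ = encode p q

      ⟦⟧-≢ : ∀ u v → u ≢ v → ⟦ u ⟧ ≢ ⟦ v ⟧
      ⟦⟧-≢ u v u≢v eq = u≢v (encode-injective p q {u} {v} eq)

    open Graph Gᵖ using (Edge; edge; _isEndOf_; adj; irrefl; symm)

    oriented-edge : ∀ u v → T (adj u v) → ∃[ e ] Orientation p q e u v
    oriented-edge u v uv with Finₚ.<-cmp u v
    ... | tri< u<v _ _  = edge u v u<v uv , inj₁ (refl , refl)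
    ... | tri≈ _ refl _ = ⊥-elim (subst T (irrefl u) uv)
    ... | tri> _ _ v<u  = edge v u v<u (subst T (symm u v) uv) , inj₂ (refl , refl)

    edge-between : ∀ u v → T (adjacentᵛ p q u v) → ∃[ e ] Orientation p q e ⟦ u ⟧ ⟦ v ⟧
    edge-between u v uv = oriented-edge ⟦ u ⟧ ⟦ v ⟧
      (subst₂ (λ u v → T (adjacentᵛ p q u v)) (sym (decode-encode p q u)) (sym (decode-encode p q v)) uv)

    am-edge : ∀ i j → ∃[ e ] Orientation p q e ⟦ a i ⟧ ⟦ m i j ⟧
    am-edge i j = edge-between (a i) (m i j) (fromWitness {a? = i Fin.≟ i} refl)

    bm-edge : ∀ i j → ∃[ e ] Orientation p q e ⟦ b j ⟧ ⟦ m i j ⟧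
    bm-edge i j = edge-between (b j) (m i j) (fromWitness {a? = j Fin.≟ j} refl)

    kk-edge : ∀ c d → c ≢ d → ∃[ e ] Orientation p q e ⟦ k c ⟧ ⟦ k d ⟧
    kk-edge c d c≢d = edge-between (k c) (k d) (fromWitnessFalse {a? = c Fin.≟ d} c≢d)

    end⇒oriented-end : ∀ e u v → Orientation p q e u v → ∀ w → w isEndOf e → w ≡ u ⊎ w ≡ v
    end⇒oriented-end e u v (inj₁ (refl , refl)) w h        = h
    end⇒oriented-end e u v (inj₂ (refl , refl)) w (inj₁ h) = inj₂ h
    end⇒oriented-end e u v (inj₂ (refl , refl)) w (inj₂ h) = inj₁ h

    module _ (D : Drawing Gᵖ) where
      open Drawing D

      onEdge : ∀ e u v → Orientation p q e u v → ∀ x → x ∈[ pos u , pos v ] → x onEdge e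
      onEdge e u v (inj₁ (refl , refl)) x h = h
      onEdge e u v (inj₂ (refl , refl)) x h = ∈[]-sym x (pos u) (pos v) h

      -- The two edges have no end in common, so any point on both is a crossing.
      layering⇒¬meet : ∀ {l} {layer : Edge → Fin l} → Drawing.IsLayering D layer → ∀ e f u v u′ v′ →
        Orientation p q e u v → Orientation p q f u′ v′ → layer e ≡ layer f →
        u ≢ u′ → u ≢ v′ → v ≢ u′ → v ≢ v′ → ¬ Meet (pos u) (pos v) (pos u′) (pos v′)
      layering⇒¬meet layering e f u v u′ v′ o o′ same-layer u≢u′ u≢v′ v≢u′ v≢v′ (x , x∈e , x∈f) =
        layering e f e≢f same-layer
          (x , onEdge e u v o x x∈e , onEdge f u′ v′ o′ x x∈f , λ (w , w∈e , w∈f , _) → no-common w w∈e w∈f)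
        where
        no-common : ∀ w → w isEndOf e → ¬ (w isEndOf f)
        no-common w w∈e w∈f with end⇒oriented-end e u v o w w∈e | end⇒oriented-end f u′ v′ o′ w w∈f
        ... | inj₁ refl | inj₁ refl = u≢u′ refl
        ... | inj₁ refl | inj₂ refl = u≢v′ refl
        ... | inj₂ refl | inj₁ refl = v≢u′ refl
        ... | inj₂ refl | inj₂ refl = v≢v′ refl
        e≢f : e ≢ f
        e≢f refl = no-common (Edge.src e) (inj₁ refl) (inj₁ refl)

    ¬drawable₀ : ¬ DrawableIn Gᵖ 0
    ¬drawable₀ (D , layer , _) = Finₚ.¬Fin0 (layer (proj₁ (kk-edge 0F 1F λ ())))

    ¬drawable₁ : ¬ DrawableIn Gᵖ 1
    ¬drawable₁ (D , layer , layering) = K₅-crosses (λ c → pos ⟦ k c ⟧)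
      (λ c d c≢d → distinct ⟦ k c ⟧ ⟦ k d ⟧ (k-≢ c≢d)) K₅-avoids K₅-no-meet
      where
      open Drawing D
      k-≢ : ∀ {c d} → c ≢ d → ⟦ k c ⟧ ≢ ⟦ k d ⟧
      k-≢ {c} {d} c≢d = ⟦⟧-≢ (k c) (k d) λ { refl → c≢d refl }
      K₅-avoids : ∀ c d e → c ≢ d → e ≢ c → e ≢ d → ¬ pos ⟦ k e ⟧ ∈[ pos ⟦ k c ⟧ , pos ⟦ k d ⟧ ]
      K₅-avoids c d e c≢d e≢c e≢d h with kk-edge c d c≢d
      ... | f , o = avoids f ⟦ k e ⟧ not-end (onEdge D f ⟦ k c ⟧ ⟦ k d ⟧ o (pos ⟦ k e ⟧) h)
        where
        not-end : ¬ (⟦ k e ⟧ isEndOf f)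
        not-end end with end⇒oriented-end f ⟦ k c ⟧ ⟦ k d ⟧ o ⟦ k e ⟧ end
        ... | inj₁ eq = k-≢ e≢c eq
        ... | inj₂ eq = k-≢ e≢d eq
      same : ∀ (l l′ : Fin 1) → l ≡ l′
      same 0F 0F = refl
      K₅-no-meet : ∀ c d c′ d′ → c ≢ d → c ≢ c′ → c ≢ d′ → d ≢ c′ → d ≢ d′ → c′ ≢ d′ →
        ¬ Meet (pos ⟦ k c ⟧) (pos ⟦ k d ⟧) (pos ⟦ k c′ ⟧) (pos ⟦ k d′ ⟧)
      K₅-no-meet c d c′ d′ c≢d c≢c′ c≢d′ d≢c′ d≢d′ c′≢d′ =
        layering⇒¬meet D layering (proj₁ e) (proj₁ f) ⟦ k c ⟧ ⟦ k d ⟧ ⟦ k c′ ⟧ ⟦ k d′ ⟧ (proj₂ e) (proj₂ f)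
          (same _ _) (k-≢ c≢c′) (k-≢ c≢d′) (k-≢ d≢c′) (k-≢ d≢d′)
        where
        e = kk-edge c d c≢d
        f = kk-edge c′ d′ c′≢d′

    geometric-thickness : GeometricThickness≡ Gᵖ 2
    geometric-thickness = drawable p q , λ where
      0                   d → ⊥-elim (¬drawable₀ d)
      1                   d → ⊥-elim (¬drawable₁ d)
      (ℕ.suc (ℕ.suc l)) _ → s≤s (s≤s z≤n)

    module _ (D : Drawing Gᵖ) (convex : ConvexPosition (Drawing.pos D))
      {l} (layer : Edge → Fin l) (layering : Drawing.IsLayering D layer)
      (r : Fin 3 → Fin p) (s : Fin 3 → Fin q) (r-distinct : Distinct r) (s-distinct : Distinct s)
      (a-layer : ∀ i j i′ j′ → layer (proj₁ (am-edge (r i) (s j))) ≡ layer (proj₁ (am-edge (r i′) (s j′))))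
      (b-layer : ∀ i j i′ j′ → layer (proj₁ (bm-edge (r i) (s j))) ≡ layer (proj₁ (bm-edge (r i′) (s j′)))) where

      open Drawing D using (pos; distinct)

      private
        a-≢ : ∀ i i′ → i ≢ i′ → ⟦ a (r i) ⟧ ≢ ⟦ a (r i′) ⟧
        a-≢ i i′ i≢i′ = ⟦⟧-≢ (a (r i)) (a (r i′)) λ eq → r-distinct i i′ i≢i′ (a-injective eq)
          where
          a-injective : ∀ {i i′} → a {p} {q} i ≡ a i′ → i ≡ i′
          a-injective refl = refl
        b-≢ : ∀ j j′ → j ≢ j′ → ⟦ b (s j) ⟧ ≢ ⟦ b (s j′) ⟧
        b-≢ j j′ j≢j′ = ⟦⟧-≢ (b (s j)) (b (s j′)) λ eq → s-distinct j j′ j≢j′ (b-injective eq)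
          where
          b-injective : ∀ {j j′} → b {p} {q} j ≡ b j′ → j ≡ j′
          b-injective refl = refl
        m-injective : ∀ {i i′ j j′} → m {p} {q} i j ≡ m i′ j′ → i ≡ i′ × j ≡ j′
        m-injective refl = refl , refl
        m-≢₁ : ∀ i i′ j j′ → i ≢ i′ → ⟦ m (r i) (s j) ⟧ ≢ ⟦ m (r i′) (s j′) ⟧
        m-≢₁ i i′ j j′ i≢i′ = ⟦⟧-≢ (m (r i) (s j)) (m (r i′) (s j′)) λ eq → r-distinct i i′ i≢i′ (proj₁ (m-injective eq))
        m-≢₂ : ∀ i i′ j j′ → j ≢ j′ → ⟦ m (r i) (s j) ⟧ ≢ ⟦ m (r i′) (s j′) ⟧
        m-≢₂ i i′ j j′ j≢j′ = ⟦⟧-≢ (m (r i) (s j)) (m (r i′) (s j′)) λ eq → s-distinct j j′ j≢j′ (proj₂ (m-injective eq))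
        a-≢-m : ∀ i i′ j → ⟦ a (r i) ⟧ ≢ ⟦ m (r i′) (s j) ⟧
        a-≢-m i i′ j = ⟦⟧-≢ (a (r i)) (m (r i′) (s j)) λ ()
        b-≢-m : ∀ j i j′ → ⟦ b (s j) ⟧ ≢ ⟦ m (r i) (s j′) ⟧
        b-≢-m j i j′ = ⟦⟧-≢ (b (s j)) (m (r i) (s j′)) λ ()

      same-layer-grid⇒⊥ : ⊥
      same-layer-grid⇒⊥ = ConvexFamily.no-grid pos distinct convex
        -- The viewpoint `o` must differ from all vertices of the grid; a vertex of `K₅` does.
        {⟦ k 0F ⟧} {λ i → ⟦ a (r i) ⟧} {λ j → ⟦ b (s j) ⟧} {λ i j → ⟦ m (r i) (s j) ⟧}
        (λ i → ⟦⟧-≢ (k 0F) (a (r i)) λ ()) (λ j → ⟦⟧-≢ (k 0F) (b (s j)) λ ())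
        (λ i j → ⟦⟧-≢ (k 0F) (m (r i) (s j)) λ ())
        a-≢-m b-≢-m a-≢ b-≢ m-≢₁ m-≢₂
        (λ i i′ j j′ i≢i′ → layering⇒¬meet D layering
          (proj₁ (am-edge (r i) (s j))) (proj₁ (am-edge (r i′) (s j′)))
          ⟦ a (r i) ⟧ ⟦ m (r i) (s j) ⟧ ⟦ a (r i′) ⟧ ⟦ m (r i′) (s j′) ⟧
          (proj₂ (am-edge (r i) (s j))) (proj₂ (am-edge (r i′) (s j′))) (a-layer i j i′ j′)
          (a-≢ i i′ i≢i′) (a-≢-m i i′ j′) (≢-sym (a-≢-m i′ i j)) (m-≢₁ i i′ j j′ i≢i′))
        (λ i i′ j j′ j≢j′ → layering⇒¬meet D layering
          (proj₁ (bm-edge (r i) (s j))) (proj₁ (bm-edge (r i′) (s j′)))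
          ⟦ b (s j) ⟧ ⟦ m (r i) (s j) ⟧ ⟦ b (s j′) ⟧ ⟦ m (r i′) (s j′) ⟧
          (proj₂ (bm-edge (r i) (s j))) (proj₂ (bm-edge (r i′) (s j′))) (b-layer i j i′ j′)
          (b-≢ j j′ j≢j′) (b-≢-m j i′ j′) (≢-sym (b-≢-m j′ i j)) (m-≢₂ i i′ j j′ j≢j′))

  -- The graph is fixed before the number `l` of layers is known. If `l < t`, layers embed into
  -- `Fin t`, and the layers of the two halves of an edge combine into one of `t * t` colours; a
  -- monochromatic grid then has each family of halves in a single layer.
  book-thickness : ∀ p q t →
    (∀ (f : Fin p → Fin q → Fin (t ℕ.* t)) →
      ∃[ r ] ∃[ s ] (Distinct r × Distinct s × ∀ i j → f (r i) (s j) ≡ f (r 0F) (s 0F))) →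
    BookThickness≥ (G p q) t
  book-thickness p q t grid l (D , convex , layer , layering) = ℕₚ.≮⇒≥ contradiction
    where
    contradiction : ¬ l ℕ.< t
    contradiction l<t = same-layer (grid (λ i j → Fin.combine (a-layer i j) (b-layer i j)))
      where
      a-layer b-layer : Fin p → Fin q → Fin t
      a-layer i j = Fin.inject≤ (layer (proj₁ (am-edge p q i j))) (ℕₚ.<⇒≤ l<t)
      b-layer i j = Fin.inject≤ (layer (proj₁ (bm-edge p q i j))) (ℕₚ.<⇒≤ l<t)
      same-layer : ∃[ r ] ∃[ s ] (Distinct r × Distinct s × ∀ i j →
        Fin.combine (a-layer (r i) (s j)) (b-layer (r i) (s j)) ≡
        Fin.combine (a-layer (r 0F) (s 0F)) (b-layer (r 0F) (s 0F))) → ⊥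
      same-layer (r , s , r-distinct , s-distinct , same) =
        same-layer-grid⇒⊥ p q D convex layer layering r s r-distinct s-distinct
          (λ i j i′ j′ → Finₚ.inject≤-injective (ℕₚ.<⇒≤ l<t) (ℕₚ.<⇒≤ l<t)
            (layer (proj₁ (am-edge p q (r i) (s j)))) (layer (proj₁ (am-edge p q (r i′) (s j′))))
            (proj₁ (both i j i′ j′)))
          (λ i j i′ j′ → Finₚ.inject≤-injective (ℕₚ.<⇒≤ l<t) (ℕₚ.<⇒≤ l<t)
            (layer (proj₁ (bm-edge p q (r i) (s j)))) (layer (proj₁ (bm-edge p q (r i′) (s j′))))
            (proj₂ (both i j i′ j′)))
        where
        both : ∀ i j i′ j′ →
          a-layer (r i) (s j) ≡ a-layer (r i′) (s j′) × b-layer (r i) (s j) ≡ b-layer (r i′) (s j′)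
        both i j i′ j′ = Finₚ.combine-injective (a-layer (r i) (s j)) (b-layer (r i) (s j))
          (a-layer (r i′) (s j′)) (b-layer (r i′) (s j′)) (trans (same i j) (sym (same i′ j′)))

open import Defs using (Graph; GeometricThickness≡; BookThickness≥)
open import Data.Nat using (_≤_)

open Subdivision using (G)
open Pigeonhole using (rows; columns; monochromatic-grid)
open Thickness using (geometric-thickness; book-thickness)

mainTheorem1 : (t : ℕ) → 1 ≤ t → Σ[ G ∈ Graph ] (GeometricThickness≡ G 2 × BookThickness≥ G t)
mainTheorem1 t _ =
    G (rows (t ℕ.* t)) (columns (t ℕ.* t))
  , geometric-thickness (rows (t ℕ.* t)) (columns (t ℕ.* t))
  , book-thickness (rows (t ℕ.* t)) (columns (t ℕ.* t)) t monochromatic-grid
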